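{- Let $d$ be a non-negative integer. Then there are infinitely many primes $p$ with $p\equiv 1\pmod 4$ such that $\mathrm{Rab}_{\geq}(P_p,d)<\lfloor \mathrm{Haem}_{\geq}(P_p,d)\rfloor$.
   Context: For a prime $p\equiv1\pmod4$, the Paley graph $P_p$ has vertex set $\mathbb F_p$, two vertices being adjacent iff their difference is a nonzero square in $\mathbb F_p$; it is strongly regular with parameters $(v,k,\lambda,\mu)=(p,(p-1)/2,(p-5)/4,(p-1)/4)$ (i.e. $v$ vertices, $k$-regular, adjacent vertices have $\lambda$ common neighbours, distinct non-adjacent vertices have $\mu$ common neighbours), with restricted eigenvalues $\rho>\sigma$ the roots of $t^2-(\lambda-\mu)t-(k-\mu)=0$, namely $\sigma=(-\sqrt p-1)/2$. For such a graph $\Gamma$ and non-negative integer $d$: $\mathrm{Haem}_{\geq}(\Gamma,d)=v\frac{d-\sigma}{k-\sigma}$; $R_\Gamma(x,y,d)=x(x+1)(v-y)-2xyk+(2x+\lambda-\mu+1)yd+y(y-1)\mu-yd^2$; $S_d=\{y\in\{d+1,\dots,v\}: R_\Gamma(x,y,d)\ge0\text{ for all integers }x\}$; $\mathrm{Rab}_{\geq}(\Gamma,d)=\max S_d$ if $S_d\ne\emptyset$, else $0$. -}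

module Defs where

open import Data.Nat as ℕ using (ℕ; _%_; _/_; _∸_)
open import Data.Integer as ℤ using (ℤ; +_; _+_; _-_; _*_; -_; _≤_; _<_)
open import Data.Product using (_×_; Σ; ∃-syntax)
open import Data.Sum using (_⊎_)
open import Relation.Nullary using (¬_)

paley-v : ℕ → ℤ
paley-v p = + p

paley-k : ℕ → ℤ
paley-k p = + ((p ∸ 1) / 2)

paley-λ : ℕ → ℤ
paley-λ p = + ((p ∸ 5) / 4)

paley-μ : ℕ → ℤ
paley-μ p = + ((p ∸ 1) / 4)

R : ℕ → ℤ → ℤ → ℤ → ℤ
R p x y d =
  x * (x + + 1) * (paley-v p - y)
  - + 2 * x * y * paley-k p
  + (+ 2 * x + paley-λ p - paley-μ p + + 1) * y * d
  + y * (y - + 1) * paley-μ p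
  - y * d * d

InS : ℕ → ℕ → ℕ → Set
InS p d y = (d ℕ.< y) × (y ℕ.≤ p) × (∀ (x : ℤ) → + 0 ≤ R p x (+ y) (+ d))

IsRab : ℕ → ℕ → ℕ → Set
IsRab p d r =
  (InS p d r × (∀ y → InS p d y → y ℕ.≤ r))
  ⊎ ((∀ y → ¬ InS p d y) × r ≡ℕ 0)
  where
    open import Relation.Binary.PropositionalEquality using () renaming (_≡_ to _≡ℕ_)

-- SqrtLe p a b  ⟺  a·√p ≤ b  (real inequality, for integers a, b and p ≥ 0),
-- expressed with integer arithmetic only.
SqrtLe : ℕ → ℤ → ℤ → Set
SqrtLe p a b =
  (a ≤ + 0 × (+ 0 ≤ b ⊎ b * b ≤ a * a * + p))
  ⊎ (+ 0 < a × + 0 ≤ b × a * a * + p ≤ b * b)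

-- LeHaem p d n  ⟺  n ≤ Haem_≥(P_p,d) = v (d - σ)/(k - σ), σ = (-√p - 1)/2.
-- Since k - σ > 0:  n ≤ Haem ⟺ n(2k - 2σ) ≤ v(2d - 2σ)
--   ⟺ n(2k + 1 + √p) ≤ v(2d + 1 + √p) ⟺ (n - v)√p ≤ v(2d+1) - n(2k+1).
LeHaem : ℕ → ℕ → ℤ → Set
LeHaem p d n =
  SqrtLe p (n - paley-v p)
           (paley-v p * (+ 2 * + d + + 1) - n * (+ 2 * paley-k p + + 1))

IsFloorHaem : ℕ → ℕ → ℤ → Set
IsFloorHaem p d n = LeHaem p d n × ¬ LeHaem p d (n + + 1)

{-# OPTIONS --safe #-}
{-
Everything depends on √p modulo 2.  If p = 4m + 1 and 8j² + j ≤ 2p ≤ 8j² + 3j with j large in terms of d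
(thus √p is about 2j + θ with θ between 1/8 and 3/8), then ⌊Haem⌋ = 2j + 2d, while every
y ≥ 2j + 2d violates the inequality defining S_d at x = ⌊y / 2⌋.  So infinitely many primes p ≡ 1 (mod 4) of
this shape are needed.

Let w_t be the indicator of an arc of ℝ/2ℤ shifted by t, minus its mean.  Averaged over t, the correlation of
n ↦ w_t(√(q m₁ n)) and n ↦ w_t(√(q m₂ n)) depends only on the phase (√m₁ − √m₂) √(q n), which advances slowly and
almost uniformly on a short interval; by Cauchy–Schwarz the bilinear sums Σ a_m b_n w_t(√(q m n)) are therefore
small.  Buchstab's identity, iterated only for sifting divisors below D, writes the primes of a short interval in
terms of such bilinear sums and of plain sums over the multiples of some e < D.  Hence if the primes ≡ 1 (mod 4)
of the interval all avoided the wanted arc, there would be very few of them.  On the other hand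
r(n) = Σ_{d ∣ n} χ₄(d) is nonnegative, has mean value between 2/3 and 1 and satisfies Hecke's relation, so that
Σ r(n) log n forces Σ log p / p over the primes p ≡ 1 (mod 4) to diverge.
-}
module Submission where

import Data.Bool as Bool
open import Data.Nat
open import Data.Nat.Properties
open import Data.Nat.DivMod
open import Data.Nat.Divisibility
open import Data.Nat.Tactic.RingSolver using (solve-∀)
open import Data.Nat.Primality using (Prime; prime?; _Rough_)
import Data.Nat.Primality as ℙ
open import Data.Nat.Coprimality as Coprime using (coprime-divisor; prime⇒coprime)
open import Data.Nat.Primality.Factorisation using (factorise)
open import Data.Nat.ListAction using (product)
open import Data.List using ([]; _∷_)
open import Data.List.Relation.Unary.All using ([]; _∷_)
open import Data.Integer as ℤ using (ℤ; +_; -[1+_]; ∣_∣)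
import Data.Integer.Properties as ℤ
import Data.Integer.Tactic.RingSolver as ℤ-Solver
open import Data.Product using (_×_; _,_; proj₁; proj₂; ∃; ∃-syntax)
open import Data.Sum using (_⊎_; inj₁; inj₂)
open import Data.Empty using (⊥)
open import Function using (_∘_; case_of_)
open import Relation.Nullary using (¬_; Dec; yes; no; contradiction)
open import Relation.Nullary.Decidable using (_×-dec_; ¬?)
open import Relation.Binary.Definitions using (tri<; tri≈; tri>)
open import Relation.Binary.PropositionalEquality
import Algebra.Structures as Structures
import Algebra.Properties.AbelianGroup ℤ.+-0-abelianGroup as ℤ+

-- Finite sums

module FiniteSum {A : Set} {_⊕_ _⊗_ : A → A → A} {0# 1# : A}
  (isCSR : Structures.IsCommutativeSemiring _≡_ _⊕_ _⊗_ 0# 1#) where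

  open Structures.IsCommutativeSemiring isCSR
    using (distribˡ; distribʳ; zeroˡ; zeroʳ)
    renaming (+-assoc to ⊕-assoc; +-comm to ⊕-comm; +-identityˡ to ⊕-identityˡ; +-identityʳ to ⊕-identityʳ)

  sum : ℕ → (ℕ → A) → A
  sum zero    f = 0#
  sum (suc n) f = sum n f ⊕ f n

  sum-cong : ∀ n {f g} → (∀ i → i < n → f i ≡ g i) → sum n f ≡ sum n g
  sum-cong zero    h = refl
  sum-cong (suc n) h =
    cong₂ _⊕_ (sum-cong n λ i i<n → h i (m<n⇒m<1+n i<n)) (h n ≤-refl)

  sum-≗ : ∀ n {f g} → (∀ i → f i ≡ g i) → sum n f ≡ sum n g
  sum-≗ n h = sum-cong n λ i _ → h i

  sum-zero : ∀ n {f} → (∀ i → i < n → f i ≡ 0#) → sum n f ≡ 0#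
  sum-zero zero    h = refl
  sum-zero (suc n) h =
    trans (cong₂ _⊕_ (sum-zero n λ i i<n → h i (m<n⇒m<1+n i<n)) (h n ≤-refl)) (⊕-identityˡ 0#)

  ⊕-interchange : ∀ a b c d → (a ⊕ b) ⊕ (c ⊕ d) ≡ (a ⊕ c) ⊕ (b ⊕ d)
  ⊕-interchange a b c d = begin
    (a ⊕ b) ⊕ (c ⊕ d)  ≡⟨ ⊕-assoc a b _ ⟩
    a ⊕ (b ⊕ (c ⊕ d))  ≡⟨ cong (a ⊕_) (⊕-assoc b c d) ⟨
    a ⊕ ((b ⊕ c) ⊕ d)  ≡⟨ cong (λ z → a ⊕ (z ⊕ d)) (⊕-comm b c) ⟩
    a ⊕ ((c ⊕ b) ⊕ d)  ≡⟨ cong (a ⊕_) (⊕-assoc c b d) ⟩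
    a ⊕ (c ⊕ (b ⊕ d))  ≡⟨ ⊕-assoc a c _ ⟨
    (a ⊕ c) ⊕ (b ⊕ d)  ∎
    where open ≡-Reasoning

  sum-⊕ : ∀ n f g → sum n (λ i → f i ⊕ g i) ≡ sum n f ⊕ sum n g
  sum-⊕ zero    f g = sym (⊕-identityˡ 0#)
  sum-⊕ (suc n) f g =
    trans (cong (_⊕ (f n ⊕ g n)) (sum-⊕ n f g)) (⊕-interchange _ _ _ _)

  sum-⊗ˡ : ∀ n c f → sum n (λ i → c ⊗ f i) ≡ c ⊗ sum n f
  sum-⊗ˡ zero    c f = sym (zeroʳ c)
  sum-⊗ˡ (suc n) c f = trans (cong (_⊕ (c ⊗ f n)) (sum-⊗ˡ n c f)) (sym (distribˡ c _ _))

  sum-⊗ʳ : ∀ n c f → sum n (λ i → f i ⊗ c) ≡ sum n f ⊗ c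
  sum-⊗ʳ zero    c f = sym (zeroˡ c)
  sum-⊗ʳ (suc n) c f = trans (cong (_⊕ (f n ⊗ c)) (sum-⊗ʳ n c f)) (sym (distribʳ c _ _))

  sum-swap : ∀ m n (f : ℕ → ℕ → A) → sum m (λ i → sum n (λ j → f i j)) ≡ sum n (λ j → sum m (λ i → f i j))
  sum-swap zero    n f = sym (sum-zero n λ _ _ → refl)
  sum-swap (suc m) n f =
    trans (cong (_⊕ sum n (f m)) (sum-swap m n f)) (sym (sum-⊕ n _ _))

  sum-product : ∀ m n f g → sum m f ⊗ sum n g ≡ sum m (λ i → sum n (λ j → f i ⊗ g j))
  sum-product m n f g =
    trans (sym (sum-⊗ʳ m (sum n g) f)) (sum-≗ m λ i → sym (sum-⊗ˡ n (f i) g))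

  sum-split : ∀ m n f → sum (m + n) f ≡ sum m f ⊕ sum n (λ i → f (m + i))
  sum-split m zero    f rewrite +-identityʳ m = sym (⊕-identityʳ _)
  sum-split m (suc n) f rewrite +-suc m n =
    trans (cong (_⊕ f (m + n)) (sum-split m n f)) (⊕-assoc _ _ _)

  sum-blocks : ∀ a b f → sum (a * b) f ≡ sum a (λ j → sum b (λ r → f (j * b + r)))
  sum-blocks zero    b f = refl
  sum-blocks (suc a) b f rewrite +-comm b (a * b) =
    trans (sum-split (a * b) b f) (cong (_⊕ sum b (λ r → f (a * b + r))) (sum-blocks a b f))

  sum-extend : ∀ {m n} f → m ≤ n → (∀ i → m ≤ i → f i ≡ 0#) → sum n f ≡ sum m f
  sum-extend {m} {n} f m≤n h = begin
    sum n f                                      ≡⟨ cong (λ k → sum k f) (m+[n∸m]≡n m≤n) ⟨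
    sum (m + (n ∸ m)) f                          ≡⟨ sum-split m (n ∸ m) f ⟩
    sum m f ⊕ sum (n ∸ m) (λ i → f (m + i))      ≡⟨ cong (sum m f ⊕_) (sum-zero (n ∸ m) λ i _ → h (m + i) (m≤m+n m i)) ⟩
    sum m f ⊕ 0#                                 ≡⟨ ⊕-identityʳ _ ⟩
    sum m f                                      ∎
    where open ≡-Reasoning

  sum-window : ∀ {N} κ ν f → κ + ν ≤ N → (∀ i → i < κ → f i ≡ 0#) → (∀ i → κ + ν ≤ i → f i ≡ 0#) →
               sum N f ≡ sum ν (λ k → f (κ + k))
  sum-window {N} κ ν f le below above = begin
    sum N f                               ≡⟨ sum-extend f le above ⟩
    sum (κ + ν) f                         ≡⟨ sum-split κ ν f ⟩
    sum κ f ⊕ sum ν (λ k → f (κ + k))     ≡⟨ cong (_⊕ sum ν (λ k → f (κ + k))) (sum-zero κ below) ⟩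
    0# ⊕ sum ν (λ k → f (κ + k))          ≡⟨ ⊕-identityˡ _ ⟩
    sum ν (λ k → f (κ + k))               ∎
    where open ≡-Reasoning

  sum-head : ∀ n f → sum (suc n) f ≡ f 0 ⊕ sum n (λ i → f (suc i))
  sum-head n f = trans (sum-split 1 n f) (cong (_⊕ sum n (λ i → f (suc i))) (⊕-identityˡ (f 0)))

  sum-single : ∀ {n} f k → k < n → (∀ i → i < n → i ≢ k → f i ≡ 0#) → sum n f ≡ f k
  sum-single {suc n} f k k<1+n h with k ≟ n
  ... | yes refl = trans (cong (_⊕ f n) (sum-zero n λ i i<n → h i (m<n⇒m<1+n i<n) (<⇒≢ i<n))) (⊕-identityˡ _)
  ... | no  k≢n  =
    trans (cong₂ _⊕_ (sum-single f k (≤∧≢⇒< (≤-pred k<1+n) k≢n) λ i i<n → h i (m<n⇒m<1+n i<n))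
                     (h n ≤-refl (k≢n ∘ sym)))
          (⊕-identityʳ _)

  sum-multiples : ∀ N w → .{{_ : NonZero w}} → ∀ f → (∀ n → ¬ w ∣ n → f n ≡ 0#) → (∀ n → N ≤ n → f n ≡ 0#) →
                  sum N f ≡ sum N (λ m → f (w * m))
  sum-multiples N w f off above = begin
    sum N f                                       ≡⟨ sum-extend f (m≤m*n N w) above ⟨
    sum (N * w) f                                 ≡⟨ sum-blocks N w f ⟩
    sum N (λ j → sum w (λ r → f (j * w + r)))     ≡⟨ sum-≗ N inner ⟩
    sum N (λ m → f (w * m))                       ∎
    where
    open ≡-Reasoning
    inner : ∀ j → sum w (λ r → f (j * w + r)) ≡ f (w * j)
    inner j = trans
      (sum-single (λ r → f (j * w + r)) 0 (>-nonZero⁻¹ w) λ r r<w r≢0 → off _ λ w∣ →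
        r≢0 (n∣m∧m<n⇒m≡0 (∣m+n∣m⇒∣n w∣ (n∣m*n j)) r<w))
      (cong f (trans (+-identityʳ (j * w)) (*-comm j w)))
      where
      n∣m∧m<n⇒m≡0 : ∀ {m n} → n ∣ m → m < n → m ≡ 0
      n∣m∧m<n⇒m≡0 {zero}  _   _   = refl
      n∣m∧m<n⇒m≡0 {suc m} n∣m m<n = contradiction (∣⇒≤ n∣m) (<⇒≱ m<n)

module ℕ∑ = FiniteSum +-*-isCommutativeSemiring
module ℤ∑ = FiniteSum (Structures.IsCommutativeRing.isCommutativeSemiring ℤ.+-*-isCommutativeRing)

∑ : ℕ → (ℕ → ℕ) → ℕ
∑ = ℕ∑.sum

∑ᶻ : ℕ → (ℕ → ℤ) → ℤ
∑ᶻ = ℤ∑.sum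

∑-mono : ∀ n {f g} → (∀ i → i < n → f i ≤ g i) → ∑ n f ≤ ∑ n g
∑-mono zero    h = z≤n
∑-mono (suc n) h = +-mono-≤ (∑-mono n λ i i<n → h i (m<n⇒m<1+n i<n)) (h n ≤-refl)

∑-const : ∀ n c → ∑ n (λ _ → c) ≡ n * c
∑-const zero    c = refl
∑-const (suc n) c = trans (cong (_+ c) (∑-const n c)) (+-comm (n * c) c)

∑-≤-const : ∀ n {f} c → (∀ i → i < n → f i ≤ c) → ∑ n f ≤ n * c
∑-≤-const n c h = ≤-trans (∑-mono n h) (≤-reflexive (∑-const n c))

∑-mono-range : ∀ {m n} f → m ≤ n → ∑ m f ≤ ∑ n f
∑-mono-range {m} {n} f m≤n = begin
  ∑ m f                                    ≤⟨ m≤m+n _ _ ⟩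
  ∑ m f + ∑ (n ∸ m) (λ i → f (m + i))      ≡⟨ ℕ∑.sum-split m (n ∸ m) f ⟨
  ∑ (m + (n ∸ m)) f                        ≡⟨ cong (λ k → ∑ k f) (m+[n∸m]≡n m≤n) ⟩
  ∑ n f                                    ∎
  where open ≤-Reasoning

∑-term : ∀ {n} f {k} → k < n → f k ≤ ∑ n f
∑-term {n} f {k} k<n = ≤-trans (m≤n+m (f k) (∑ k f)) (∑-mono-range f k<n)

∣∑ᶻ∣≤ : ∀ n f → ∣ ∑ᶻ n f ∣ ≤ ∑ n (λ i → ∣ f i ∣)
∣∑ᶻ∣≤ zero    f = z≤n
∣∑ᶻ∣≤ (suc n) f = ≤-trans (ℤ.∣i+j∣≤∣i∣+∣j∣ (∑ᶻ n f) (f n)) (+-monoˡ-≤ ∣ f n ∣ (∣∑ᶻ∣≤ n f))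

∣∑ᶻ∣≤-const : ∀ n {f} c → (∀ i → i < n → ∣ f i ∣ ≤ c) → ∣ ∑ᶻ n f ∣ ≤ n * c
∣∑ᶻ∣≤-const n c h = ≤-trans (∣∑ᶻ∣≤ n _) (∑-≤-const n c h)

∑ᶻ-+ : ∀ n f → ∑ᶻ n (λ i → + f i) ≡ + ∑ n f
∑ᶻ-+ zero    f = refl
∑ᶻ-+ (suc n) f = cong (ℤ._+ + f n) (∑ᶻ-+ n f)

∑ᶻ-neg : ∀ n f → ∑ᶻ n (λ i → ℤ.- f i) ≡ ℤ.- ∑ᶻ n f
∑ᶻ-neg zero    f = refl
∑ᶻ-neg (suc n) f = trans (cong (ℤ._+ (ℤ.- f n)) (∑ᶻ-neg n f)) (sym (ℤ.neg-distrib-+ (∑ᶻ n f) (f n)))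

∑ᶻ-sub : ∀ n f g → ∑ᶻ n (λ i → f i ℤ.- g i) ≡ ∑ᶻ n f ℤ.- ∑ᶻ n g
∑ᶻ-sub n f g = trans (ℤ∑.sum-⊕ n f (λ i → ℤ.- g i)) (cong (λ z → ∑ᶻ n f ℤ.+ z) (∑ᶻ-neg n g))

2mn≤m²+n² : ∀ m n → 2 * (m * n) ≤ m * m + n * n
2mn≤m²+n² m n with ≤-total m n
... | inj₁ m≤n with k , refl ← m≤n⇒∃[o]m+o≡n m≤n =
  m+n≤o⇒m≤o _ {k * k} (≤-reflexive (eq m k))
  where eq : ∀ m k → 2 * (m * (m + k)) + k * k ≡ m * m + (m + k) * (m + k)
        eq = solve-∀
... | inj₂ n≤m with k , refl ← m≤n⇒∃[o]m+o≡n n≤m =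
  m+n≤o⇒m≤o _ {k * k} (≤-reflexive (eq n k))
  where eq : ∀ n k → 2 * ((n + k) * n) + k * k ≡ (n + k) * (n + k) + n * n
        eq = solve-∀

cauchy-schwarz : ∀ n f → ∑ n f * ∑ n f ≤ n * ∑ n (λ i → f i * f i)
cauchy-schwarz zero    f = z≤n
cauchy-schwarz (suc n) f = begin
  (S + a) * (S + a)                  ≡⟨ eq₁ S a ⟩
  S * S + 2 * S * a + a * a          ≤⟨ +-monoˡ-≤ (a * a) (+-mono-≤ (cauchy-schwarz n f) cross) ⟩
  n * T + (T + n * (a * a)) + a * a  ≡⟨ eq₂ n T a ⟩
  suc n * (T + a * a)                ∎
  where
  open ≤-Reasoning
  S = ∑ n f
  T = ∑ n (λ i → f i * f i)
  a = f n
  eq₁ : ∀ S a → (S + a) * (S + a) ≡ S * S + 2 * S * a + a * a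
  eq₁ = solve-∀
  eq₂ : ∀ n T a → n * T + (T + n * (a * a)) + a * a ≡ suc n * (T + a * a)
  eq₂ = solve-∀
  cross : 2 * S * a ≤ T + n * (a * a)
  cross = begin
    2 * S * a                          ≡⟨ trans (*-assoc 2 S a) (cong (2 *_) (sym (ℕ∑.sum-⊗ʳ n a f))) ⟩
    2 * ∑ n (λ i → f i * a)            ≡⟨ ℕ∑.sum-⊗ˡ n 2 (λ i → f i * a) ⟨
    ∑ n (λ i → 2 * (f i * a))          ≤⟨ ∑-mono n (λ i _ → 2mn≤m²+n² (f i) a) ⟩
    ∑ n (λ i → f i * f i + a * a)      ≡⟨ ℕ∑.sum-⊕ n _ _ ⟩
    T + ∑ n (λ _ → a * a)              ≡⟨ cong (λ z → T + z) (∑-const n (a * a)) ⟩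
    T + n * (a * a)                    ∎

∑-average : ∀ n → .{{_ : NonZero n}} → ∀ {f} A → (∀ i → i < n → n * f i ≤ A) → ∑ n f ≤ A
∑-average n {f} A h = *-cancelˡ-≤ n (begin
  n * ∑ n f              ≡⟨ ℕ∑.sum-⊗ˡ n n f ⟨
  ∑ n (λ i → n * f i)    ≤⟨ ∑-≤-const n A h ⟩
  n * A                  ∎)
  where open ≤-Reasoning

∑-harmonic : ∀ L f A → f 0 ≡ 0 → (∀ j → j * f j ≤ A) → ∑ (2 ^ L) f ≤ L * A
∑-harmonic zero    f A f0 h = ≤-reflexive f0
∑-harmonic (suc L) f A f0 h = begin
  ∑ (2 ^ suc L) f                                  ≡⟨ cong (λ k → ∑ k f) (cong (λ z → 2 ^ L + z) (+-identityʳ (2 ^ L))) ⟩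
  ∑ (2 ^ L + 2 ^ L) f                              ≡⟨ ℕ∑.sum-split (2 ^ L) (2 ^ L) f ⟩
  ∑ (2 ^ L) f + ∑ (2 ^ L) (λ i → f (2 ^ L + i))    ≤⟨ +-mono-≤ (∑-harmonic L f A f0 h) upper ⟩
  L * A + A                                        ≡⟨ +-comm (L * A) A ⟩
  suc L * A                                        ∎
  where
  open ≤-Reasoning
  instance _ = m^n≢0 2 L
  upper = ∑-average (2 ^ L) {λ i → f (2 ^ L + i)} A λ i _ →
    ≤-trans (*-monoˡ-≤ (f (2 ^ L + i)) (m≤m+n (2 ^ L) i)) (h (2 ^ L + i))

ι : ∀ {P : Set} → Dec P → ℤ
ι (yes _) = + 1
ι (no _)  = + 0

ι-yes : ∀ {P : Set} {d : Dec P} → P → ι d ≡ + 1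
ι-yes {d = yes _} _ = refl
ι-yes {d = no ¬p} p = contradiction p ¬p

ι-no : ∀ {P : Set} {d : Dec P} → ¬ P → ι d ≡ + 0
ι-no {d = yes p} ¬p = contradiction p ¬p
ι-no {d = no _}  _  = refl

∣ι∣≤1 : ∀ {P : Set} (d : Dec P) → ∣ ι d ∣ ≤ 1
∣ι∣≤1 (yes _) = ≤-refl
∣ι∣≤1 (no _)  = z≤n

ι-×-dec : ∀ {P Q : Set} (d : Dec P) (e : Dec Q) → ι (d ×-dec e) ≡ ι d ℤ.* ι e
ι-×-dec (yes _) (yes _) = refl
ι-×-dec (yes _) (no _)  = refl
ι-×-dec (no _)  (yes _) = refl
ι-×-dec (no _)  (no _)  = refl

ι-cong : ∀ {P Q : Set} (d : Dec P) (e : Dec Q) → (P → Q) → (Q → P) → ι d ≡ ι e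
ι-cong (yes p) e f g = sym (ι-yes (f p))
ι-cong (no ¬p) e f g = sym (ι-no (¬p ∘ g))

-- A convex set of indices is an interval.
∑ᶻ-convex : ∀ {P : ℕ → Set} (P? : ∀ k → Dec (P k)) →
  (∀ {i j k} → i ≤ j → j ≤ k → P i → P k → P j) →
  ∀ ν f → ∃[ α ] ∃[ K ] (α + K ≤ ν × (∀ j → j < K → P (α + j)) ×
    ∑ᶻ ν (λ k → ι (P? k) ℤ.* f k) ≡ ∑ᶻ K (λ j → f (α + j)))
∑ᶻ-convex {P} P? convex ν f with go ν
  where
  go : ∀ ν → ∃[ α ] ∃[ K ] (α + K ≤ ν × (∀ j → j < K → P (α + j)) ×
    (∀ k → k < ν → P k → α ≤ k × k < α + K) ×
    ∑ᶻ ν (λ k → ι (P? k) ℤ.* f k) ≡ ∑ᶻ K (λ j → f (α + j)))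
  go zero = 0 , 0 , z≤n , (λ _ ()) , (λ _ ()) , refl
  go (suc ν) with go ν | P? ν
  ... | α , K , le , inP , cover , eq | no ¬Pν =
    α , K , m≤n⇒m≤1+n le , inP ,
    (λ k k<1+ν Pk → cover k (≤∧≢⇒< (≤-pred k<1+ν) λ { refl → ¬Pν Pk }) Pk) ,
    trans (ℤ.+-identityʳ _) eq
  ... | α , zero , le , inP , cover , eq | yes Pν =
    ν , 1 , ≤-reflexive (+-comm ν 1) ,
    (λ { zero _ → subst P (sym (+-identityʳ ν)) Pν ; (suc j) (s≤s ()) }) ,
    (λ k k<1+ν Pk → case m≤n⇒m<n∨m≡n (≤-pred k<1+ν) of λ
      { (inj₁ k<ν) → let α≤k , k<α = cover k k<ν Pk in
          contradiction (subst (k <_) (+-identityʳ α) k<α) (≤⇒≯ α≤k)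
      ; (inj₂ refl) → ≤-refl , ≤-reflexive (+-comm 1 k) }) ,
    trans (cong₂ ℤ._+_ eq (ℤ.*-identityˡ (f ν)))
          (cong (λ z → + 0 ℤ.+ f z) (sym (+-identityʳ ν)))
  ... | α , suc K , le , inP , cover , eq | yes Pν =
    α , suc (suc K) , ≤-reflexive (trans (+-suc α (suc K)) (cong suc top)) ,
    (λ j j<2+K → case m≤n⇒m<n∨m≡n (≤-pred j<2+K) of λ
      { (inj₁ j<1+K) → inP j j<1+K ; (inj₂ refl) → subst P (sym top) Pν }) ,
    (λ k k<1+ν Pk → case m≤n⇒m<n∨m≡n (≤-pred k<1+ν) of λ
      { (inj₁ k<ν) → let α≤k , k< = cover k k<ν Pk in
          α≤k , <-≤-trans k< (+-monoʳ-≤ α (n≤1+n (suc K)))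
      ; (inj₂ refl) → ≤-trans (m≤m+n α _) le ,
          ≤-reflexive (trans (cong suc (sym top)) (sym (+-suc α (suc K)))) }) ,
    cong₂ ℤ._+_ eq (trans (ℤ.*-identityˡ (f ν)) (cong f (sym top)))
    where
    top : α + suc K ≡ ν
    top = ≤-antisym le (≮⇒≥ λ α+1+K<ν →
      contradiction (proj₂ (cover (α + suc K) α+1+K<ν
        (convex (+-monoʳ-≤ α z≤n) le (inP 0 z<s) Pν))) (<-irrefl refl))
... | α , K , le , inP , _ , eq = α , K , le , inP , eq

-- Periodic functions and phases

∑ᶻ-const : ∀ n c → ∑ᶻ n (λ _ → c) ≡ + n ℤ.* c
∑ᶻ-const zero    c = sym (ℤ.*-zeroˡ c)
∑ᶻ-const (suc n) c = trans (cong (ℤ._+ c) (∑ᶻ-const n c))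
  (trans (ℤ.+-comm (+ n ℤ.* c) c) (sym (ℤ.suc-* (+ n) c)))

∣i-j∣≤∣i∣+∣j∣ : ∀ i j → ∣ i ℤ.- j ∣ ≤ ∣ i ∣ + ∣ j ∣
∣i-j∣≤∣i∣+∣j∣ i j = subst (λ k → ∣ i ℤ.- j ∣ ≤ ∣ i ∣ + k) (ℤ.∣-i∣≡∣i∣ j) (ℤ.∣i+j∣≤∣i∣+∣j∣ i (ℤ.- j))

module Periodic (P : ℕ) .{{_ : NonZero P}} (f : ℕ → ℤ) (period : ∀ z → f (z + P) ≡ f z) where

  ∑-shift : ∀ a → ∑ᶻ P (λ t → f (a + t)) ≡ ∑ᶻ P f
  ∑-shift zero    = refl
  ∑-shift (suc a) = trans step (∑-shift a)
    where
    g = λ t → f (a + t)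
    step : ∑ᶻ P (λ t → f (suc a + t)) ≡ ∑ᶻ P g
    step = trans (ℤ∑.sum-≗ P λ t → cong f (sym (+-suc a t)))
      (ℤ+.∙-cancelˡ (g 0) _ _
        (trans (sym (ℤ∑.sum-head P g))
               (trans (cong (λ y → ∑ᶻ P g ℤ.+ y) (trans (period a) (cong f (sym (+-identityʳ a)))))
                      (ℤ.+-comm (∑ᶻ P g) (g 0)))))

  module _ (mean : ∑ᶻ P f ≡ + 0) where

    ∑-periods : ∀ q a → ∑ᶻ (q * P) (λ i → f (a + i)) ≡ + 0
    ∑-periods q a = trans (ℤ∑.sum-blocks q P _) (ℤ∑.sum-zero q λ j _ →
      trans (ℤ∑.sum-≗ P λ r → cong f (sym (+-assoc a (j * P) r)))
            (trans (∑-shift (a + j * P)) mean))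

    ∣∑-window∣≤ : ∀ M → (∀ z → ∣ f z ∣ ≤ M) → ∀ n a → ∣ ∑ᶻ n (λ i → f (a + i)) ∣ ≤ P * M
    ∣∑-window∣≤ M f≤M n a = begin
      ∣ ∑ᶻ n g ∣                                       ≡⟨ cong (λ k → ∣ ∑ᶻ k g ∣) (m≡m%n+[m/n]*n n P) ⟩
      ∣ ∑ᶻ (n % P + n / P * P) g ∣                     ≡⟨ cong ∣_∣ (ℤ∑.sum-split (n % P) (n / P * P) g) ⟩
      ∣ ∑ᶻ (n % P) g ℤ.+ ∑ᶻ (n / P * P) (λ i → g (n % P + i)) ∣
        ≡⟨ cong (λ y → ∣ ∑ᶻ (n % P) g ℤ.+ y ∣)
             (trans (ℤ∑.sum-≗ (n / P * P) λ i → cong f (sym (+-assoc a (n % P) i)))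
                    (∑-periods (n / P) (a + n % P))) ⟩
      ∣ ∑ᶻ (n % P) g ℤ.+ + 0 ∣                         ≡⟨ cong ∣_∣ (ℤ.+-identityʳ (∑ᶻ (n % P) g)) ⟩
      ∣ ∑ᶻ (n % P) g ∣                                 ≤⟨ ∣∑ᶻ∣≤-const (n % P) M (λ i _ → f≤M (a + i)) ⟩
      n % P * M                                        ≤⟨ *-monoˡ-≤ M (<⇒≤ (m%n<n n P)) ⟩
      P * M                                            ∎
      where
      open ≤-Reasoning
      g = λ i → f (a + i)

module Phase (R : ℕ) .{{_ : NonZero R}} where

  P : ℕ
  P = 16 * R

  instance
    P≢0 : NonZero P
    P≢0 = m*n≢0 16 R

  opaque
    w : ℕ → ℤ
    w z = + 16 ℤ.* ι (z % P <? R) ℤ.- + 1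

  opaque
    unfolding w

    w-in : ∀ {z} → z % P < R → w z ≡ + 15
    w-in {z} h rewrite ι-yes {d = z % P <? R} h = refl

    w-out : ∀ {z} → ¬ z % P < R → w z ≡ ℤ.- + 1
    w-out {z} h rewrite ι-no {d = z % P <? R} h = refl

    ∣w∣≤15 : ∀ z → ∣ w z ∣ ≤ 15
    ∣w∣≤15 z with z % P <? R
    ... | yes _ = ≤-refl
    ... | no  _ = s≤s z≤n

    w-period : ∀ z → w (z + P) ≡ w z
    w-period z = cong (λ y → + 16 ℤ.* ι (y <? R) ℤ.- + 1) ([m+n]%n≡m%n z P)

    w-bump : ∀ z → w z ≡ + 16 ℤ.* ι (z % P <? R) ℤ.- + 1
    w-bump z = refl

  R<P : R < P
  R<P = m<m+n R (>-nonZero⁻¹ (15 * R) {{m*n≢0 15 R}})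

  w-mean : ∑ᶻ P w ≡ + 0
  w-mean = begin
    ∑ᶻ (R + 15 * R) w                                         ≡⟨ ℤ∑.sum-split R (15 * R) w ⟩
    ∑ᶻ R w ℤ.+ ∑ᶻ (15 * R) (λ i → w (R + i))                  ≡⟨ cong₂ ℤ._+_ (ℤ∑.sum-cong R inside) (ℤ∑.sum-cong (15 * R) outside) ⟩
    ∑ᶻ R (λ _ → + 15) ℤ.+ ∑ᶻ (15 * R) (λ _ → ℤ.- + 1)         ≡⟨ cong₂ ℤ._+_ (∑ᶻ-const R (+ 15)) (∑ᶻ-const (15 * R) (ℤ.- + 1)) ⟩
    + R ℤ.* + 15 ℤ.+ + (15 * R) ℤ.* (ℤ.- + 1)                 ≡⟨ cong (λ y → + R ℤ.* + 15 ℤ.+ y ℤ.* (ℤ.- + 1)) (ℤ.pos-* 15 R) ⟩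
    + R ℤ.* + 15 ℤ.+ (+ 15 ℤ.* + R) ℤ.* (ℤ.- + 1)             ≡⟨ eq (+ R) ⟩
    + 0                                                       ∎
    where
    open ≡-Reasoning
    eq : ∀ r → r ℤ.* + 15 ℤ.+ (+ 15 ℤ.* r) ℤ.* (ℤ.- + 1) ≡ + 0
    eq = ℤ-Solver.solve-∀
    inside : ∀ i → i < R → w i ≡ + 15
    inside i i<R = w-in (subst (_< R) (sym (m<n⇒m%n≡m (<-trans i<R R<P))) i<R)
    outside : ∀ i → i < 15 * R → w (R + i) ≡ ℤ.- + 1
    outside i i<15R = w-out λ h → contradiction
      (subst (_< R) (m<n⇒m%n≡m (+-monoʳ-< R i<15R)) h) (≤⇒≯ (m≤m+n R i))

  open Periodic P w w-period

  H : ℕ → ℤ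
  H z = ∑ᶻ R (λ i → w (z + i))

  ∣H∣≤ : ∀ z → ∣ H z ∣ ≤ 15 * R
  ∣H∣≤ z = ≤-trans (∣∑ᶻ∣≤-const R 15 λ i _ → ∣w∣≤15 (z + i)) (≤-reflexive (*-comm R 15))

  H-suc : ∀ z → H (suc z) ℤ.- H z ≡ w (z + R) ℤ.- w z
  H-suc z = begin
    H (suc z) ℤ.- H z                  ≡⟨ cong (ℤ._- H z) (ℤ∑.sum-≗ R λ i → cong w (sym (+-suc z i))) ⟩
    A ℤ.- B                            ≡⟨ eq₁ A B (g 0) ⟩
    (g 0 ℤ.+ A) ℤ.- B ℤ.- g 0          ≡⟨ cong (λ y → y ℤ.- B ℤ.- g 0) (ℤ∑.sum-head R g) ⟨
    (B ℤ.+ g R) ℤ.- B ℤ.- g 0          ≡⟨ eq₂ B (g R) (g 0) ⟩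
    g R ℤ.- g 0                        ≡⟨ cong (λ y → g R ℤ.- w y) (+-identityʳ z) ⟩
    w (z + R) ℤ.- w z                  ∎
    where
    open ≡-Reasoning
    g = λ i → w (z + i)
    A = ∑ᶻ R (λ i → g (suc i))
    B = ∑ᶻ R g
    eq₁ : ∀ a b c → a ℤ.- b ≡ (c ℤ.+ a) ℤ.- b ℤ.- c
    eq₁ = ℤ-Solver.solve-∀
    eq₂ : ∀ a b c → (a ℤ.+ b) ℤ.- a ℤ.- c ≡ b ℤ.- c
    eq₂ = ℤ-Solver.solve-∀

  H-lipschitz : ∀ n z → ∣ H (z + n) ℤ.- H z ∣ ≤ n * 30
  H-lipschitz zero    z rewrite +-identityʳ z | ℤ.+-inverseʳ (H z) = z≤n
  H-lipschitz (suc n) z = begin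
    ∣ H (z + suc n) ℤ.- H z ∣                                          ≡⟨ cong ∣_∣ (trans (cong (λ y → H y ℤ.- H z) (+-suc z n)) (eq (H (suc (z + n))) (H (z + n)) (H z))) ⟩
    ∣ (H (suc (z + n)) ℤ.- H (z + n)) ℤ.+ (H (z + n) ℤ.- H z) ∣         ≤⟨ ℤ.∣i+j∣≤∣i∣+∣j∣ (H (suc (z + n)) ℤ.- H (z + n)) _ ⟩
    ∣ H (suc (z + n)) ℤ.- H (z + n) ∣ + ∣ H (z + n) ℤ.- H z ∣           ≤⟨ +-mono-≤ one (H-lipschitz n z) ⟩
    30 + n * 30                                                        ∎
    where
    open ≤-Reasoning
    eq : ∀ a b c → a ℤ.- c ≡ (a ℤ.- b) ℤ.+ (b ℤ.- c)
    eq = ℤ-Solver.solve-∀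
    one : ∣ H (suc (z + n)) ℤ.- H (z + n) ∣ ≤ 30
    one = ≤-trans (≤-reflexive (cong ∣_∣ (H-suc (z + n))))
      (≤-trans (∣i-j∣≤∣i∣+∣j∣ (w (z + n + R)) (w (z + n))) (+-mono-≤ (∣w∣≤15 (z + n + R)) (∣w∣≤15 (z + n))))

  ∣∑H∣≤ : ∀ n a → ∣ ∑ᶻ n (λ i → H (a + i)) ∣ ≤ 240 * (R * R)
  ∣∑H∣≤ n a = begin
    ∣ ∑ᶻ n (λ i → ∑ᶻ R (λ j → w (a + i + j))) ∣      ≡⟨ cong ∣_∣ (ℤ∑.sum-swap n R λ i j → w (a + i + j)) ⟩
    ∣ ∑ᶻ R (λ j → ∑ᶻ n (λ i → w (a + i + j))) ∣      ≤⟨ ∣∑ᶻ∣≤-const R (P * 15) (λ j _ → ≤-trans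
        (≤-reflexive (cong ∣_∣ (ℤ∑.sum-≗ n λ i → cong w (eq₁ a i j)))) (∣∑-window∣≤ w-mean 15 ∣w∣≤15 n (a + j))) ⟩
    R * (P * 15)                                     ≡⟨ eq₂ R ⟩
    240 * (R * R)                                    ∎
    where
    open ≤-Reasoning
    eq₁ : ∀ a i j → a + i + j ≡ a + j + i
    eq₁ = solve-∀
    eq₂ : ∀ r → r * (16 * r * 15) ≡ 240 * (r * r)
    eq₂ = solve-∀

  -- Averaging over all phase shifts t makes the correlation depend on the difference only.
  w-correlation : ∀ D a → ∑ᶻ P (λ t → w (D + a + t) ℤ.* w (a + t)) ≡ + 16 ℤ.* H D
  w-correlation D a = begin
    ∑ᶻ P (λ t → w (D + a + t) ℤ.* w (a + t))       ≡⟨ ℤ∑.sum-≗ P (λ t → cong (λ y → w y ℤ.* w (a + t)) (+-assoc D a t)) ⟩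
    ∑ᶻ P (λ t → f (a + t))                         ≡⟨ Periodic.∑-shift P f f-period a ⟩
    ∑ᶻ P f                                         ≡⟨ ℤ∑.sum-≗ P (λ t → trans (cong (w (D + t) ℤ.*_) (w-bump t)) (eq₁ (w (D + t)) (ι (t % P <? R)))) ⟩
    ∑ᶻ P (λ t → + 16 ℤ.* (ι (t % P <? R) ℤ.* w (D + t)) ℤ.- w (D + t))
                                                   ≡⟨ ∑ᶻ-sub P _ _ ⟩
    ∑ᶻ P (λ t → + 16 ℤ.* (ι (t % P <? R) ℤ.* w (D + t))) ℤ.- ∑ᶻ P (λ t → w (D + t))
                                                   ≡⟨ cong₂ ℤ._-_ (ℤ∑.sum-⊗ˡ P (+ 16) _) (trans (∑-shift D) w-mean) ⟩
    + 16 ℤ.* ∑ᶻ P (λ t → ι (t % P <? R) ℤ.* w (D + t)) ℤ.- + 0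
                                                   ≡⟨ ℤ.+-identityʳ _ ⟩
    + 16 ℤ.* ∑ᶻ P (λ t → ι (t % P <? R) ℤ.* w (D + t))
                                                   ≡⟨ cong (+ 16 ℤ.*_) (trans (ℤ∑.sum-split R (15 * R) _) (cong₂ ℤ._+_ (ℤ∑.sum-cong R inside) (ℤ∑.sum-zero (15 * R) outside))) ⟩
    + 16 ℤ.* (H D ℤ.+ + 0)                         ≡⟨ cong (+ 16 ℤ.*_) (ℤ.+-identityʳ (H D)) ⟩
    + 16 ℤ.* H D                                   ∎
    where
    open ≡-Reasoning
    f = λ t → w (D + t) ℤ.* w t
    f-period : ∀ z → f (z + P) ≡ f z
    f-period z = cong₂ ℤ._*_ (trans (cong w (sym (+-assoc D z P))) (w-period (D + z))) (w-period z)
    eq₁ : ∀ x i → x ℤ.* (+ 16 ℤ.* i ℤ.- + 1) ≡ + 16 ℤ.* (i ℤ.* x) ℤ.- x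
    eq₁ = ℤ-Solver.solve-∀
    inside : ∀ t → t < R → ι (t % P <? R) ℤ.* w (D + t) ≡ w (D + t)
    inside t t<R rewrite ι-yes {d = t % P <? R} (subst (_< R) (sym (m<n⇒m%n≡m (<-trans t<R R<P))) t<R) =
      ℤ.*-identityˡ _
    outside : ∀ i → i < 15 * R → ι ((R + i) % P <? R) ℤ.* w (D + (R + i)) ≡ + 0
    outside i i<15R rewrite ι-no {d = (R + i) % P <? R} (λ h → contradiction
      (subst (_< R) (m<n⇒m%n≡m (+-monoʳ-< R i<15R)) h) (≤⇒≯ (m≤m+n R i))) = ℤ.*-zeroˡ (w (D + (R + i)))

  h : ℕ → ℤ
  h z = H (z + 14 * R)

  h-out : ∀ z → ¬ (R ≤ z % P × z % P < 3 * R) → h z ≡ ℤ.- + R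
  h-out z out = begin
    ∑ᶻ R (λ i → w (z + 14 * R + i))   ≡⟨ ℤ∑.sum-cong R (λ i i<R → w-out (far i i<R)) ⟩
    ∑ᶻ R (λ _ → ℤ.- + 1)              ≡⟨ ∑ᶻ-const R (ℤ.- + 1) ⟩
    + R ℤ.* (ℤ.- + 1)                 ≡⟨ ℤ.*-comm (+ R) (ℤ.- + 1) ⟩
    ℤ.- + 1 ℤ.* + R                   ≡⟨ ℤ.-1*i≡-i (+ R) ⟩
    ℤ.- + R                           ∎
    where
    open ≡-Reasoning
    ρ = z % P
    reduce : ∀ i → (z + 14 * R + i) % P ≡ (ρ + 14 * R + i) % P
    reduce i = trans (cong (_% P) (trans (cong (λ y → y + 14 * R + i) (m≡m%n+[m/n]*n z P)) (eq ρ (z / P * P) (14 * R) i)))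
                     ([m+kn]%n≡m%n (ρ + 14 * R + i) (z / P) P)
      where eq : ∀ a b c d → a + b + c + d ≡ a + c + d + b
            eq = solve-∀
    far : ∀ i → i < R → ¬ (z + 14 * R + i) % P < R
    far i i<R small with R ≤? ρ | ρ <? 3 * R
    ... | yes R≤ρ | yes ρ<3R = out (R≤ρ , ρ<3R)
    ... | no R≰ρ  | _ = contradiction
      (subst (_< R) (trans (reduce i) (m<n⇒m%n≡m bound)) small) (≤⇒≯ (≤-trans (m≤m+n R (13 * R)) (≤-trans (m≤n+m (14 * R) ρ) (m≤m+n _ i))))
      where
      eq : ∀ r → r + 14 * r + r ≡ 16 * r
      eq = solve-∀
      bound : ρ + 14 * R + i < P
      bound = <-≤-trans (+-mono-≤-< (+-monoˡ-≤ (14 * R) (<⇒≤ (≰⇒> R≰ρ))) i<R) (≤-reflexive (eq R))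
    ... | yes _   | no ρ≮3R with k , ρ≡ ← m≤n⇒∃[o]m+o≡n (≮⇒≥ ρ≮3R) = contradiction
      (subst (_< R) (trans (reduce i) wrap) small) (≤⇒≯ (≤-trans (m≤m+n R k) (m≤m+n _ i)))
      where
      eq₁ : ∀ r k i → 3 * r + k + 14 * r + i ≡ r + k + i + 16 * r
      eq₁ = solve-∀
      eq₂ : ∀ r k i → 3 * r + k + i ≡ r + k + i + 2 * r
      eq₂ = solve-∀
      small′ : R + k + i < P
      small′ = +-cancelʳ-< (2 * R) (R + k + i) P (subst₂ _<_ (trans (cong (_+ i) (sym ρ≡)) (eq₂ R k i)) refl
        (+-mono-<-≤ (m%n<n z P) (≤-trans (<⇒≤ i<R) (m≤m+n R (1 * R)))))
      wrap : (ρ + 14 * R + i) % P ≡ R + k + i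
      wrap = trans (cong (_% P) (trans (cong (λ y → y + 14 * R + i) (sym ρ≡)) (eq₁ R k i)))
                   (trans ([m+n]%n≡m%n (R + k + i) P) (m<n⇒m%n≡m small′))

∣m-n∣≤ : ∀ m n {g} → m ≤ n + g → n ≤ m + g → ∣ + m ℤ.- + n ∣ ≤ g
∣m-n∣≤ m n {g} m≤n+g n≤m+g with ≤-total m n
... | inj₁ m≤n with k , refl ← m≤n⇒∃[o]m+o≡n m≤n =
  ≤-trans (≤-reflexive (trans (cong ∣_∣ (eq (+ m) (+ k))) (ℤ.∣-i∣≡∣i∣ (+ k)))) (+-cancelˡ-≤ m k g n≤m+g)
  where eq : ∀ a b → a ℤ.- (a ℤ.+ b) ≡ ℤ.- b
        eq = ℤ-Solver.solve-∀
... | inj₂ n≤m with k , refl ← m≤n⇒∃[o]m+o≡n n≤m =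
  ≤-trans (≤-reflexive (cong ∣_∣ (eq (+ n) (+ k)))) (+-cancelˡ-≤ n k g m≤n+g)
  where eq : ∀ a b → (a ℤ.+ b) ℤ.- a ≡ b
        eq = ℤ-Solver.solve-∀

∣+m*i∣ : ∀ m i → ∣ + m ℤ.* i ∣ ≡ m * ∣ i ∣
∣+m*i∣ m i = ℤ.∣i*j∣≡∣i∣*∣j∣ (+ m) i

module SlowPhase (R : ℕ) .{{_ : NonZero R}} where
  open Phase R

  ∑H-telescope : ∀ (D : ℕ → ℕ) K → (∀ k → k < K → D k ≤ D (suc k)) → D 0 ≤ D K ×
    ∑ᶻ K (λ k → ∑ᶻ (D (suc k) ∸ D k) (λ i → H (D k + i))) ≡ ∑ᶻ (D K ∸ D 0) (λ i → H (D 0 + i))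
  ∑H-telescope D zero    mono = ≤-refl , sym (cong (λ n → ∑ᶻ n (λ i → H (D 0 + i))) (n∸n≡0 (D 0)))
  ∑H-telescope D (suc K) mono with ∑H-telescope D K (λ k k<K → mono k (m<n⇒m<1+n k<K))
  ... | D0≤DK , eq = ≤-trans D0≤DK DK≤ , (begin
    ∑ᶻ K (λ k → ∑ᶻ (D (suc k) ∸ D k) (λ i → H (D k + i))) ℤ.+ ∑ᶻ Δ (λ i → H (D K + i))
      ≡⟨ cong (ℤ._+ ∑ᶻ Δ (λ i → H (D K + i))) eq ⟩
    ∑ᶻ (D K ∸ D 0) (λ i → H (D 0 + i)) ℤ.+ ∑ᶻ Δ (λ i → H (D K + i))
      ≡⟨ cong (λ y → ∑ᶻ (D K ∸ D 0) (λ i → H (D 0 + i)) ℤ.+ y) (ℤ∑.sum-≗ Δ λ i → cong H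
           (trans (cong (_+ i) (sym (m+[n∸m]≡n D0≤DK))) (+-assoc (D 0) _ i))) ⟩
    ∑ᶻ (D K ∸ D 0) (λ i → H (D 0 + i)) ℤ.+ ∑ᶻ Δ (λ i → H (D 0 + (D K ∸ D 0 + i)))
      ≡⟨ ℤ∑.sum-split (D K ∸ D 0) Δ (λ i → H (D 0 + i)) ⟨
    ∑ᶻ (D K ∸ D 0 + Δ) (λ i → H (D 0 + i))
      ≡⟨ cong (λ n → ∑ᶻ n (λ i → H (D 0 + i))) (trans (+-comm (D K ∸ D 0) Δ)
           (trans (sym (+-∸-assoc Δ D0≤DK)) (cong (_∸ D 0) (m∸n+n≡m DK≤)))) ⟩
    ∑ᶻ (D (suc K) ∸ D 0) (λ i → H (D 0 + i)) ∎)
    where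
    open ≡-Reasoning
    DK≤ = mono K ≤-refl
    Δ = D (suc K) ∸ D K

  -- Summation against a primitive of H: where D advances by about V/f, H(D k) is
  -- f/V times the sum of H over [D k , D (k+1)), up to the Lipschitz error.
  slow-sum : ∀ (D : ℕ → ℕ) K V f E → (∀ k → k < K → D k ≤ D (suc k)) →
    (∀ k → k < K → let Δ = D (suc k) ∸ D k in
       ∣ + (f * Δ) ℤ.- + V ∣ * (15 * R) + f * (Δ * (Δ * 30)) ≤ E) →
    V * ∣ ∑ᶻ K (λ k → H (D k)) ∣ ≤ f * (240 * (R * R)) + K * E
  slow-sum D K V f E mono err≤ = begin
    V * ∣ ∑ᶻ K (λ k → H (D k)) ∣               ≡⟨ trans (cong ∣_∣ (ℤ∑.sum-⊗ˡ K (+ V) (λ k → H (D k)))) (∣+m*i∣ V _) ⟨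
    ∣ ∑ᶻ K (λ k → + V ℤ.* H (D k)) ∣           ≡⟨ cong ∣_∣ (trans (ℤ∑.sum-≗ K pointwise) (∑ᶻ-sub K main err)) ⟩
    ∣ ∑ᶻ K main ℤ.- ∑ᶻ K err ∣                 ≤⟨ ∣i-j∣≤∣i∣+∣j∣ (∑ᶻ K main) (∑ᶻ K err) ⟩
    ∣ ∑ᶻ K main ∣ + ∣ ∑ᶻ K err ∣               ≤⟨ +-mono-≤ main≤ (∣∑ᶻ∣≤-const K E λ k k<K → ≤-trans (err-bound k) (err≤ k k<K)) ⟩
    f * (240 * (R * R)) + K * E                ∎
    where
    open ≤-Reasoning
    Δ : ℕ → ℕ
    Δ k = D (suc k) ∸ D k
    osc : ℕ → ℤ
    osc k = ∑ᶻ (Δ k) (λ i → H (D k + i) ℤ.- H (D k))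
    main err : ℕ → ℤ
    main k = + f ℤ.* ∑ᶻ (Δ k) (λ i → H (D k + i))
    err k = (+ (f * Δ k) ℤ.- + V) ℤ.* H (D k) ℤ.+ + f ℤ.* osc k
    pointwise : ∀ k → + V ℤ.* H (D k) ≡ main k ℤ.- err k
    pointwise k = sym (trans
      (cong₂ (λ x y → + f ℤ.* x ℤ.- ((y ℤ.- + V) ℤ.* H (D k) ℤ.+ + f ℤ.* osc k))
        window (ℤ.pos-* f (Δ k)))
      (eq (+ f) (+ Δ k) (+ V) (H (D k)) (osc k)))
      where
      eq : ∀ f δ v x o → f ℤ.* (o ℤ.+ δ ℤ.* x) ℤ.- ((f ℤ.* δ ℤ.- v) ℤ.* x ℤ.+ f ℤ.* o) ≡ v ℤ.* x
      eq = ℤ-Solver.solve-∀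
      undo : ∀ a b → a ≡ (a ℤ.- b) ℤ.+ b
      undo = ℤ-Solver.solve-∀
      window : ∑ᶻ (Δ k) (λ i → H (D k + i)) ≡ osc k ℤ.+ + Δ k ℤ.* H (D k)
      window = trans (ℤ∑.sum-≗ (Δ k) λ i → undo (H (D k + i)) (H (D k)))
        (trans (ℤ∑.sum-⊕ (Δ k) _ _) (cong (λ y → osc k ℤ.+ y) (∑ᶻ-const (Δ k) (H (D k)))))
    main≤ : ∣ ∑ᶻ K main ∣ ≤ f * (240 * (R * R))
    main≤ = ≤-trans (≤-reflexive (trans (cong ∣_∣ (trans (ℤ∑.sum-⊗ˡ K (+ f) _)
        (cong (+ f ℤ.*_) (proj₂ (∑H-telescope D K mono))))) (∣+m*i∣ f _)))
      (*-monoʳ-≤ f (∣∑H∣≤ (D K ∸ D 0) (D 0)))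
    err-bound : ∀ k → ∣ err k ∣ ≤ ∣ + (f * Δ k) ℤ.- + V ∣ * (15 * R) + f * (Δ k * (Δ k * 30))
    err-bound k = ≤-trans (ℤ.∣i+j∣≤∣i∣+∣j∣ ((+ (f * Δ k) ℤ.- + V) ℤ.* H (D k)) (+ f ℤ.* osc k)) (+-mono-≤
      (≤-trans (≤-reflexive (ℤ.∣i*j∣≡∣i∣*∣j∣ (+ (f * Δ k) ℤ.- + V) (H (D k))))
               (*-monoʳ-≤ ∣ + (f * Δ k) ℤ.- + V ∣ (∣H∣≤ (D k))))
      (≤-trans (≤-reflexive (∣+m*i∣ f (osc k)))
               (*-monoʳ-≤ f (∣∑ᶻ∣≤-const (Δ k) (Δ k * 30) λ i i<Δ →
                  ≤-trans (H-lipschitz i (D k)) (*-monoˡ-≤ 30 (<⇒≤ i<Δ))))))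

  module _ {V f₀ f₁ s : ℕ} .{{_ : NonZero f₀}} (2≤s : 2 ≤ s) (f₁≈f₀ : s * f₁ ≤ (s + 2) * f₀)
           (fast : 9 * (s * f₁) ≤ V) (slow : 2 * (s * V) ≤ R * f₀) where

    private
      step-error : ∀ Δ → f₀ * Δ ≤ V + 2 * f₁ → V ≤ f₁ * Δ + 2 * f₁ →
        ∣ + (s * f₁ * Δ) ℤ.- + (s * V) ∣ * (15 * R) + s * f₁ * (Δ * (Δ * 30)) ≤ 165 * (R * V)
      step-error Δ up′ low′ = begin
        ∣ + (s * f₁ * Δ) ℤ.- + (s * V) ∣ * (15 * R) + s * f₁ * (Δ * (Δ * 30))
          ≤⟨ +-mono-≤ (*-monoˡ-≤ (15 * R) (∣m-n∣≤ (s * f₁ * Δ) (s * V) above below))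
                      (≤-reflexive (eq₁ s f₁ Δ)) ⟩
        3 * V * (15 * R) + 30 * (f₁ * Δ * (s * Δ))
          ≤⟨ +-monoʳ-≤ (3 * V * (15 * R)) (*-monoʳ-≤ 30 (*-mono-≤ f₁Δ≤4V sΔ≤R)) ⟩
        3 * V * (15 * R) + 30 * (4 * V * R)
          ≡⟨ eq₂ V R ⟩
        165 * (R * V) ∎
        where
        open ≤-Reasoning
        eq₁ : ∀ s f d → s * f * (d * (d * 30)) ≡ 30 * (f * d * (s * d))
        eq₁ = solve-∀
        eq₂ : ∀ v r → 3 * v * (15 * r) + 30 * (4 * v * r) ≡ 165 * (r * v)
        eq₂ = solve-∀
        8≤10 : ∀ x → 4 * (x + 2 * f₁) ≤ 4 * x + 10 * f₁
        8≤10 x = m+n≤o⇒m≤o _ {2 * f₁} (≤-reflexive (eq₀ x f₁))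
          where eq₀ : ∀ x f → 4 * (x + 2 * f) + 2 * f ≡ 4 * x + 10 * f
                eq₀ = solve-∀
        up : 4 * (f₀ * Δ) ≤ 4 * V + 10 * f₁
        up = ≤-trans (*-monoʳ-≤ 4 up′) (8≤10 V)
        low : 4 * V ≤ 4 * (f₁ * Δ) + 10 * f₁
        low = ≤-trans (*-monoʳ-≤ 4 low′) (8≤10 (f₁ * Δ))
        sf₁≤ : 36 * (s * f₁) ≤ 4 * V
        sf₁≤ = ≤-trans (≤-reflexive (*-assoc 4 9 (s * f₁))) (*-monoʳ-≤ 4 fast)
        2f₁≤sf₁ : 2 * f₁ ≤ s * f₁
        2f₁≤sf₁ = *-monoˡ-≤ f₁ 2≤s
        above : s * f₁ * Δ ≤ s * V + 3 * V
        above = *-cancelˡ-≤ 4 (begin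
          4 * (s * f₁ * Δ)                           ≤⟨ *-monoʳ-≤ 4 (*-monoˡ-≤ Δ f₁≈f₀) ⟩
          4 * ((s + 2) * f₀ * Δ)                     ≡⟨ eq₃ s f₀ Δ ⟩
          (s + 2) * (4 * (f₀ * Δ))                   ≤⟨ *-monoʳ-≤ (s + 2) up ⟩
          (s + 2) * (4 * V + 10 * f₁)                ≡⟨ eq₄ s V f₁ ⟩
          4 * (s * V) + 8 * V + (10 * (s * f₁) + 10 * (2 * f₁))
                                                     ≤⟨ +-monoʳ-≤ (4 * (s * V) + 8 * V) (+-monoʳ-≤ (10 * (s * f₁)) (*-monoʳ-≤ 10 2f₁≤sf₁)) ⟩
          4 * (s * V) + 8 * V + (10 * (s * f₁) + 10 * (s * f₁))
                                                     ≤⟨ +-monoʳ-≤ (4 * (s * V) + 8 * V) (≤-trans (m≤m+n _ (16 * (s * f₁))) (≤-trans (≤-reflexive (eq₅ (s * f₁))) sf₁≤)) ⟩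
          4 * (s * V) + 8 * V + 4 * V                ≡⟨ eq₆ (s * V) V ⟩
          4 * (s * V + 3 * V)                        ∎)
          where
          eq₃ : ∀ s f d → 4 * ((s + 2) * f * d) ≡ (s + 2) * (4 * (f * d))
          eq₃ = solve-∀
          eq₄ : ∀ s v f → (s + 2) * (4 * v + 10 * f) ≡ 4 * (s * v) + 8 * v + (10 * (s * f) + 10 * (2 * f))
          eq₄ = solve-∀
          eq₅ : ∀ x → 10 * x + 10 * x + 16 * x ≡ 36 * x
          eq₅ = solve-∀
          eq₆ : ∀ x v → 4 * x + 8 * v + 4 * v ≡ 4 * (x + 3 * v)
          eq₆ = solve-∀
        below : s * V ≤ s * f₁ * Δ + 3 * V
        below = *-cancelˡ-≤ 4 (begin
          4 * (s * V)                                ≡⟨ eq₃ s V ⟩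
          s * (4 * V)                                ≤⟨ *-monoʳ-≤ s low ⟩
          s * (4 * (f₁ * Δ) + 10 * f₁)               ≡⟨ eq₄ s f₁ Δ ⟩
          4 * (s * f₁ * Δ) + 10 * (s * f₁)           ≤⟨ +-monoʳ-≤ (4 * (s * f₁ * Δ)) (≤-trans (*-monoˡ-≤ (s * f₁) {10} {36} (m≤m+n 10 26)) (≤-trans sf₁≤ (*-monoˡ-≤ V {4} {12} (m≤m+n 4 8)))) ⟩
          4 * (s * f₁ * Δ) + 12 * V                  ≡⟨ eq₅ (s * f₁ * Δ) V ⟩
          4 * (s * f₁ * Δ + 3 * V)                   ∎)
          where
          eq₃ : ∀ s v → 4 * (s * v) ≡ s * (4 * v)
          eq₃ = solve-∀
          eq₄ : ∀ s f d → s * (4 * (f * d) + 10 * f) ≡ 4 * (s * f * d) + 10 * (s * f)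
          eq₄ = solve-∀
          eq₅ : ∀ x v → 4 * x + 12 * v ≡ 4 * (x + 3 * v)
          eq₅ = solve-∀
        10f₁≤2V : 10 * f₁ ≤ 2 * V
        10f₁≤2V = begin
          10 * f₁           ≡⟨ *-assoc 5 2 f₁ ⟩
          5 * (2 * f₁)      ≤⟨ *-monoʳ-≤ 5 2f₁≤sf₁ ⟩
          5 * (s * f₁)      ≤⟨ *-monoˡ-≤ (s * f₁) {5} {9} (m≤m+n 5 4) ⟩
          9 * (s * f₁)      ≤⟨ fast ⟩
          V                 ≤⟨ m≤m+n V _ ⟩
          2 * V             ∎
        sΔ≤R : s * Δ ≤ R
        sΔ≤R = *-cancelˡ-≤ (4 * f₀) {{m*n≢0 4 f₀}} (begin
          4 * f₀ * (s * Δ)            ≡⟨ eq₃ f₀ s Δ ⟩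
          s * (4 * (f₀ * Δ))          ≤⟨ *-monoʳ-≤ s up ⟩
          s * (4 * V + 10 * f₁)       ≤⟨ *-monoʳ-≤ s (+-monoʳ-≤ (4 * V) 10f₁≤2V) ⟩
          s * (4 * V + 2 * V)         ≤⟨ *-monoʳ-≤ s (m≤m+n (4 * V + 2 * V) (2 * V)) ⟩
          s * (4 * V + 2 * V + 2 * V) ≡⟨ eq₄ s V ⟩
          4 * (2 * (s * V))           ≤⟨ *-monoʳ-≤ 4 slow ⟩
          4 * (R * f₀)                ≡⟨ eq₅ R f₀ ⟩
          4 * f₀ * R                  ∎)
          where
          eq₃ : ∀ f s d → 4 * f * (s * d) ≡ s * (4 * (f * d))
          eq₃ = solve-∀
          eq₄ : ∀ s v → s * (4 * v + 2 * v + 2 * v) ≡ 4 * (2 * (s * v))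
          eq₄ = solve-∀
          eq₅ : ∀ r f → 4 * (r * f) ≡ 4 * f * r
          eq₅ = solve-∀
        f₁Δ≤4V : f₁ * Δ ≤ 4 * V
        f₁Δ≤4V = *-cancelˡ-≤ (2 * s) {{m*n≢0 2 s {{_}} {{>-nonZero (≤-trans z<s 2≤s)}}}} (begin
          2 * s * (f₁ * Δ)            ≡⟨ eq₃ s f₁ Δ ⟩
          2 * (s * f₁ * Δ)            ≤⟨ *-monoʳ-≤ 2 (*-monoˡ-≤ Δ f₁≈f₀) ⟩
          2 * ((s + 2) * f₀ * Δ)      ≤⟨ *-monoʳ-≤ 2 (*-monoˡ-≤ Δ (*-monoˡ-≤ f₀ (+-monoʳ-≤ s 2≤s))) ⟩
          2 * ((s + s) * f₀ * Δ)      ≡⟨ eq₄ s f₀ Δ ⟩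
          s * (4 * (f₀ * Δ))          ≤⟨ *-monoʳ-≤ s up ⟩
          s * (4 * V + 10 * f₁)       ≤⟨ *-monoʳ-≤ s (+-monoʳ-≤ (4 * V) 10f₁≤2V) ⟩
          s * (4 * V + 2 * V)         ≤⟨ *-monoʳ-≤ s (m≤m+n (4 * V + 2 * V) (2 * V)) ⟩
          s * (4 * V + 2 * V + 2 * V) ≡⟨ eq₅ s V ⟩
          2 * s * (4 * V)             ∎)
          where
          eq₃ : ∀ s f d → 2 * s * (f * d) ≡ 2 * (s * f * d)
          eq₃ = solve-∀
          eq₄ : ∀ s f d → 2 * ((s + s) * f * d) ≡ s * (4 * (f * d))
          eq₄ = solve-∀
          eq₅ : ∀ s v → s * (4 * v + 2 * v + 2 * v) ≡ 2 * s * (4 * v)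
          eq₅ = solve-∀

    slow-phase : ∀ (D : ℕ → ℕ) K →
      (∀ k → suc k < K → D k ≤ D (suc k)) →
      (∀ k → suc k < K → f₀ * (D (suc k) ∸ D k) ≤ V + 2 * f₁) →
      (∀ k → suc k < K → V ≤ f₁ * (D (suc k) ∸ D k) + 2 * f₁) →
      s * V * ∣ ∑ᶻ K (λ k → H (D k)) ∣ ≤ s * f₁ * (240 * (R * R)) + K * (165 * (R * V)) + s * V * (15 * R)
    slow-phase D zero    mono up low = ≤-trans (≤-reflexive (*-zeroʳ (s * V))) z≤n
    slow-phase D (suc K) mono up low = begin
      s * V * ∣ ∑ᶻ K (λ k → H (D k)) ℤ.+ H (D K) ∣
        ≤⟨ *-monoʳ-≤ (s * V) (ℤ.∣i+j∣≤∣i∣+∣j∣ (∑ᶻ K (λ k → H (D k))) (H (D K))) ⟩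
      s * V * (∣ ∑ᶻ K (λ k → H (D k)) ∣ + ∣ H (D K) ∣)
        ≡⟨ *-distribˡ-+ (s * V) _ _ ⟩
      s * V * ∣ ∑ᶻ K (λ k → H (D k)) ∣ + s * V * ∣ H (D K) ∣
        ≤⟨ +-mono-≤ (slow-sum D K (s * V) (s * f₁) (165 * (R * V)) (λ k k<K → mono k (s≤s k<K))
             λ k k<K → step-error (D (suc k) ∸ D k) (up k (s≤s k<K)) (low k (s≤s k<K)))
             (*-monoʳ-≤ (s * V) (∣H∣≤ (D K))) ⟩
      s * f₁ * (240 * (R * R)) + K * (165 * (R * V)) + s * V * (15 * R)
        ≤⟨ +-monoˡ-≤ (s * V * (15 * R)) (+-monoʳ-≤ (s * f₁ * (240 * (R * R))) (*-monoˡ-≤ (165 * (R * V)) (n≤1+n K))) ⟩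
      s * f₁ * (240 * (R * R)) + suc K * (165 * (R * V)) + s * V * (15 * R) ∎
      where open ≤-Reasoning

-- Square roots and slowly varying phases

isqrt : ℕ → ℕ
isqrt zero    = 0
isqrt (suc n) with suc (isqrt n) * suc (isqrt n) ≤? suc n
... | yes _ = suc (isqrt n)
... | no  _ = isqrt n

isqrt-lower : ∀ n → isqrt n * isqrt n ≤ n
isqrt-lower zero    = z≤n
isqrt-lower (suc n) with suc (isqrt n) * suc (isqrt n) ≤? suc n
... | yes le = le
... | no  _  = m≤n⇒m≤1+n (isqrt-lower n)

isqrt-upper : ∀ n → n < suc (isqrt n) * suc (isqrt n)
isqrt-upper zero    = z<s
isqrt-upper (suc n) with suc (isqrt n) * suc (isqrt n) ≤? suc n
... | yes _  = ≤-<-trans (isqrt-upper n) (*-mono-< (n<1+n (suc (isqrt n))) (n<1+n (suc (isqrt n))))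
... | no ¬le = ≰⇒> ¬le

m²<n²⇒m<n : ∀ {m n} → m * m < n * n → m < n
m²<n²⇒m<n {m} {n} lt = ≰⇒> λ n≤m → <⇒≱ lt (*-mono-≤ n≤m n≤m)

m²≤n²⇒m≤n : ∀ {m n} → m * m ≤ n * n → m ≤ n
m²≤n²⇒m≤n {m} {n} le = ≮⇒≥ λ n<m → <⇒≱ (*-mono-< n<m n<m) le

[1+m]² : ∀ m → suc m * suc m ≡ suc (m * m + 2 * m)
[1+m]² = solve-∀

private
  cross≤ : ∀ A E B G {N₁ N₂ N₃ N₄} → N₁ < suc A * suc A → N₄ < suc E * suc E →
    B * B ≤ N₂ → G * G ≤ N₃ → N₁ * N₄ ≡ N₂ * N₃ → B * G ≤ A * E + A + E
  cross≤ A E B G {N₁} {N₂} {N₃} {N₄} a e b g eq = ≤-pred (subst (B * G <_) (eq₁ A E) (m²<n²⇒m<n (begin-strict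
    B * G * (B * G)                          ≡⟨ eq₂ B G ⟩
    B * B * (G * G)                          ≤⟨ *-mono-≤ b g ⟩
    N₂ * N₃                                  ≡⟨ eq ⟨
    N₁ * N₄                                  <⟨ *-mono-< a e ⟩
    suc A * suc A * (suc E * suc E)          ≡⟨ eq₂ (suc A) (suc E) ⟨
    suc A * suc E * (suc A * suc E)          ∎)))
    where
    open ≤-Reasoning
    eq₁ : ∀ A E → suc A * suc E ≡ suc (A * E + A + E)
    eq₁ = solve-∀
    eq₂ : ∀ B G → B * G * (B * G) ≡ B * B * (G * G)
    eq₂ = solve-∀

  square-gap : ∀ A E B G {N₁ N₂ N₃ N₄ V} → N₁ < suc A * suc A → N₄ < suc E * suc E →
    B * B ≤ N₂ → G * G ≤ N₃ → N₁ * N₄ ≡ N₂ * N₃ → N₂ + N₃ + V ≤ N₁ + N₄ →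
    (B + G) * (B + G) + V ≤ (A + E) * (A + E) + 4 * (A + E)
  square-gap A E B G {N₁} {N₂} {N₃} {N₄} {V} a e b g eq sum≤ = begin
    (B + G) * (B + G) + V                              ≡⟨ eq₁ B G V ⟩
    B * B + G * G + V + 2 * (B * G)                    ≤⟨ +-mono-≤ (+-monoˡ-≤ V (+-mono-≤ b g)) (*-monoʳ-≤ 2 (cross≤ A E B G a e b g eq)) ⟩
    N₂ + N₃ + V + 2 * (A * E + A + E)                  ≤⟨ +-monoˡ-≤ (2 * (A * E + A + E)) sum≤ ⟩
    N₁ + N₄ + 2 * (A * E + A + E)                      ≤⟨ +-monoˡ-≤ (2 * (A * E + A + E)) (+-mono-≤ (below A a) (below E e)) ⟩
    A * A + 2 * A + (E * E + 2 * E) + 2 * (A * E + A + E) ≡⟨ eq₂ A E ⟩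
    (A + E) * (A + E) + 4 * (A + E)                    ∎
    where
    open ≤-Reasoning
    below : ∀ n {m} → m < suc n * suc n → m ≤ n * n + 2 * n
    below n {m} lt = ≤-pred (subst (m <_) ([1+m]² n) lt)
    eq₁ : ∀ B G V → (B + G) * (B + G) + V ≡ B * B + G * G + V + 2 * (B * G)
    eq₁ = solve-∀
    eq₂ : ∀ A E → A * A + 2 * A + (E * E + 2 * E) + 2 * (A * E + A + E) ≡ (A + E) * (A + E) + 4 * (A + E)
    eq₂ = solve-∀

  -- (p − r)(p + r) = p² − r² ≈ cV with cf₀ ≤ p + r ≤ cf₁ determines p − r.
  difference-bounds : ∀ c .{{_ : NonZero c}} {p r V f₀ f₁} → 2 * f₁ ≤ V → c * f₀ ≤ p + r → p + r ≤ c * f₁ →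
    r * r + c * V ≤ p * p + c * (2 * f₁) → p * p ≤ r * r + c * V + c * (2 * f₁) →
    r ≤ p × f₀ * (p ∸ r) ≤ V + 2 * f₁ × V ≤ f₁ * (p ∸ r) + 2 * f₁
  difference-bounds c {p} {r} {V} {f₀} {f₁} fast lower upper low up = r≤p ,
    *-cancelˡ-≤ c (begin
      c * (f₀ * Δ)              ≡⟨ *-assoc c f₀ Δ ⟨
      c * f₀ * Δ                ≤⟨ *-monoˡ-≤ Δ lower ⟩
      (p + r) * Δ               ≤⟨ +-cancelˡ-≤ (r * r) _ _ (≤-trans (≤-reflexive (sym p²≡)) (≤-trans up (≤-reflexive (+-assoc (r * r) (c * V) (c * (2 * f₁)))))) ⟩
      c * V + c * (2 * f₁)      ≡⟨ *-distribˡ-+ c V (2 * f₁) ⟨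
      c * (V + 2 * f₁)          ∎) ,
    *-cancelˡ-≤ c (begin
      c * V                            ≤⟨ +-cancelˡ-≤ (r * r) _ _ (≤-trans low (≤-reflexive (trans (cong (_+ c * (2 * f₁)) p²≡) (+-assoc (r * r) ((p + r) * Δ) (c * (2 * f₁)))))) ⟩
      (p + r) * Δ + c * (2 * f₁)       ≤⟨ +-monoˡ-≤ (c * (2 * f₁)) (*-monoˡ-≤ Δ upper) ⟩
      c * f₁ * Δ + c * (2 * f₁)        ≡⟨ cong (_+ c * (2 * f₁)) (*-assoc c f₁ Δ) ⟩
      c * (f₁ * Δ) + c * (2 * f₁)      ≡⟨ *-distribˡ-+ c (f₁ * Δ) (2 * f₁) ⟨
      c * (f₁ * Δ + 2 * f₁)            ∎)
    where
    open ≤-Reasoning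
    Δ = p ∸ r
    r≤p : r ≤ p
    r≤p = m²≤n²⇒m≤n (+-cancelʳ-≤ (c * (2 * f₁)) (r * r) (p * p)
      (≤-trans (+-monoʳ-≤ (r * r) (*-monoʳ-≤ c fast)) low))
    p²≡ : p * p ≡ r * r + (p + r) * Δ
    p²≡ = subst (λ q → q * q ≡ r * r + (q + r) * Δ) (m+[n∸m]≡n r≤p) (eq r Δ)
      where eq : ∀ r k → (r + k) * (r + k) ≡ r * r + (r + k + r) * k
            eq = solve-∀

module Oscillation (R s lo Y g g₀ : ℕ) .{{_ : NonZero R}}
  (2≤s : 2 ≤ s) (hi≤g² : lo + Y ≤ g * g) (g₀²≤lo : g₀ * g₀ ≤ lo)
  (sY≤2lo : s * Y ≤ 2 * lo) (2sg≤R : 2 * (s * g) ≤ R) (s<g₀ : s < g₀) where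

  open Phase R
  open SlowPhase R

  hi : ℕ
  hi = lo + Y

  Q : ℕ
  Q = 8 * R

  opaque
    -- F n = ⌊Q √n⌋, so that n ↦ F n % P records √n modulo 2.
    F : ℕ → ℕ
    F n = isqrt (Q * Q * n)

  opaque
    unfolding F

    F-lower : ∀ n → F n * F n ≤ Q * Q * n
    F-lower n = isqrt-lower (Q * Q * n)

    F-upper : ∀ n → Q * Q * n < suc (F n) * suc (F n)
    F-upper n = isqrt-upper (Q * Q * n)

  F-mono : ∀ {m n} → m ≤ n → F m ≤ F n
  F-mono {m} {n} m≤n = ≤-pred (m²<n²⇒m<n (≤-<-trans (F-lower m) (≤-<-trans (*-monoʳ-≤ (Q * Q) m≤n) (F-upper n))))

  f₀ f₁ : ℕ
  f₀ = F lo
  f₁ = F hi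

  f₁≤Qg : f₁ ≤ Q * g
  f₁≤Qg = m²≤n²⇒m≤n (≤-trans (F-lower hi) (≤-trans (*-monoʳ-≤ (Q * Q) hi≤g²) (≤-reflexive (eq Q g))))
    where eq : ∀ a b → a * a * (b * b) ≡ a * b * (a * b)
          eq = solve-∀

  Qg₀≤f₀ : Q * g₀ ≤ f₀
  Qg₀≤f₀ = ≤-pred (m²<n²⇒m<n (≤-<-trans (≤-reflexive (eq Q g₀)) (≤-<-trans (*-monoʳ-≤ (Q * Q) g₀²≤lo) (F-upper lo))))
    where eq : ∀ a b → a * b * (a * b) ≡ a * a * (b * b)
          eq = solve-∀

  1≤R : 1 ≤ R
  1≤R = >-nonZero⁻¹ R

  2+s≤f₀ : 2 + s ≤ f₀
  2+s≤f₀ = begin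
    2 + s                ≤⟨ s≤s s<g₀ ⟩
    suc g₀               ≤⟨ +-monoˡ-≤ g₀ (≤-trans (m<n⇒0<n s<g₀) (m≤m+n g₀ (g₀ + (g₀ + (g₀ + (g₀ + (g₀ + (g₀ + 0)))))))) ⟩
    7 * g₀ + g₀          ≡⟨ +-comm (7 * g₀) g₀ ⟩
    8 * g₀               ≤⟨ *-monoˡ-≤ g₀ (*-monoʳ-≤ 8 1≤R) ⟩
    Q * g₀               ≤⟨ Qg₀≤f₀ ⟩
    f₀                   ∎
    where open ≤-Reasoning

  instance
    f₀≢0 : NonZero f₀
    f₀≢0 = >-nonZero (≤-trans (s≤s z≤n) 2+s≤f₀)

  f₁≈f₀ : s * f₁ ≤ (s + 2) * f₀
  f₁≈f₀ with δ , f₀+δ≡f₁ ← m≤n⇒∃[o]m+o≡n (F-mono (m≤m+n lo Y)) = begin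
    s * f₁                 ≡⟨ cong (s *_) f₀+δ≡f₁ ⟨
    s * (f₀ + δ)           ≡⟨ *-distribˡ-+ s f₀ δ ⟩
    s * f₀ + s * δ         ≤⟨ +-monoʳ-≤ (s * f₀) sδ≤2f₀ ⟩
    s * f₀ + 2 * f₀        ≡⟨ *-distribʳ-+ f₀ s 2 ⟨
    (s + 2) * f₀           ∎
    where
    open ≤-Reasoning
    N = Q * Q
    Nlo≤ : N * lo ≤ f₀ * f₀ + 2 * f₀
    Nlo≤ = ≤-pred (subst (N * lo <_) ([1+m]² f₀) (F-upper lo))
    eq₁ : ∀ f d → (f + d) * (f + d) ≡ f * f + (2 * (f * d) + d * d)
    eq₁ = solve-∀
    2f₀δ≤ : 2 * (f₀ * δ) ≤ N * Y + 2 * f₀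
    2f₀δ≤ = +-cancelˡ-≤ (f₀ * f₀) _ _ (begin
      f₀ * f₀ + 2 * (f₀ * δ)                 ≤⟨ +-monoʳ-≤ (f₀ * f₀) (m≤m+n (2 * (f₀ * δ)) (δ * δ)) ⟩
      f₀ * f₀ + (2 * (f₀ * δ) + δ * δ)       ≡⟨ eq₁ f₀ δ ⟨
      (f₀ + δ) * (f₀ + δ)                    ≡⟨ cong (λ z → z * z) f₀+δ≡f₁ ⟩
      f₁ * f₁                                ≤⟨ F-lower hi ⟩
      N * (lo + Y)                           ≡⟨ *-distribˡ-+ N lo Y ⟩
      N * lo + N * Y                         ≤⟨ +-monoˡ-≤ (N * Y) Nlo≤ ⟩
      f₀ * f₀ + 2 * f₀ + N * Y               ≡⟨ trans (+-assoc (f₀ * f₀) (2 * f₀) (N * Y)) (cong (λ z → f₀ * f₀ + z) (+-comm (2 * f₀) (N * Y))) ⟩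
      f₀ * f₀ + (N * Y + 2 * f₀)             ∎)
    sδ≤2f₀ : s * δ ≤ 2 * f₀
    sδ≤2f₀ = *-cancelˡ-≤ (2 * f₀) {{m*n≢0 2 f₀}} (begin
      2 * f₀ * (s * δ)                                  ≡⟨ eq₂ f₀ s δ ⟩
      s * (2 * (f₀ * δ))                                ≤⟨ *-monoʳ-≤ s 2f₀δ≤ ⟩
      s * (N * Y + 2 * f₀)                              ≡⟨ eq₃ s N Y f₀ ⟩
      N * (s * Y) + 2 * (s * f₀)                        ≤⟨ +-monoˡ-≤ (2 * (s * f₀)) (*-monoʳ-≤ N sY≤2lo) ⟩
      N * (2 * lo) + 2 * (s * f₀)                       ≡⟨ cong (_+ 2 * (s * f₀)) (eq₄ N lo) ⟩
      2 * (N * lo) + 2 * (s * f₀)                       ≤⟨ +-monoˡ-≤ (2 * (s * f₀)) (*-monoʳ-≤ 2 Nlo≤) ⟩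
      2 * (f₀ * f₀ + 2 * f₀) + 2 * (s * f₀)             ≡⟨ eq₅ f₀ s ⟩
      2 * (f₀ * f₀) + 2 * ((2 + s) * f₀)                ≤⟨ +-monoʳ-≤ (2 * (f₀ * f₀)) (*-monoʳ-≤ 2 (*-monoˡ-≤ f₀ 2+s≤f₀)) ⟩
      2 * (f₀ * f₀) + 2 * (f₀ * f₀)                     ≡⟨ eq₆ f₀ ⟩
      2 * f₀ * (2 * f₀)                                 ∎)
      where
      eq₂ : ∀ f s d → 2 * f * (s * d) ≡ s * (2 * (f * d))
      eq₂ = solve-∀
      eq₃ : ∀ s n y f → s * (n * y + 2 * f) ≡ n * (s * y) + 2 * (s * f)
      eq₃ = solve-∀
      eq₄ : ∀ n l → n * (2 * l) ≡ 2 * (n * l)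
      eq₄ = solve-∀
      eq₅ : ∀ f s → 2 * (f * f + 2 * f) + 2 * (s * f) ≡ 2 * (f * f) + 2 * ((2 + s) * f)
      eq₅ = solve-∀
      eq₆ : ∀ f → 2 * (f * f) + 2 * (f * f) ≡ 2 * f * (2 * f)
      eq₆ = solve-∀

  module _ (e : ℕ) .{{_ : NonZero e}} where

    V : ℕ
    V = Q * Q * e

    fast : 9 * (s * f₁) ≤ V
    fast = begin
      9 * (s * f₁)             ≤⟨ *-monoʳ-≤ 9 (*-monoʳ-≤ s f₁≤Qg) ⟩
      9 * (s * (8 * R * g))    ≡⟨ eq₁ s R g ⟩
      36 * R * (2 * (s * g))   ≤⟨ *-monoʳ-≤ (36 * R) 2sg≤R ⟩
      36 * R * R               ≤⟨ *-monoˡ-≤ R (*-monoˡ-≤ R {36} {64} (m≤m+n 36 28)) ⟩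
      64 * R * R               ≡⟨ eq₂ R ⟩
      Q * Q                    ≤⟨ m≤m*n (Q * Q) e ⟩
      V                        ∎
      where
      open ≤-Reasoning
      eq₁ : ∀ s r g → 9 * (s * (8 * r * g)) ≡ 36 * r * (2 * (s * g))
      eq₁ = solve-∀
      eq₂ : ∀ r → 64 * r * r ≡ 8 * r * (8 * r)
      eq₂ = solve-∀

    2f₁≤V : 2 * f₁ ≤ V
    2f₁≤V = begin
      2 * f₁           ≤⟨ *-monoˡ-≤ f₁ {2} {9} (m≤m+n 2 7) ⟩
      9 * f₁           ≤⟨ *-monoʳ-≤ 9 (m≤n*m f₁ s {{>-nonZero (≤-trans z<s 2≤s)}}) ⟩
      9 * (s * f₁)     ≤⟨ fast ⟩
      V                ∎
      where open ≤-Reasoning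

    bounded-oscillation : 16 * (s * e) ≤ g₀ → ∀ {ν} → s * g ≤ ν * e → s ≤ ν →
      ∀ (D : ℕ → ℕ) K → K ≤ ν →
      (∀ k → suc k < K → D k ≤ D (suc k) ×
         f₀ * (D (suc k) ∸ D k) ≤ V + 2 * f₁ ×
         V ≤ f₁ * (D (suc k) ∸ D k) + 2 * f₁) →
      s * ∣ ∑ᶻ K (λ k → H (D k)) ∣ ≤ 210 * (R * ν)
    bounded-oscillation slowness {ν} sg≤νe s≤ν D K K≤ν steps = *-cancelˡ-≤ V {{V≢0}} (begin
      V * (s * X)                                                           ≡⟨ eq₁ V s X ⟩
      s * V * X                                                             ≤⟨ slow-phase 2≤s f₁≈f₀ fast slow D K
                                                                                 (λ k lt → proj₁ (steps k lt)) (λ k lt → proj₁ (proj₂ (steps k lt))) (λ k lt → proj₂ (proj₂ (steps k lt))) ⟩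
      s * f₁ * (240 * (R * R)) + K * (165 * (R * V)) + s * V * (15 * R)     ≤⟨ +-mono-≤ (+-mono-≤ boundary (*-monoˡ-≤ (165 * (R * V)) K≤ν)) (*-monoˡ-≤ (15 * R) (*-monoˡ-≤ V s≤ν)) ⟩
      30 * (R * ν) * V + ν * (165 * (R * V)) + ν * V * (15 * R)             ≡⟨ eq₂ R ν V ⟩
      V * (210 * (R * ν))                                                   ∎)
      where
      open ≤-Reasoning
      X = ∣ ∑ᶻ K (λ k → H (D k)) ∣
      eq₁ : ∀ v s x → v * (s * x) ≡ s * v * x
      eq₁ = solve-∀
      eq₂ : ∀ r n v → 30 * (r * n) * v + n * (165 * (r * v)) + n * v * (15 * r) ≡ v * (210 * (r * n))
      eq₂ = solve-∀
      V≢0 : NonZero V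
      V≢0 = m*n≢0 (Q * Q) e {{m*n≢0 Q Q {{m*n≢0 8 R}} {{m*n≢0 8 R}}}}
      slow : 2 * (s * V) ≤ R * f₀
      slow = begin
        2 * (s * (8 * R * (8 * R) * e))   ≡⟨ eq₃ s R e ⟩
        R * (8 * R * (16 * (s * e)))      ≤⟨ *-monoʳ-≤ R (*-monoʳ-≤ (8 * R) slowness) ⟩
        R * (8 * R * g₀)                  ≤⟨ *-monoʳ-≤ R Qg₀≤f₀ ⟩
        R * f₀                            ∎
        where eq₃ : ∀ s r e → 2 * (s * (8 * r * (8 * r) * e)) ≡ r * (8 * r * (16 * (s * e)))
              eq₃ = solve-∀
      boundary : s * f₁ * (240 * (R * R)) ≤ 30 * (R * ν) * V
      boundary = begin
        s * f₁ * (240 * (R * R))               ≤⟨ *-monoˡ-≤ (240 * (R * R)) (*-monoʳ-≤ s f₁≤Qg) ⟩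
        s * (8 * R * g) * (240 * (R * R))      ≡⟨ eq₃ s R g ⟩
        1920 * (R * R * R) * (s * g)           ≤⟨ *-monoʳ-≤ (1920 * (R * R * R)) sg≤νe ⟩
        1920 * (R * R * R) * (ν * e)           ≡⟨ eq₄ R ν e ⟩
        30 * (R * ν) * (8 * R * (8 * R) * e)   ∎
        where
        eq₃ : ∀ s r g → s * (8 * r * g) * (240 * (r * r)) ≡ 1920 * (r * r * r) * (s * g)
        eq₃ = solve-∀
        eq₄ : ∀ r n e → 1920 * (r * r * r) * (n * e) ≡ 30 * (r * n) * (8 * r * (8 * r) * e)
        eq₄ = solve-∀

  private
    F-range : ∀ {u} → lo ≤ u → u ≤ hi → f₀ ≤ F u × F u ≤ f₁
    F-range lo≤u u≤hi = F-mono lo≤u , F-mono u≤hi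

  linear-phase : ∀ d .{{_ : NonZero d}} (n : ℕ → ℕ) K ν → 32 * (s * d) ≤ g₀ → s * g ≤ ν * (2 * d) → s ≤ ν → K ≤ ν →
    (∀ k → n (suc k) ≡ n k + 4) → (∀ k → k < K → lo ≤ d * n k × d * n k ≤ hi) →
    s * ∣ ∑ᶻ K (λ k → h (F (d * n k))) ∣ ≤ 210 * (R * ν)
  linear-phase d n K ν slowness sg≤ s≤ν K≤ν step range =
    bounded-oscillation (2 * d) (≤-trans (≤-reflexive (eq₁ s d)) slowness) sg≤ s≤ν
      (λ k → F (d * n k) + 14 * R) K K≤ν steps
    where
    instance _ = m*n≢0 2 d
    eq₁ : ∀ s d → 16 * (s * (2 * d)) ≡ 32 * (s * d)
    eq₁ = solve-∀
    steps : ∀ k → suc k < K → F (d * n k) + 14 * R ≤ F (d * n (suc k)) + 14 * R ×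
      f₀ * (F (d * n (suc k)) + 14 * R ∸ (F (d * n k) + 14 * R)) ≤ V (2 * d) + 2 * f₁ ×
      V (2 * d) ≤ f₁ * (F (d * n (suc k)) + 14 * R ∸ (F (d * n k) + 14 * R)) + 2 * f₁
    steps k 1+k<K =
      +-monoˡ-≤ (14 * R) (proj₁ bounds) ,
      subst (λ z → f₀ * z ≤ V (2 * d) + 2 * f₁ × V (2 * d) ≤ f₁ * z + 2 * f₁)
        (sym ([m+n]∸[o+n]≡m∸o (14 * R))) (proj₂ bounds)
      where
      a = d * n (suc k)
      b = d * n k
      [m+n]∸[o+n]≡m∸o : ∀ c → F a + c ∸ (F b + c) ≡ F a ∸ F b
      [m+n]∸[o+n]≡m∸o c = trans (cong₂ _∸_ (+-comm (F a) c) (+-comm (F b) c)) ([m+n]∸[m+o]≡n∸o c (F a) (F b))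
      A-range = F-range (proj₁ (range (suc k) 1+k<K)) (proj₂ (range (suc k) 1+k<K))
      B-range = F-range (proj₁ (range k (<⇒≤ 1+k<K))) (proj₂ (range k (<⇒≤ 1+k<K)))
      Qa≡ : Q * Q * a ≡ Q * Q * b + 2 * V (2 * d)
      Qa≡ = trans (cong (λ z → Q * Q * (d * z)) (step k)) (eq (Q * Q) d (n k))
        where eq : ∀ q d n → q * (d * (n + 4)) ≡ q * (d * n) + 2 * (q * (2 * d))
              eq = solve-∀
      below : ∀ m → Q * Q * m ≤ F m * F m + 2 * F m
      below m = ≤-pred (subst (Q * Q * m <_) ([1+m]² (F m)) (F-upper m))
      2x≤ : ∀ {x} → x ≤ f₁ → 2 * x ≤ 2 * (2 * f₁)
      2x≤ x≤f₁ = *-monoʳ-≤ 2 (≤-trans x≤f₁ (m≤m+n f₁ _))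
      bounds = difference-bounds 2 {F a} {F b} {V (2 * d)} {f₀} {f₁} (2f₁≤V (2 * d))
        (≤-trans (≤-reflexive (cong (λ z → f₀ + z) (+-identityʳ f₀))) (+-mono-≤ (proj₁ A-range) (proj₁ B-range)))
        (≤-trans (+-mono-≤ (proj₂ A-range) (proj₂ B-range)) (≤-reflexive (cong (λ z → f₁ + z) (sym (+-identityʳ f₁)))))
        (begin
          F b * F b + 2 * V (2 * d)          ≤⟨ +-monoˡ-≤ (2 * V (2 * d)) (F-lower b) ⟩
          Q * Q * b + 2 * V (2 * d)          ≡⟨ Qa≡ ⟨
          Q * Q * a                          ≤⟨ below a ⟩
          F a * F a + 2 * F a                ≤⟨ +-monoʳ-≤ (F a * F a) (2x≤ (proj₂ A-range)) ⟩
          F a * F a + 2 * (2 * f₁)           ∎)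
        (begin
          F a * F a                                      ≤⟨ F-lower a ⟩
          Q * Q * a                                      ≡⟨ Qa≡ ⟩
          Q * Q * b + 2 * V (2 * d)                      ≤⟨ +-monoˡ-≤ (2 * V (2 * d)) (below b) ⟩
          F b * F b + 2 * F b + 2 * V (2 * d)            ≡⟨ eq (F b * F b) (2 * F b) (2 * V (2 * d)) ⟩
          F b * F b + 2 * V (2 * d) + 2 * F b            ≤⟨ +-monoʳ-≤ (F b * F b + 2 * V (2 * d)) (2x≤ (proj₂ B-range)) ⟩
          F b * F b + 2 * V (2 * d) + 2 * (2 * f₁)       ∎)
        where
        open ≤-Reasoning
        eq : ∀ a b c → a + b + c ≡ a + c + b
        eq = solve-∀

  bilinear-phase : ∀ q m δ .{{_ : NonZero q}} .{{_ : NonZero δ}} (n : ℕ → ℕ) K ν →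
    16 * (s * (q * δ)) ≤ g₀ → s * g ≤ ν * (q * δ) → s ≤ ν → K ≤ ν → (∀ k → n (suc k) ≡ n k + 4) →
    (∀ k → k < K → lo ≤ q * m * n k × q * (m + δ) * n k ≤ hi) →
    s * ∣ ∑ᶻ K (λ k → H (F (q * (m + δ) * n k) ∸ F (q * m * n k))) ∣ ≤ 210 * (R * ν)
  bilinear-phase q m δ n K ν slowness sg≤ s≤ν K≤ν step range =
    bounded-oscillation (q * δ) slowness sg≤ s≤ν (λ k → F (big k) ∸ F (small k)) K K≤ν steps
    where
    instance _ = m*n≢0 q δ
    big small : ℕ → ℕ
    big k = q * (m + δ) * n k
    small k = q * m * n k
    small≤big : ∀ k → small k ≤ big k
    small≤big k = *-monoˡ-≤ (n k) (*-monoʳ-≤ q (m≤m+n m δ))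
    W = V (q * δ)
    steps : ∀ k → suc k < K → F (big k) ∸ F (small k) ≤ F (big (suc k)) ∸ F (small (suc k)) ×
      f₀ * (F (big (suc k)) ∸ F (small (suc k)) ∸ (F (big k) ∸ F (small k))) ≤ W + 2 * f₁ ×
      W ≤ f₁ * (F (big (suc k)) ∸ F (small (suc k)) ∸ (F (big k) ∸ F (small k))) + 2 * f₁
    steps k 1+k<K with m≤n⇒∃[o]m+o≡n (F-mono (small≤big (suc k))) | m≤n⇒∃[o]m+o≡n (F-mono (small≤big k))
    ... | x , G+x≡A | y , E+y≡B =
      subst₂ (λ u v → u ≤ v × f₀ * (v ∸ u) ≤ W + 2 * f₁ × W ≤ f₁ * (v ∸ u) + 2 * f₁)
        (trans (sym (m+n∸m≡n E y)) (cong (_∸ E) E+y≡B)) (trans (sym (m+n∸m≡n G x)) (cong (_∸ G) G+x≡A))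
        (+-cancelˡ-≤ (G + E) y x (subst₂ _≤_ r≡ p≡ (proj₁ bounds)) ,
         subst (λ z → f₀ * z ≤ W + 2 * f₁ × W ≤ f₁ * z + 2 * f₁)
           (trans (cong₂ _∸_ p≡ r≡) ([m+n]∸[m+o]≡n∸o (G + E) x y)) (proj₂ bounds))
      where
      A = F (big (suc k))
      B = F (big k)
      G = F (small (suc k))
      E = F (small k)
      p≡ : A + E ≡ G + E + x
      p≡ = trans (cong (_+ E) (sym G+x≡A)) (eq G x E)
        where eq : ∀ g x e → g + x + e ≡ g + e + x
              eq = solve-∀
      r≡ : B + G ≡ G + E + y
      r≡ = trans (cong (_+ G) (sym E+y≡B)) (eq G y E)
        where eq : ∀ g y e → e + y + g ≡ g + e + y
              eq = solve-∀
      range-of : ∀ j → j < K → (f₀ ≤ F (big j) × F (big j) ≤ f₁) × (f₀ ≤ F (small j) × F (small j) ≤ f₁)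
      range-of j j<K = F-range (≤-trans (proj₁ (range j j<K)) (small≤big j)) (proj₂ (range j j<K)) ,
                       F-range (proj₁ (range j j<K)) (≤-trans (small≤big j) (proj₂ (range j j<K)))
      new = range-of (suc k) 1+k<K
      old = range-of k (<⇒≤ 1+k<K)
      4x≡ : ∀ x → 4 * x ≡ (x + x) + (x + x)
      4x≡ = solve-∀
      four : ∀ {a b} → a ≤ f₁ → b ≤ f₁ → 4 * (a + b) ≤ 4 * (2 * f₁)
      four a≤ b≤ = *-monoʳ-≤ 4 (≤-trans (+-mono-≤ a≤ b≤) (≤-reflexive (cong (λ z → f₁ + z) (sym (+-identityʳ f₁)))))
      sums : Q * Q * big (suc k) + Q * Q * small k ≡ Q * Q * big k + Q * Q * small (suc k) + 4 * W
      sums = trans (cong (λ z → Q * Q * (q * (m + δ) * z) + Q * Q * small k) (step k))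
        (trans (eq (Q * Q) q m δ (n k)) (cong (λ z → Q * Q * big k + Q * Q * (q * m * z) + 4 * W) (sym (step k))))
        where eq : ∀ Q q m d n → Q * (q * (m + d) * (n + 4)) + Q * (q * m * n) ≡
                     Q * (q * (m + d) * n) + Q * (q * m * (n + 4)) + 4 * (Q * (q * d))
              eq = solve-∀
      prods : Q * Q * big (suc k) * (Q * Q * small k) ≡ Q * Q * big k * (Q * Q * small (suc k))
      prods = eq (Q * Q) (q * (m + δ)) (n (suc k)) (q * m) (n k)
        where eq : ∀ Q a x b y → Q * (a * x) * (Q * (b * y)) ≡ Q * (a * y) * (Q * (b * x))
              eq = solve-∀
      bounds = difference-bounds 4 {A + E} {B + G} {W} {f₀} {f₁} (2f₁≤V (q * δ))
        (≤-trans (≤-reflexive (4x≡ f₀)) (+-mono-≤ (+-mono-≤ (proj₁ (proj₁ new)) (proj₁ (proj₂ old)))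
                                                  (+-mono-≤ (proj₁ (proj₁ old)) (proj₁ (proj₂ new)))))
        (≤-trans (+-mono-≤ (+-mono-≤ (proj₂ (proj₁ new)) (proj₂ (proj₂ old)))
                           (+-mono-≤ (proj₂ (proj₁ old)) (proj₂ (proj₂ new)))) (≤-reflexive (sym (4x≡ f₁))))
        (≤-trans (square-gap A E B G (F-upper (big (suc k))) (F-upper (small k)) (F-lower (big k)) (F-lower (small (suc k)))
                   prods (≤-reflexive (sym sums)))
                 (+-monoʳ-≤ ((A + E) * (A + E)) (four (proj₂ (proj₁ new)) (proj₂ (proj₂ old)))))
        (begin
          (A + E) * (A + E)                                             ≡⟨ eq₁ A E ⟩
          A * A + E * E + 2 * (A * E)                                   ≤⟨ +-mono-≤ (+-mono-≤ (F-lower (big (suc k))) (F-lower (small k)))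
                                                                             (*-monoʳ-≤ 2 (cross≤ B G A E (F-upper (big k)) (F-upper (small (suc k))) (F-lower (big (suc k))) (F-lower (small k)) (sym prods))) ⟩
          Q * Q * big (suc k) + Q * Q * small k + 2 * (B * G + B + G)   ≡⟨ cong (_+ 2 * (B * G + B + G)) sums ⟩
          Q * Q * big k + Q * Q * small (suc k) + 4 * W + 2 * (B * G + B + G)
                                                                        ≤⟨ +-monoˡ-≤ (2 * (B * G + B + G)) (+-monoˡ-≤ (4 * W) (+-mono-≤ (below (big k)) (below (small (suc k))))) ⟩
          B * B + 2 * B + (G * G + 2 * G) + 4 * W + 2 * (B * G + B + G) ≡⟨ eq₂ B G W ⟩
          (B + G) * (B + G) + 4 * W + 4 * (B + G)                       ≤⟨ +-monoʳ-≤ ((B + G) * (B + G) + 4 * W) (four (proj₂ (proj₁ old)) (proj₂ (proj₂ new))) ⟩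
          (B + G) * (B + G) + 4 * W + 4 * (2 * f₁)                      ∎)
        where
        open ≤-Reasoning
        below : ∀ m → Q * Q * m ≤ F m * F m + 2 * F m
        below m = ≤-pred (subst (Q * Q * m <_) ([1+m]² (F m)) (F-upper m))
        eq₁ : ∀ a e → (a + e) * (a + e) ≡ a * a + e * e + 2 * (a * e)
        eq₁ = solve-∀
        eq₂ : ∀ b g w → b * b + 2 * b + (g * g + 2 * g) + 4 * w + 2 * (b * g + b + g) ≡ (b + g) * (b + g) + 4 * w + 4 * (b + g)
        eq₂ = solve-∀

-- Bilinear sums over short intervals

∣x*y∣≤ : ∀ x y {m} → ∣ x ∣ ≤ 1 → ∣ y ∣ ≤ m → ∣ x ℤ.* y ∣ ≤ m
∣x*y∣≤ x y {m} x≤1 y≤m = ≤-trans (≤-reflexive (ℤ.∣i*j∣≡∣i∣*∣j∣ x y))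
  (≤-trans (*-mono-≤ x≤1 y≤m) (≤-reflexive (*-identityˡ m)))

cauchy-schwarz₂ : ∀ m n (f : ℕ → ℕ → ℕ) →
  ∑ m (λ i → ∑ n (f i)) * ∑ m (λ i → ∑ n (f i)) ≤ m * n * ∑ m (λ i → ∑ n (λ j → f i j * f i j))
cauchy-schwarz₂ m n f = begin
  ∑ m (λ i → ∑ n (f i)) * ∑ m (λ i → ∑ n (f i))           ≤⟨ cauchy-schwarz m (λ i → ∑ n (f i)) ⟩
  m * ∑ m (λ i → ∑ n (f i) * ∑ n (f i))                   ≤⟨ *-monoʳ-≤ m (∑-mono m λ i _ → cauchy-schwarz n (f i)) ⟩
  m * ∑ m (λ i → n * ∑ n (λ j → f i j * f i j))           ≡⟨ cong (m *_) (ℕ∑.sum-⊗ˡ m n _) ⟩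
  m * (n * ∑ m (λ i → ∑ n (λ j → f i j * f i j)))         ≡⟨ *-assoc m n _ ⟨
  m * n * ∑ m (λ i → ∑ n (λ j → f i j * f i j))           ∎
  where open ≤-Reasoning

+∣i∣²≡i² : ∀ i → + (∣ i ∣ * ∣ i ∣) ≡ i ℤ.* i
+∣i∣²≡i² (+ n)    = ℤ.pos-* n n
+∣i∣²≡i² -[1+ n ] = refl

m<m+n⇒nonZero : ∀ m {n} → m < m + n → NonZero n
m<m+n⇒nonZero m {zero}  lt = contradiction lt (≤⇒≯ (≤-reflexive (+-identityʳ m)))
m<m+n⇒nonZero m {suc _} lt = _

module BilinearBlock (R s lo Y g g₀ : ℕ) .{{_ : NonZero R}}
  (2≤s : 2 ≤ s) (hi≤g² : lo + Y ≤ g * g) (g₀²≤lo : g₀ * g₀ ≤ lo)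
  (sY≤2lo : s * Y ≤ 2 * lo) (2sg≤R : 2 * (s * g) ≤ R) (s<g₀ : s < g₀) where

  open Phase R public
  open Oscillation R s lo Y g g₀ 2≤s hi≤g² g₀²≤lo sY≤2lo 2sg≤R s<g₀ public

  module Block (q Δ₀ : ℕ) .{{_ : NonZero q}} .{{_ : NonZero Δ₀}} (E c : ℕ) (T : ℕ → ℕ) where

    element : ℕ → ℕ
    element i = E + Δ₀ * i

    value : ℕ → ℕ → ℕ
    value i k = q * element i * (k * 4 + c)

    U : ℕ → ℕ → Set
    U i k = (lo < value i k × value i k ≤ hi) × T (element i) ≤ k * 4 + c

    U? : ∀ i k → Dec (U i k)
    U? i k = (lo <? value i k ×-dec value i k ≤? hi) ×-dec T (element i) ≤? k * 4 + c

    U-convex : ∀ i {k₁ k₂ k₃} → k₁ ≤ k₂ → k₂ ≤ k₃ → U i k₁ → U i k₃ → U i k₂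
    U-convex i k₁≤k₂ k₂≤k₃ ((lo< , _) , T≤) ((_ , ≤hi) , _) =
      (<-≤-trans lo< (mono k₁≤k₂) , ≤-trans (mono k₂≤k₃) ≤hi) , ≤-trans T≤ (+-monoˡ-≤ c (*-monoˡ-≤ 4 k₁≤k₂))
      where
      mono : ∀ {x y} → x ≤ y → value i x ≤ value i y
      mono x≤y = *-monoʳ-≤ (q * element i) (+-monoˡ-≤ c (*-monoˡ-≤ 4 x≤y))

    module _ {κ ν : ℕ} (window : ∀ i k → i < s → U i k → κ ≤ k × k < κ + ν)
             (slowness : 16 * (s * (q * (Δ₀ * s))) ≤ g₀) (sg≤ : s * g ≤ ν * (q * Δ₀)) (s≤ν : s ≤ ν) where

      correlation : ℕ → ℕ → ℤ
      correlation i j = ∑ᶻ ν λ k → ι (U? i (κ + k)) ℤ.* ι (U? j (κ + k)) ℤ.*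
        ∑ᶻ P (λ t → w (F (value i (κ + k)) + t) ℤ.* w (F (value j (κ + k)) + t))

      w-correlation-F : ∀ {x y} → x ≤ y →
        ∑ᶻ P (λ t → w (F y + t) ℤ.* w (F x + t)) ≡ + 16 ℤ.* H (F y ∸ F x)
      w-correlation-F {x} {y} x≤y = trans
        (ℤ∑.sum-≗ P λ t → cong (λ z → w (z + t) ℤ.* w (F x + t)) (sym (m∸n+n≡m (F-mono x≤y))))
        (w-correlation (F y ∸ F x) (F x))

      correlation-sym : ∀ i j → correlation i j ≡ correlation j i
      correlation-sym i j = ℤ∑.sum-≗ ν λ k → cong₂ ℤ._*_ (ℤ.*-comm (ι (U? i (κ + k))) (ι (U? j (κ + k))))
        (ℤ∑.sum-≗ P λ t → ℤ.*-comm (w (F (value i (κ + k)) + t)) (w (F (value j (κ + k)) + t)))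

      ∣correlation-diagonal∣≤ : ∀ i → ∣ correlation i i ∣ ≤ 240 * (R * ν)
      ∣correlation-diagonal∣≤ i = ≤-trans
        (∣∑ᶻ∣≤-const ν (16 * (15 * R)) λ k _ →
          ∣x*y∣≤ (ι (U? i (κ + k)) ℤ.* ι (U? i (κ + k))) _ (∣x*y∣≤ (ι (U? i (κ + k))) _ (∣ι∣≤1 (U? i (κ + k))) (∣ι∣≤1 (U? i (κ + k))))
            (≤-trans (≤-reflexive (trans (cong ∣_∣ (w-correlation-F (≤-refl {value i (κ + k)}))) (∣+m*i∣ 16 (H (F (value i (κ + k)) ∸ F (value i (κ + k)))))))
                     (*-monoʳ-≤ 16 (∣H∣≤ (F (value i (κ + k)) ∸ F (value i (κ + k)))))))
        (≤-reflexive (eq ν R))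
        where eq : ∀ n r → n * (16 * (15 * r)) ≡ 240 * (r * n)
              eq = solve-∀

      ∣correlation∣< : ∀ i d .{{_ : NonZero d}} → i + d < s → s * ∣ correlation (i + d) i ∣ ≤ 3360 * (R * ν)
      ∣correlation∣< i d i+d<s
        with ∑ᶻ-convex (λ k → U? (i + d) (κ + k) ×-dec U? i (κ + k))
               (λ le₁ le₂ (p , p′) (r , r′) → U-convex (i + d) (+-monoʳ-≤ κ le₁) (+-monoʳ-≤ κ le₂) p r ,
                                              U-convex i (+-monoʳ-≤ κ le₁) (+-monoʳ-≤ κ le₂) p′ r′)
               ν (λ k → H (F (value (i + d) (κ + k)) ∸ F (value i (κ + k))))
      ... | α , K , α+K≤ν , inside , sum≡ = begin
        s * ∣ correlation (i + d) i ∣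
          ≡⟨ cong (λ x → s * ∣ x ∣) (trans (ℤ∑.sum-≗ ν pointwise) (trans (ℤ∑.sum-⊗ˡ ν (+ 16) _) (cong (+ 16 ℤ.*_) sum≡))) ⟩
        s * ∣ + 16 ℤ.* ∑ᶻ K (λ j → H (F (value (i + d) (κ + (α + j))) ∸ F (value i (κ + (α + j))))) ∣
          ≡⟨ trans (cong (s *_) (∣+m*i∣ 16 X)) (eq₁ s ∣ X ∣) ⟩
        16 * (s * ∣ ∑ᶻ K (λ j → H (F (value (i + d) (κ + (α + j))) ∸ F (value i (κ + (α + j))))) ∣)
          ≡⟨ cong (λ x → 16 * (s * ∣ x ∣)) (ℤ∑.sum-≗ K λ j → cong (λ e → H (F (q * e * n j) ∸ F (value i (κ + (α + j))))) element+) ⟩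
        16 * (s * ∣ ∑ᶻ K (λ j → H (F (q * (element i + Δ₀ * d) * n j) ∸ F (q * element i * n j))) ∣)
          ≤⟨ *-monoʳ-≤ 16 (bilinear-phase q (element i) (Δ₀ * d) n K ν
               (≤-trans (*-monoʳ-≤ 16 (*-monoʳ-≤ s (*-monoʳ-≤ q (*-monoʳ-≤ Δ₀ (≤-trans (m≤n+m d i) (<⇒≤ i+d<s)))))) slowness)
               (≤-trans sg≤ (*-monoʳ-≤ ν (*-monoʳ-≤ q (m≤m*n Δ₀ d)))) s≤ν (m+n≤o⇒n≤o α α+K≤ν) step range) ⟩
        16 * (210 * (R * ν))
          ≡⟨ *-assoc 16 210 (R * ν) ⟨
        3360 * (R * ν) ∎
        where
        open ≤-Reasoning
        instance _ = m*n≢0 Δ₀ d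
        X = ∑ᶻ K (λ j → H (F (value (i + d) (κ + (α + j))) ∸ F (value i (κ + (α + j)))))
        n : ℕ → ℕ
        n j = (κ + (α + j)) * 4 + c
        eq₁ : ∀ s x → s * (16 * x) ≡ 16 * (s * x)
        eq₁ = solve-∀
        eq₂ : ∀ ιι x → ιι ℤ.* (+ 16 ℤ.* x) ≡ + 16 ℤ.* (ιι ℤ.* x)
        eq₂ = ℤ-Solver.solve-∀
        element+ : element (i + d) ≡ element i + Δ₀ * d
        element+ = trans (cong (λ x → E + x) (*-distribˡ-+ Δ₀ i d)) (sym (+-assoc E (Δ₀ * i) (Δ₀ * d)))
        value≤ : ∀ k → value i k ≤ value (i + d) k
        value≤ k = *-monoˡ-≤ (k * 4 + c) (*-monoʳ-≤ q (+-monoʳ-≤ E (*-monoʳ-≤ Δ₀ (m≤m+n i d))))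
        pointwise : ∀ k → _
        pointwise k = trans
          (cong₂ ℤ._*_ (sym (ι-×-dec (U? (i + d) (κ + k)) (U? i (κ + k)))) (w-correlation-F (value≤ (κ + k))))
          (eq₂ (ι (U? (i + d) (κ + k) ×-dec U? i (κ + k))) (H (F (value (i + d) (κ + k)) ∸ F (value i (κ + k)))))
        step : ∀ j → n (suc j) ≡ n j + 4
        step j = eq κ α j c
          where eq : ∀ κ α j c → (κ + (α + suc j)) * 4 + c ≡ (κ + (α + j)) * 4 + c + 4
                eq = solve-∀
        range : ∀ j → j < K → lo ≤ q * element i * n j × q * (element i + Δ₀ * d) * n j ≤ hi
        range j j<K with inside j j<K
        ... | ((_ , ≤hi) , _) , ((lo< , _) , _) = <⇒≤ lo< , subst (λ e → q * e * n j ≤ hi) element+ ≤hi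

      s∣correlation∣≤ : ∀ i j → i < s → j < s → s * ∣ correlation i j ∣ ≤ 3360 * (R * ν) + ∣ ι (j ≟ i) ∣ * (s * (240 * (R * ν)))
      s∣correlation∣≤ i j i<s j<s with <-cmp i j
      ... | tri≈ _ refl _ = ≤-trans (*-monoʳ-≤ s (∣correlation-diagonal∣≤ i))
        (≤-trans (≤-reflexive (sym (trans (cong (λ x → ∣ x ∣ * _) (ι-yes {d = i ≟ i} refl)) (*-identityˡ _)))) (m≤n+m _ _))
      ... | tri< i<j _ _ with d , refl ← m≤n⇒∃[o]m+o≡n (<⇒≤ i<j) =
        ≤-trans (≤-reflexive (cong (λ x → s * ∣ x ∣) (correlation-sym i (i + d))))
                (≤-trans (∣correlation∣< i d {{m<m+n⇒nonZero i i<j}} j<s) (m≤m+n _ _))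
      ... | tri> _ _ j<i with d , refl ← m≤n⇒∃[o]m+o≡n (<⇒≤ j<i) =
        ≤-trans (∣correlation∣< j d {{m<m+n⇒nonZero j j<i}} i<s) (m≤m+n _ _)

      module _ (a b : ℕ → ℤ) (∣a∣≤1 : ∀ i → ∣ a i ∣ ≤ 1) (∣b∣≤1 : ∀ k → ∣ b k ∣ ≤ 1) where

        inner : ℕ → ℕ → ℤ
        inner t k = ∑ᶻ s λ i → a i ℤ.* ι (U? i k) ℤ.* w (F (value i k) + t)

        energy : ℕ
        energy = ∑ P λ t → ∑ ν λ k → ∣ inner t (κ + k) ∣ * ∣ inner t (κ + k) ∣

        energy≡ : + energy ≡ ∑ᶻ s λ i → ∑ᶻ s λ j → a i ℤ.* a j ℤ.* correlation i j
        energy≡ = begin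
          + energy
            ≡⟨ ∑ᶻ-+ P _ ⟨
          ∑ᶻ P (λ t → + ∑ ν (λ k → ∣ inner t (κ + k) ∣ * ∣ inner t (κ + k) ∣))
            ≡⟨ ℤ∑.sum-≗ P (λ t → trans (sym (∑ᶻ-+ ν _)) (ℤ∑.sum-≗ ν λ k → +∣i∣²≡i² (inner t (κ + k)))) ⟩
          ∑ᶻ P (λ t → ∑ᶻ ν λ k → inner t (κ + k) ℤ.* inner t (κ + k))
            ≡⟨ ℤ∑.sum-≗ P (λ t → ℤ∑.sum-≗ ν λ k → ℤ∑.sum-product s s _ _) ⟩
          ∑ᶻ P (λ t → ∑ᶻ ν λ k → ∑ᶻ s λ i → ∑ᶻ s λ j → term t k i j)
            ≡⟨ ℤ∑.sum-swap P ν _ ⟩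
          ∑ᶻ ν (λ k → ∑ᶻ P λ t → ∑ᶻ s λ i → ∑ᶻ s λ j → term t k i j)
            ≡⟨ ℤ∑.sum-≗ ν (λ k → trans (ℤ∑.sum-swap P s _) (ℤ∑.sum-≗ s λ i → ℤ∑.sum-swap P s _)) ⟩
          ∑ᶻ ν (λ k → ∑ᶻ s λ i → ∑ᶻ s λ j → ∑ᶻ P λ t → term t k i j)
            ≡⟨ trans (ℤ∑.sum-swap ν s _) (ℤ∑.sum-≗ s λ i → ℤ∑.sum-swap ν s _) ⟩
          ∑ᶻ s (λ i → ∑ᶻ s λ j → ∑ᶻ ν λ k → ∑ᶻ P λ t → term t k i j)
            ≡⟨ ℤ∑.sum-≗ s (λ i → ℤ∑.sum-≗ s λ j → trans (ℤ∑.sum-≗ ν λ k → factor i j k) (ℤ∑.sum-⊗ˡ ν (a i ℤ.* a j) _)) ⟩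
          ∑ᶻ s (λ i → ∑ᶻ s λ j → a i ℤ.* a j ℤ.* correlation i j) ∎
          where
          open ≡-Reasoning
          term : ℕ → ℕ → ℕ → ℕ → ℤ
          term t k i j = (a i ℤ.* ι (U? i (κ + k)) ℤ.* w (F (value i (κ + k)) + t)) ℤ.*
                         (a j ℤ.* ι (U? j (κ + k)) ℤ.* w (F (value j (κ + k)) + t))
          factor : ∀ i j k → ∑ᶻ P (λ t → term t k i j) ≡ a i ℤ.* a j ℤ.*
            (ι (U? i (κ + k)) ℤ.* ι (U? j (κ + k)) ℤ.* ∑ᶻ P (λ t → w (F (value i (κ + k)) + t) ℤ.* w (F (value j (κ + k)) + t)))
          factor i j k = trans
            (ℤ∑.sum-≗ P λ t → eq (a i) (a j) (ι (U? i (κ + k))) (ι (U? j (κ + k))) (w (F (value i (κ + k)) + t)) (w (F (value j (κ + k)) + t)))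
            (trans (ℤ∑.sum-⊗ˡ P (a i ℤ.* a j ℤ.* (ι (U? i (κ + k)) ℤ.* ι (U? j (κ + k)))) _) (ℤ.*-assoc (a i ℤ.* a j) _ _))
            where eq : ∀ a b i j u v → (a ℤ.* i ℤ.* u) ℤ.* (b ℤ.* j ℤ.* v) ≡ (a ℤ.* b ℤ.* (i ℤ.* j)) ℤ.* (u ℤ.* v)
                  eq = ℤ-Solver.solve-∀

        energy≤ : energy ≤ 3600 * (s * (R * ν))
        energy≤ = *-cancelˡ-≤ s {{>-nonZero (≤-trans z<s 2≤s)}} (begin
          s * energy
            ≡⟨ cong (λ x → s * ∣ x ∣) energy≡ ⟩
          s * ∣ ∑ᶻ s (λ i → ∑ᶻ s λ j → a i ℤ.* a j ℤ.* correlation i j) ∣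
            ≤⟨ *-monoʳ-≤ s (≤-trans (∣∑ᶻ∣≤ s _) (∑-mono s λ i _ → ≤-trans (∣∑ᶻ∣≤ s _) (∑-mono s λ j _ →
                 ∣x*y∣≤ (a i ℤ.* a j) (correlation i j) (∣x*y∣≤ (a i) (a j) (∣a∣≤1 i) (∣a∣≤1 j)) ≤-refl))) ⟩
          s * ∑ s (λ i → ∑ s λ j → ∣ correlation i j ∣)
            ≡⟨ trans (sym (ℕ∑.sum-⊗ˡ s s _)) (ℕ∑.sum-≗ s λ i → sym (ℕ∑.sum-⊗ˡ s s _)) ⟩
          ∑ s (λ i → ∑ s λ j → s * ∣ correlation i j ∣)
            ≤⟨ ∑-mono s (λ i i<s → ∑-mono s λ j j<s → s∣correlation∣≤ i j i<s j<s) ⟩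
          ∑ s (λ i → ∑ s λ j → C₁ + ∣ ι (j ≟ i) ∣ * C₂)
            ≡⟨ ℕ∑.sum-cong s (λ i i<s → trans (ℕ∑.sum-⊕ s _ _) (cong₂ _+_ (∑-const s C₁)
                 (trans (ℕ∑.sum-single (λ j → ∣ ι (j ≟ i) ∣ * C₂) i i<s λ j _ j≢i → cong (λ x → ∣ x ∣ * C₂) (ι-no {d = j ≟ i} j≢i))
                        (trans (cong (λ x → ∣ x ∣ * C₂) (ι-yes {d = i ≟ i} refl)) (*-identityˡ C₂))))) ⟩
          ∑ s (λ i → s * C₁ + C₂)
            ≡⟨ ∑-const s (s * C₁ + C₂) ⟩
          s * (s * C₁ + C₂)
            ≡⟨ eq s (R * ν) ⟩
          s * (3600 * (s * (R * ν))) ∎)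
          where
          open ≤-Reasoning
          C₁ = 3360 * (R * ν)
          C₂ = s * (240 * (R * ν))
          eq : ∀ s x → s * (s * (3360 * x) + s * (240 * x)) ≡ s * (3600 * (s * x))
          eq = solve-∀

        block-sum : ℕ → ℤ
        block-sum N = ∑ᶻ s λ i → ∑ᶻ N λ k → a i ℤ.* b k ℤ.* (ι (U? i k) ℤ.* h (F (value i k)))

        inner-outside : ∀ t k → ¬ (κ ≤ k × k < κ + ν) → ∣ inner t k ∣ ≡ 0
        inner-outside t k out = cong ∣_∣ (ℤ∑.sum-zero s λ i i<s →
          trans (cong (λ x → a i ℤ.* x ℤ.* w (F (value i k) + t)) (ι-no {d = U? i k} (out ∘ window i k i<s)))
                (trans (cong (ℤ._* w (F (value i k) + t)) (ℤ.*-zeroʳ (a i))) (ℤ.*-zeroˡ (w (F (value i k) + t)))))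

        ∣block-sum∣≤∑ : ∀ {N} → κ + ν ≤ N → ∣ block-sum N ∣ ≤ ∑ P (λ t → ∑ ν (λ k → ∣ inner t (κ + k) ∣))
        ∣block-sum∣≤∑ {N} κ+ν≤N = begin
          ∣ block-sum N ∣
            ≡⟨ cong ∣_∣ expand ⟩
          ∣ ∑ᶻ R (λ r → ∑ᶻ N λ k → b k ℤ.* inner (14 * R + r) k) ∣
            ≤⟨ ≤-trans (∣∑ᶻ∣≤ R _) (∑-mono R λ r _ → ≤-trans (∣∑ᶻ∣≤ N _) (∑-mono N λ k _ → ∣x*y∣≤ (b k) (inner (14 * R + r) k) (∣b∣≤1 k) ≤-refl)) ⟩
          ∑ R (λ r → ∑ N λ k → ∣ inner (14 * R + r) k ∣)
            ≤⟨ ≤-trans (m≤n+m _ _) (≤-trans (≤-reflexive (sym (ℕ∑.sum-split (14 * R) R _))) (∑-mono-range _ 15R≤P)) ⟩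
          ∑ P (λ t → ∑ N λ k → ∣ inner t k ∣)
            ≡⟨ ℕ∑.sum-≗ P (λ t → ℕ∑.sum-window κ ν _ κ+ν≤N
                 (λ k k<κ → inner-outside t k λ (κ≤k , _) → <⇒≱ k<κ κ≤k)
                 (λ k κ+ν≤k → inner-outside t k λ (_ , k<) → <⇒≱ k< κ+ν≤k)) ⟩
          ∑ P (λ t → ∑ ν λ k → ∣ inner t (κ + k) ∣) ∎
          where
          open ≤-Reasoning
          15R≤P : 14 * R + R ≤ 16 * R
          15R≤P = m+n≤o⇒m≤o _ {R} (≤-reflexive (eq R))
            where eq : ∀ r → 14 * r + r + r ≡ 16 * r
                  eq = solve-∀
          expand : block-sum N ≡ ∑ᶻ R (λ r → ∑ᶻ N λ k → b k ℤ.* inner (14 * R + r) k)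
          expand = trans
            (ℤ∑.sum-≗ s λ i → trans (ℤ∑.sum-≗ N λ k → trans (eq₁ (a i) (b k) (ι (U? i k)) (h (F (value i k))))
                (sym (ℤ∑.sum-⊗ˡ R (b k ℤ.* (a i ℤ.* ι (U? i k))) _)))
              (ℤ∑.sum-swap N R _))
            (trans (ℤ∑.sum-swap s R _) (ℤ∑.sum-≗ R λ r → trans (ℤ∑.sum-swap s N _) (ℤ∑.sum-≗ N λ k →
              trans (ℤ∑.sum-≗ s λ i → trans (cong (b k ℤ.* (a i ℤ.* ι (U? i k)) ℤ.*_) (cong w (+-assoc (F (value i k)) (14 * R) r)))
                                            (ℤ.*-assoc (b k) (a i ℤ.* ι (U? i k)) _))
                    (ℤ∑.sum-⊗ˡ s (b k) _))))
            where eq₁ : ∀ a b i x → a ℤ.* b ℤ.* (i ℤ.* x) ≡ b ℤ.* (a ℤ.* i) ℤ.* x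
                  eq₁ = ℤ-Solver.solve-∀

        ∣block-sum∣≤ : ∀ {σ N} → σ * σ ≡ s → κ + ν ≤ N → ∣ block-sum N ∣ ≤ 240 * (R * ν * σ)
        ∣block-sum∣≤ {σ} {N} σ²≡s κ+ν≤N = m²≤n²⇒m≤n (begin
          ∣ block-sum N ∣ * ∣ block-sum N ∣     ≤⟨ *-mono-≤ (∣block-sum∣≤∑ κ+ν≤N) (∣block-sum∣≤∑ κ+ν≤N) ⟩
          _                                     ≤⟨ cauchy-schwarz₂ P ν _ ⟩
          P * ν * energy                        ≤⟨ *-monoʳ-≤ (P * ν) energy≤ ⟩
          16 * R * ν * (3600 * (s * (R * ν)))   ≡⟨ cong (λ x → 16 * R * ν * (3600 * (x * (R * ν)))) σ²≡s ⟨
          16 * R * ν * (3600 * (σ * σ * (R * ν))) ≡⟨ eq R ν σ ⟩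
          240 * (R * ν * σ) * (240 * (R * ν * σ)) ∎)
          where
          open ≤-Reasoning
          eq : ∀ r n z → 16 * r * n * (3600 * (z * z * (r * n))) ≡ 240 * (r * n * z) * (240 * (r * n * z))
          eq = solve-∀

m<suc[m/n]*n : ∀ m n .{{_ : NonZero n}} → m < suc (m / n) * n
m<suc[m/n]*n m n = subst (_< suc (m / n) * n) (sym (m≡m%n+[m/n]*n m n)) (+-monoˡ-< (m / n * n) (m%n<n m n))

module Weight (R s lo Y g g₀ : ℕ) .{{_ : NonZero R}}
  (2≤s : 2 ≤ s) (hi≤g² : lo + Y ≤ g * g) (g₀²≤lo : g₀ * g₀ ≤ lo)
  (sY≤2lo : s * Y ≤ 2 * lo) (2sg≤R : 2 * (s * g) ≤ R) (s<g₀ : s < g₀)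
  (sg≤Y : s * g ≤ Y) where

  open BilinearBlock R s lo Y g g₀ 2≤s hi≤g² g₀²≤lo sY≤2lo 2sg≤R s<g₀ public

  In? : ∀ n → Dec ((lo < n × n ≤ hi) × n % 4 ≡ 1)
  In? n = (lo <? n ×-dec n ≤? hi) ×-dec n % 4 ≟ 1

  φ : ℕ → ℤ
  φ n = ι (In? n) ℤ.* h (F n)

  φ-outside : ∀ n → ¬ (lo < n × n ≤ hi) → φ n ≡ + 0
  φ-outside n out = cong (ℤ._* h (F n)) (ι-no {d = In? n} (out ∘ proj₁))

  φ-above : ∀ n → hi < n → φ n ≡ + 0
  φ-above n hi<n = φ-outside n λ (_ , n≤hi) → <⇒≱ hi<n n≤hi

  φ-below : ∀ n → n ≤ lo → φ n ≡ + 0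
  φ-below n n≤lo = φ-outside n λ (lo<n , _) → <⇒≱ lo<n n≤lo

  N′ N : ℕ
  N′ = hi + 2
  N = N′ * 4

  hi<N : hi < N
  hi<N = ≤-trans (m<m+n hi z<s) (m≤m*n N′ 4)

  φ-N : ∀ n → N ≤ n → φ n ≡ + 0
  φ-N n N≤n = φ-above n (<-≤-trans hi<N N≤n)

  ∑-mod4 : ∀ (f : ℕ → ℤ) → ∑ᶻ N f ≡ ∑ᶻ 4 (λ c → ∑ᶻ N′ λ k → f (k * 4 + c))
  ∑-mod4 f = trans (ℤ∑.sum-blocks N′ 4 f) (ℤ∑.sum-swap N′ 4 λ k c → f (k * 4 + c))

  %4-split : ∀ d k c → (d * (k * 4 + c)) % 4 ≡ (d * c) % 4
  %4-split d k c = trans (cong (_% 4) (eq d k c)) ([m+kn]%n≡m%n (d * c) (d * k) 4)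
    where eq : ∀ d k c → d * (k * 4 + c) ≡ d * c + d * k * 4
          eq = solve-∀

  1≤s : 1 ≤ s
  1≤s = ≤-trans (s≤s z≤n) 2≤s

  ∣∑φ-multiples∣≤ : ∀ d .{{_ : NonZero d}} → 32 * (s * d) ≤ g₀ → s * d ≤ Y →
    s * ∣ ∑ᶻ N (λ m → φ (d * m)) ∣ ≤ 840 * (R * (Y / d))
  ∣∑φ-multiples∣≤ d slowness sd≤Y = begin
    s * ∣ ∑ᶻ N (λ m → φ (d * m)) ∣                                 ≡⟨ cong (λ x → s * ∣ x ∣) (∑-mod4 (λ m → φ (d * m))) ⟩
    s * ∣ ∑ᶻ 4 (λ c → ∑ᶻ N′ λ k → φ (d * (k * 4 + c))) ∣           ≤⟨ *-monoʳ-≤ s (∣∑ᶻ∣≤ 4 λ c → ∑ᶻ N′ λ k → φ (d * (k * 4 + c))) ⟩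
    s * ∑ 4 (λ c → ∣ ∑ᶻ N′ (λ k → φ (d * (k * 4 + c))) ∣)          ≡⟨ ℕ∑.sum-⊗ˡ 4 s (λ c → ∣ ∑ᶻ N′ (λ k → φ (d * (k * 4 + c))) ∣) ⟨
    ∑ 4 (λ c → s * ∣ ∑ᶻ N′ (λ k → φ (d * (k * 4 + c))) ∣)          ≤⟨ ∑-≤-const 4 (210 * (R * ν)) (λ c _ → class c) ⟩
    4 * (210 * (R * ν))                                            ≡⟨ *-assoc 4 210 (R * ν) ⟨
    840 * (R * ν)                                                  ∎
    where
    open ≤-Reasoning
    ν = Y / d
    s≤ν : s ≤ ν
    s≤ν = ≤-trans (≤-reflexive (sym (m*n/n≡m s d))) (/-monoˡ-≤ d sd≤Y)
    d≤Y : d ≤ Y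
    d≤Y = ≤-trans (m≤n*m d s {{>-nonZero 1≤s}}) sd≤Y
    Y≤ν*2d : Y ≤ ν * (2 * d)
    Y≤ν*2d = begin
      Y                      ≡⟨ m≡m%n+[m/n]*n Y d ⟩
      Y % d + ν * d          ≤⟨ +-monoˡ-≤ (ν * d) (≤-trans (<⇒≤ (m%n<n Y d)) (m≤n*m d ν {{>-nonZero (≤-trans 1≤s s≤ν)}})) ⟩
      ν * d + ν * d          ≡⟨ eq ν d ⟩
      ν * (2 * d)            ∎
      where eq : ∀ n d → n * d + n * d ≡ n * (2 * d)
            eq = solve-∀
    class : ∀ c → s * ∣ ∑ᶻ N′ (λ k → φ (d * (k * 4 + c))) ∣ ≤ 210 * (R * ν)
    class c with ∑ᶻ-convex (λ k → lo <? d * (k * 4 + c) ×-dec d * (k * 4 + c) ≤? hi)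
        (λ i≤j j≤k (lo< , _) (_ , ≤hi) → <-≤-trans lo< (mono i≤j) , ≤-trans (mono j≤k) ≤hi)
        N′ (λ k → h (F (d * (k * 4 + c))))
      where
      mono : ∀ {x y} → x ≤ y → d * (x * 4 + c) ≤ d * (y * 4 + c)
      mono x≤y = *-monoʳ-≤ d (+-monoˡ-≤ c (*-monoˡ-≤ 4 x≤y))
    ... | α , K , _ , inside , sum≡ = begin
      s * ∣ ∑ᶻ N′ (λ k → φ (d * (k * 4 + c))) ∣
        ≡⟨ cong (λ x → s * ∣ x ∣) (trans (ℤ∑.sum-≗ N′ pointwise) (ℤ∑.sum-⊗ˡ N′ χ _)) ⟩
      s * ∣ χ ℤ.* ∑ᶻ N′ (λ k → ι (lo <? d * (k * 4 + c) ×-dec d * (k * 4 + c) ≤? hi) ℤ.* h (F (d * (k * 4 + c)))) ∣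
        ≤⟨ *-monoʳ-≤ s (∣x*y∣≤ χ _ (∣ι∣≤1 (d * c % 4 ≟ 1)) (≤-reflexive (cong ∣_∣ sum≡))) ⟩
      s * ∣ ∑ᶻ K (λ j → h (F (d * n j))) ∣
        ≤⟨ linear-phase d n K ν slowness (≤-trans sg≤Y Y≤ν*2d) s≤ν K≤ν step (λ j j<K → <⇒≤ (proj₁ (inside j j<K)) , proj₂ (inside j j<K)) ⟩
      210 * (R * ν) ∎
      where
      χ = ι (d * c % 4 ≟ 1)
      n : ℕ → ℕ
      n j = (α + j) * 4 + c
      step : ∀ j → n (suc j) ≡ n j + 4
      step j = eq α j c
        where eq : ∀ α j c → (α + suc j) * 4 + c ≡ (α + j) * 4 + c + 4
              eq = solve-∀
      pointwise : ∀ k → φ (d * (k * 4 + c)) ≡ χ ℤ.* (ι (lo <? d * (k * 4 + c) ×-dec d * (k * 4 + c) ≤? hi) ℤ.* h (F (d * (k * 4 + c))))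
      pointwise k = trans (cong (ℤ._* h (F (d * (k * 4 + c)))) (trans (ι-×-dec (lo <? d * (k * 4 + c) ×-dec d * (k * 4 + c) ≤? hi) (d * (k * 4 + c) % 4 ≟ 1))
          (cong (λ x → ι (lo <? d * (k * 4 + c) ×-dec d * (k * 4 + c) ≤? hi) ℤ.* ι (x ≟ 1)) (%4-split d k c))))
        (eq (ι (lo <? d * (k * 4 + c) ×-dec d * (k * 4 + c) ≤? hi)) χ (h (F (d * (k * 4 + c)))))
        where eq : ∀ i x y → i ℤ.* x ℤ.* y ≡ x ℤ.* (i ℤ.* y)
              eq = ℤ-Solver.solve-∀
      K*d≤Y : ∀ K → (∀ j → j < K → lo < d * n j × d * n j ≤ hi) → K * d ≤ Y
      K*d≤Y zero          _   = z≤n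
      K*d≤Y (suc zero)    _   = ≤-trans (≤-reflexive (+-identityʳ d)) d≤Y
      K*d≤Y (suc (suc K)) ins = +-cancelˡ-≤ lo (suc (suc K) * d) Y (begin
        lo + suc (suc K) * d             ≤⟨ +-mono-≤ (<⇒≤ (proj₁ (ins 0 z<s))) (m≤m+n _ ((3 * K + 2) * d)) ⟩
        d * n 0 + (suc (suc K) * d + (3 * K + 2) * d)  ≡⟨ eq d α c K ⟩
        d * n (suc K)                    ≤⟨ proj₂ (ins (suc K) ≤-refl) ⟩
        hi                               ∎)
        where eq : ∀ d α c K → d * ((α + 0) * 4 + c) + (suc (suc K) * d + (3 * K + 2) * d) ≡ d * ((α + suc K) * 4 + c)
              eq = solve-∀
      K≤ν : K ≤ ν
      K≤ν = ≤-trans (≤-reflexive (sym (m*n/n≡m K d))) (/-monoˡ-≤ d (K*d≤Y K inside))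

  module BilinearSum (q Δ₀ σ J j₀ L : ℕ) .{{_ : NonZero q}} .{{_ : NonZero Δ₀}} .{{_ : NonZero j₀}}
    (σ²≡s : σ * σ ≡ s) (hi≤Yj₀ : hi ≤ Y * j₀) (J≤2^L : J ≤ 2 ^ L)
    (slowness : 16 * (s * (q * (Δ₀ * s))) ≤ g₀)
    (sqE≤Y : s * (q * (J * (s * Δ₀))) ≤ Y) (sgE≤YΔ₀ : s * g * (J * (s * Δ₀)) ≤ Y * Δ₀)
    (a b : ℕ → ℤ) (T : ℕ → ℕ) (∣a∣≤1 : ∀ m → ∣ a m ∣ ≤ 1) (∣b∣≤1 : ∀ n → ∣ b n ∣ ≤ 1)
    (a-small : ∀ m → m < j₀ * (s * Δ₀) → a m ≡ + 0) where

    B : ℕ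
    B = s * Δ₀

    instance
      s≢0 : NonZero s
      s≢0 = >-nonZero 1≤s
      B≢0 : NonZero B
      B≢0 = m*n≢0 s Δ₀
      qB≢0 : NonZero (q * B)
      qB≢0 = m*n≢0 q B

    A : ℕ
    A = Y / (q * B)

    module AtBlock (j : ℕ) .{{_ : NonZero j}} (j₀≤j : j₀ ≤ j) (j<J : j < J) where

      E₁ μ ν κ : ℕ
      E₁ = j * B
      μ = suc (A / j)
      ν = suc μ

      instance
        E₁≢0 : NonZero E₁
        E₁≢0 = m*n≢0 j B
        E₁+B≢0 : NonZero (E₁ + B)
        E₁+B≢0 = >-nonZero (≤-trans (>-nonZero⁻¹ B) (m≤n+m B E₁))
        top≢0 : NonZero (4 * (q * (E₁ + B)))
        top≢0 = m*n≢0 4 (q * (E₁ + B)) {{_}} {{m*n≢0 q (E₁ + B)}}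

      κ = lo / (4 * (q * (E₁ + B)))

      Y<qE₁μ : Y < q * E₁ * μ
      Y<qE₁μ = begin-strict
        Y                        <⟨ m<suc[m/n]*n Y (q * B) ⟩
        suc A * (q * B)          ≤⟨ *-monoˡ-≤ (q * B) (m<suc[m/n]*n A j) ⟩
        μ * j * (q * B)          ≡⟨ eq μ j q B ⟩
        q * E₁ * μ               ∎
        where
        open ≤-Reasoning
        eq : ∀ u j q b → u * j * (q * b) ≡ q * (j * b) * u
        eq = solve-∀

      E₁≤JB : E₁ ≤ J * B
      E₁≤JB = *-monoˡ-≤ B (<⇒≤ j<J)

      s<μ : s < μ
      s<μ = *-cancelʳ-< (q * E₁) s μ (≤-<-trans (≤-trans (*-monoʳ-≤ s (*-monoʳ-≤ q E₁≤JB)) sqE≤Y)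
        (<-≤-trans Y<qE₁μ (≤-reflexive (*-comm (q * E₁) μ))))

      sg≤ν : s * g ≤ ν * (q * Δ₀)
      sg≤ν = *-cancelʳ-≤ (s * g) (ν * (q * Δ₀)) E₁ (begin
        s * g * E₁               ≤⟨ *-monoʳ-≤ (s * g) E₁≤JB ⟩
        s * g * (J * B)          ≤⟨ sgE≤YΔ₀ ⟩
        Y * Δ₀                   ≤⟨ *-monoˡ-≤ Δ₀ (<⇒≤ Y<qE₁μ) ⟩
        q * E₁ * μ * Δ₀          ≤⟨ *-monoˡ-≤ Δ₀ (*-monoʳ-≤ (q * E₁) (n≤1+n μ)) ⟩
        q * E₁ * ν * Δ₀          ≡⟨ eq q E₁ ν Δ₀ ⟩
        ν * (q * Δ₀) * E₁        ∎)
        where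
        open ≤-Reasoning
        eq : ∀ q e n d → q * e * n * d ≡ n * (q * d) * e
        eq = solve-∀

      ν≤3A/j : ν ≤ 3 * (A / j)
      ν≤3A/j = begin
        2 + A / j                    ≤⟨ +-monoˡ-≤ (A / j) (+-mono-≤ 1≤A/j 1≤A/j) ⟩
        A / j + A / j + A / j        ≡⟨ eq (A / j) ⟩
        3 * (A / j)                  ∎
        where
        open ≤-Reasoning
        1≤A/j : 1 ≤ A / j
        1≤A/j = ≤-trans 1≤s (≤-pred s<μ)
        eq : ∀ x → x + x + x ≡ 3 * x
        eq = solve-∀

      κ+ν≤N′ : κ + ν ≤ N′
      κ+ν≤N′ = begin
        κ + (2 + A / j)     ≡⟨ eq κ (A / j) ⟩
        κ + A / j + 2       ≤⟨ +-monoˡ-≤ 2 (+-mono-≤ (m/n≤m lo (4 * (q * (E₁ + B)))) (≤-trans (m/n≤m A j) (m/n≤m Y (q * B)))) ⟩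
        lo + Y + 2          ∎
        where
        open ≤-Reasoning
        eq : ∀ x y → x + (2 + y) ≡ x + y + 2
        eq = solve-∀

      window : ∀ m c k → E₁ ≤ m → m < E₁ + B → c < 4 → lo < q * m * (k * 4 + c) → q * m * (k * 4 + c) ≤ hi →
               κ ≤ k × k < κ + ν
      window m c k E₁≤m m< c<4 lo< ≤hi = ≮⇒≥ below , ≰⇒> above
        where
        open ≤-Reasoning
        below : ¬ k < κ
        below k<κ = <⇒≱ lo< (begin
          q * m * (k * 4 + c)               ≤⟨ *-mono-≤ (*-monoʳ-≤ q (<⇒≤ m<)) (+-monoʳ-≤ (k * 4) (<⇒≤ c<4)) ⟩
          q * (E₁ + B) * (k * 4 + 4)        ≡⟨ eq (q * (E₁ + B)) k ⟩
          suc k * (4 * (q * (E₁ + B)))      ≤⟨ *-monoˡ-≤ (4 * (q * (E₁ + B))) k<κ ⟩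
          κ * (4 * (q * (E₁ + B)))          ≤⟨ m/n*n≤m lo (4 * (q * (E₁ + B))) ⟩
          lo                                ∎)
          where eq : ∀ x k → x * (k * 4 + 4) ≡ suc k * (4 * x)
                eq = solve-∀
        above : ¬ κ + ν ≤ k
        above κ+ν≤k = <⇒≱ contra (≤-trans (*-monoˡ-≤ E₁ 3Y≤) (≤-trans (≤-reflexive (eq₅ q B κ E₁)) (≤-trans (*-monoʳ-≤ B 4a≤hi) (≤-trans (*-monoʳ-≤ B hi≤Yj₀) (≤-trans (*-monoʳ-≤ B (*-monoʳ-≤ Y j₀≤j)) (≤-reflexive (eq₆ B Y j)))))))
          where
          e = q * E₁
          4a+4Y≤hi : 4 * e * suc κ + 4 * Y ≤ hi
          4a+4Y≤hi = begin
            4 * e * suc κ + 4 * Y               ≤⟨ +-monoʳ-≤ (4 * e * suc κ) (*-monoʳ-≤ 4 (<⇒≤ Y<qE₁μ)) ⟩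
            4 * e * suc κ + 4 * (e * μ)         ≡⟨ eq₁ e κ μ ⟩
            e * ((κ + suc μ) * 4)               ≤⟨ *-mono-≤ (*-monoʳ-≤ q E₁≤m) (≤-trans (*-monoˡ-≤ 4 κ+ν≤k) (m≤m+n (k * 4) c)) ⟩
            q * m * (k * 4 + c)                 ≤⟨ ≤hi ⟩
            hi                                  ∎
            where eq₁ : ∀ a x u → 4 * a * suc x + 4 * (a * u) ≡ a * ((x + suc u) * 4)
                  eq₁ = solve-∀
          4a≤hi : 4 * e * suc κ ≤ hi
          4a≤hi = ≤-trans (m≤m+n _ (4 * Y)) 4a+4Y≤hi
          lo≤ : lo ≤ 4 * e * suc κ + 4 * (q * B) * suc κ
          lo≤ = ≤-trans (<⇒≤ (m<suc[m/n]*n lo (4 * (q * (E₁ + B))))) (≤-reflexive (eq₂ κ q E₁ B))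
            where eq₂ : ∀ x q e b → suc x * (4 * (q * (e + b))) ≡ 4 * (q * e) * suc x + 4 * (q * b) * suc x
                  eq₂ = solve-∀
          3Y≤ : 3 * Y ≤ 4 * (q * B) * suc κ
          3Y≤ = +-cancelˡ-≤ (4 * e * suc κ + Y) _ _ (begin
            4 * e * suc κ + Y + 3 * Y                       ≡⟨ eq₃ (4 * e * suc κ) Y ⟩
            4 * e * suc κ + 4 * Y                           ≤⟨ 4a+4Y≤hi ⟩
            lo + Y                                          ≤⟨ +-monoˡ-≤ Y lo≤ ⟩
            4 * e * suc κ + 4 * (q * B) * suc κ + Y         ≡⟨ eq₄ (4 * e * suc κ) (4 * (q * B) * suc κ) Y ⟩
            4 * e * suc κ + Y + 4 * (q * B) * suc κ         ∎)
            where
            eq₃ : ∀ x y → x + y + 3 * y ≡ x + 4 * y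
            eq₃ = solve-∀
            eq₄ : ∀ x z y → x + z + y ≡ x + y + z
            eq₄ = solve-∀
          eq₅ : ∀ q b x e → 4 * (q * b) * suc x * e ≡ b * (4 * (q * e) * suc x)
          eq₅ = solve-∀
          eq₆ : ∀ b y j → b * (y * j) ≡ y * (j * b)
          eq₆ = solve-∀
          1≤Y : 1 ≤ Y
          1≤Y = ≤-trans (*-mono-≤ {1} {s} {1} 1≤s (*-mono-≤ {1} {q} {1} (>-nonZero⁻¹ q) (*-mono-≤ {1} {J} {1} (≤-trans (s≤s z≤n) j<J) (>-nonZero⁻¹ B)))) sqE≤Y
          contra : Y * E₁ < 3 * Y * E₁
          contra = *-monoˡ-< E₁ (≤-trans (+-monoˡ-≤ Y 1≤Y) (+-monoʳ-≤ Y (m≤m+n Y (Y + 0))))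

      class-sum : ∀ r c → r < Δ₀ → c < 4 →
        ∣ ∑ᶻ s (λ i → ∑ᶻ N′ λ k → let m = j * B + (i * Δ₀ + r); n = k * 4 + c in
            a m ℤ.* b n ℤ.* (ι (T m ≤? n) ℤ.* φ (q * m * n))) ∣ ≤ 720 * (R * (σ * (A / j)))
      class-sum r c r<Δ₀ c<4 = begin
        _                             ≡⟨ cong ∣_∣ (ℤ∑.sum-≗ s λ i → ℤ∑.sum-≗ N′ λ k → rewrite-term i k) ⟩
        ∣ Block.block-sum q Δ₀ (E₁ + r) c T {κ} {ν} win slowness sg≤ν (≤-trans (<⇒≤ s<μ) (n≤1+n μ)) a′ b′ ∣a′∣≤1 (λ k → ∣b∣≤1 (k * 4 + c)) N′ ∣
                                      ≤⟨ Block.∣block-sum∣≤ q Δ₀ (E₁ + r) c T win slowness sg≤ν (≤-trans (<⇒≤ s<μ) (n≤1+n μ)) a′ b′ ∣a′∣≤1 (λ k → ∣b∣≤1 (k * 4 + c)) σ²≡s κ+ν≤N′ ⟩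
        240 * (R * ν * σ)             ≤⟨ *-monoʳ-≤ 240 (*-monoˡ-≤ σ (*-monoʳ-≤ R ν≤3A/j)) ⟩
        240 * (R * (3 * (A / j)) * σ) ≡⟨ eq R (A / j) σ ⟩
        720 * (R * (σ * (A / j)))     ∎
        where
        open ≤-Reasoning
        open Block q Δ₀ (E₁ + r) c T using (element; value; U; U?)
        eq : ∀ r x z → 240 * (r * (3 * x) * z) ≡ 720 * (r * (z * x))
        eq = solve-∀
        a′ b′ : ℕ → ℤ
        a′ i = a (element i) ℤ.* ι (q * element i * c % 4 ≟ 1)
        b′ k = b (k * 4 + c)
        ∣a′∣≤1 : ∀ i → ∣ a′ i ∣ ≤ 1
        ∣a′∣≤1 i = ∣x*y∣≤ (a (element i)) _ (∣a∣≤1 (element i)) (∣ι∣≤1 (q * element i * c % 4 ≟ 1))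
        m≡ : ∀ i → j * B + (i * Δ₀ + r) ≡ element i
        m≡ i = eq′ (j * B) i Δ₀ r
          where eq′ : ∀ x i d r → x + (i * d + r) ≡ x + r + d * i
                eq′ = solve-∀
        element< : ∀ i → i < s → element i < E₁ + B
        element< i i<s = begin-strict
          E₁ + r + Δ₀ * i        ≡⟨ +-assoc E₁ r (Δ₀ * i) ⟩
          E₁ + (r + Δ₀ * i)      <⟨ +-monoʳ-< E₁ (+-monoˡ-< (Δ₀ * i) r<Δ₀) ⟩
          E₁ + (Δ₀ + Δ₀ * i)     ≡⟨ cong (λ x → E₁ + x) (trans (sym (*-suc Δ₀ i)) (*-comm Δ₀ (suc i))) ⟩
          E₁ + suc i * Δ₀        ≤⟨ +-monoʳ-≤ E₁ (*-monoˡ-≤ Δ₀ i<s) ⟩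
          E₁ + B                 ∎
        win : ∀ i k → i < s → U i k → κ ≤ k × k < κ + ν
        win i k i<s ((lo< , ≤hi) , _) =
          window (element i) c k (≤-trans (m≤m+n E₁ r) (m≤m+n (E₁ + r) (Δ₀ * i))) (element< i i<s) c<4 lo< ≤hi
        rewrite-term : ∀ i k → _
        rewrite-term i k = trans
          (cong (λ m → a m ℤ.* b (k * 4 + c) ℤ.* (ι (T m ≤? k * 4 + c) ℤ.* φ (q * m * (k * 4 + c)))) (m≡ i))
          (trans (cong (λ x → a (element i) ℤ.* b (k * 4 + c) ℤ.* (ιT ℤ.* (x ℤ.* h (F (value i k)))))
                   (trans (ι-×-dec range? (value i k % 4 ≟ 1)) (cong (λ x → ι range? ℤ.* ι (x ≟ 1)) (%4-split (q * element i) k c))))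
            (trans (eq₁ (a (element i)) (b (k * 4 + c)) ιT (ι range?) (ι (q * element i * c % 4 ≟ 1)) (h (F (value i k))))
                   (cong (λ x → a′ i ℤ.* b (k * 4 + c) ℤ.* (x ℤ.* h (F (value i k)))) (sym (ι-×-dec range? (T (element i) ≤? k * 4 + c))))))
          where
          range? = lo <? value i k ×-dec value i k ≤? hi
          ιT = ι (T (element i) ≤? k * 4 + c)
          eq₁ : ∀ a b t u v x → a ℤ.* b ℤ.* (t ℤ.* (u ℤ.* v ℤ.* x)) ≡ a ℤ.* v ℤ.* b ℤ.* (u ℤ.* t ℤ.* x)
          eq₁ = ℤ-Solver.solve-∀

    divA : ℕ → ℕ
    divA zero        = 0
    divA j@(suc _) = A / j

    summand : ℕ → ℕ → ℤ
    summand m n = a m ℤ.* b n ℤ.* (ι (T m ≤? n) ℤ.* φ (q * m * n))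

    piece : ∀ j r c → j < J → r < Δ₀ → c < 4 →
      ∣ ∑ᶻ s (λ i → ∑ᶻ N′ λ k → summand (j * B + (i * Δ₀ + r)) (k * 4 + c)) ∣ ≤ 720 * (R * (σ * divA j))
    piece j r c j<J r<Δ₀ c<4 with j <? j₀
    ... | yes j<j₀ = ≤-trans (≤-reflexive (cong ∣_∣ (ℤ∑.sum-zero s λ i i<s → ℤ∑.sum-zero N′ λ k _ →
          trans (cong (λ x → x ℤ.* b (k * 4 + c) ℤ.* (ι (T (m i) ≤? k * 4 + c) ℤ.* φ (q * m i * (k * 4 + c)))) (a-small (m i) (small i i<s)))
                (trans (cong (ℤ._* (ι (T (m i) ≤? k * 4 + c) ℤ.* φ (q * m i * (k * 4 + c)))) (ℤ.*-zeroˡ (b (k * 4 + c)))) (ℤ.*-zeroˡ (ι (T (m i) ≤? k * 4 + c) ℤ.* φ (q * m i * (k * 4 + c)))))))) z≤n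
      where
      open ≤-Reasoning
      m : ℕ → ℕ
      m i = j * B + (i * Δ₀ + r)
      small : ∀ i → i < s → m i < j₀ * B
      small i i<s = begin-strict
        j * B + (i * Δ₀ + r)      <⟨ +-monoʳ-< (j * B) (+-monoʳ-< (i * Δ₀) r<Δ₀) ⟩
        j * B + (i * Δ₀ + Δ₀)     ≡⟨ cong (λ x → j * B + x) (+-comm (i * Δ₀) Δ₀) ⟩
        j * B + suc i * Δ₀        ≤⟨ +-monoʳ-≤ (j * B) (*-monoˡ-≤ Δ₀ i<s) ⟩
        j * B + B                 ≡⟨ +-comm (j * B) B ⟩
        suc j * B                 ≤⟨ *-monoˡ-≤ B j<j₀ ⟩
        j₀ * B                    ∎
    piece zero    r c j<J r<Δ₀ c<4 | no j≮j₀ = contradiction (>-nonZero⁻¹ j₀) j≮j₀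
    piece (suc j) r c j<J r<Δ₀ c<4 | no j≮j₀ = AtBlock.class-sum (suc j) (≮⇒≥ j≮j₀) j<J r c r<Δ₀ c<4

    ∣bilinear-sum∣≤ : ∣ ∑ᶻ (J * B) (λ m → ∑ᶻ N λ n → summand m n) ∣ ≤ 2880 * (R * (Δ₀ * σ * (L * A)))
    ∣bilinear-sum∣≤ = begin
      ∣ ∑ᶻ (J * B) (λ m → ∑ᶻ N (summand m)) ∣
        ≡⟨ cong ∣_∣ regroup ⟩
      ∣ ∑ᶻ J (λ j → ∑ᶻ Δ₀ λ r → ∑ᶻ 4 λ c → ∑ᶻ s λ i → ∑ᶻ N′ λ k → summand (j * B + (i * Δ₀ + r)) (k * 4 + c)) ∣
        ≤⟨ ≤-trans (∣∑ᶻ∣≤ J _) (∑-mono J λ j j<J → ∣∑ᶻ∣≤-const Δ₀ (4 * (720 * (R * (σ * divA j)))) λ r r<Δ₀ → ∣∑ᶻ∣≤-const 4 {λ c → ∑ᶻ s λ i → ∑ᶻ N′ λ k → summand (j * B + (i * Δ₀ + r)) (k * 4 + c)} (720 * (R * (σ * divA j))) λ c c<4 → piece j r c j<J r<Δ₀ c<4) ⟩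
      ∑ J (λ j → Δ₀ * (4 * (720 * (R * (σ * divA j)))))
        ≡⟨ trans (ℕ∑.sum-≗ J λ j → eq Δ₀ R σ (divA j)) (ℕ∑.sum-⊗ˡ J (2880 * (R * (Δ₀ * σ))) divA) ⟩
      2880 * (R * (Δ₀ * σ)) * ∑ J divA
        ≤⟨ *-monoʳ-≤ (2880 * (R * (Δ₀ * σ))) (≤-trans (∑-mono-range divA J≤2^L) (∑-harmonic L divA A refl j*divA≤A)) ⟩
      2880 * (R * (Δ₀ * σ)) * (L * A)
        ≡⟨ eq₂ R (Δ₀ * σ) (L * A) ⟩
      2880 * (R * (Δ₀ * σ * (L * A))) ∎
      where
      open ≤-Reasoning
      eq : ∀ d r z x → d * (4 * (720 * (r * (z * x)))) ≡ 2880 * (r * (d * z)) * x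
      eq = solve-∀
      eq₂ : ∀ r x y → 2880 * (r * x) * y ≡ 2880 * (r * (x * y))
      eq₂ = solve-∀
      j*divA≤A : ∀ j → j * divA j ≤ A
      j*divA≤A zero    = z≤n
      j*divA≤A (suc j) = ≤-trans (≤-reflexive (*-comm (suc j) (A / suc j))) (m/n*n≤m A (suc j))
      regroup : ∑ᶻ (J * B) (λ m → ∑ᶻ N (summand m)) ≡
        ∑ᶻ J (λ j → ∑ᶻ Δ₀ λ r → ∑ᶻ 4 λ c → ∑ᶻ s λ i → ∑ᶻ N′ λ k → summand (j * B + (i * Δ₀ + r)) (k * 4 + c))
      regroup = trans (ℤ∑.sum-blocks J B _) (ℤ∑.sum-≗ J λ j →
        trans (ℤ∑.sum-blocks s Δ₀ _) (trans (ℤ∑.sum-swap s Δ₀ _) (ℤ∑.sum-≗ Δ₀ λ r →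
          trans (ℤ∑.sum-≗ s λ i → ∑-mod4 (summand (j * B + (i * Δ₀ + r)))) (ℤ∑.sum-swap s 4 λ i c → ∑ᶻ N′ λ k → summand (j * B + (i * Δ₀ + r)) (k * 4 + c)))))

-- Buchstab's identity

rough-weaken : ∀ {v w n} → v ≤ w → w Rough n → v Rough n
rough-weaken v≤w r (hasNonTrivialDivisor d<v d∣n) = r (hasNonTrivialDivisor (<-≤-trans d<v v≤w) d∣n)

rough? : ∀ w n → Dec (w Rough n)
rough? 0 n = yes ℙ.0-rough
rough? 1 n = yes ℙ.1-rough
rough? 2 n = yes ℙ.2-rough
rough? (suc w@(2+ _)) n with rough? w n | w ∣? n
... | no ¬r | _       = no λ r → ¬r (rough-weaken (n≤1+n w) r)
... | yes r | no w∤n  = yes (ℙ.∤⇒rough-suc w∤n r)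
... | yes r | yes w∣n = no λ r′ → r′ (hasNonTrivialDivisor (n<1+n w) w∣n)

rough-*⇒ : ∀ {w m} .{{_ : NonTrivial w}} → w Rough (w * m) → Prime w × w Rough m
rough-*⇒ {w} {m} r = ℙ.rough∧∣⇒prime r (m∣m*n m) , ℙ.rough∧∣⇒rough r (n∣m*n w)

rough-*⇐ : ∀ {w m} → Prime w → w Rough m → w Rough (w * m)
rough-*⇐ {w} pw r (hasNonTrivialDivisor {divisor = d} d<w d∣wm) =
  r (hasNonTrivialDivisor d<w (coprime-divisor (Coprime.sym (prime⇒coprime pw {{nonTrivial⇒nonZero d}} d<w)) d∣wm))

ρ : ℕ → ℕ → ℤ
ρ w n = ι (rough? w n)

π : ℕ → ℤ
π n = ι (prime? n)

∣ρ∣≤1 : ∀ w n → ∣ ρ w n ∣ ≤ 1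
∣ρ∣≤1 w n = ∣ι∣≤1 (rough? w n)

∣ρ∣-antitone : ∀ w n → ∣ ρ (suc w) n ∣ ≤ ∣ ρ w n ∣
∣ρ∣-antitone w n with rough? (suc w) n
... | no _  = z≤n
... | yes r = ≤-reflexive (sym (cong ∣_∣ (ι-yes {d = rough? w n} (rough-weaken (n≤1+n w) r))))

ρ-suc-∣ : ∀ {w n} .{{_ : NonTrivial w}} → w ∣ n → ρ (suc w) n ≡ + 0
ρ-suc-∣ {w} w∣n = ι-no λ r → r (hasNonTrivialDivisor (n<1+n w) w∣n)

ρ-suc-∤ : ∀ {w n} → ¬ w ∣ n → ρ (suc w) n ≡ ρ w n
ρ-suc-∤ {w} {n} w∤n = ι-cong (rough? (suc w) n) (rough? w n) (rough-weaken (n≤1+n w)) (ℙ.∤⇒rough-suc w∤n)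

ρ-suc : ∀ w n .{{_ : NonTrivial w}} → ρ (suc w) n ≡ ρ w n ℤ.- ι (w ∣? n) ℤ.* ρ w n
ρ-suc w n with w ∣? n
... | yes w∣n = trans (ρ-suc-∣ w∣n) (sym (trans (cong (λ x → ρ w n ℤ.- x) (ℤ.*-identityˡ (ρ w n))) (ℤ.+-inverseʳ (ρ w n))))
... | no  w∤n = trans (ρ-suc-∤ w∤n) (sym (trans (cong (λ x → ρ w n ℤ.- x) (ℤ.*-zeroˡ (ρ w n))) (ℤ.+-identityʳ (ρ w n))))

ρ-* : ∀ w m .{{_ : NonTrivial w}} → ρ w (w * m) ≡ π w ℤ.* ρ w m
ρ-* w m = trans (ι-cong (rough? w (w * m)) (prime? w ×-dec rough? w m) rough-*⇒ (λ (pw , r) → rough-*⇐ pw r))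
                (ι-×-dec (prime? w) (rough? w m))

module Sieve (φ : ℕ → ℤ) (N : ℕ) (φ-N : ∀ n → N ≤ n → φ n ≡ + 0) (φ-0 : φ 0 ≡ + 0) where

  G : ℕ → ℕ → ℤ
  G e w = ∑ᶻ N λ m → φ (e * m) ℤ.* ρ w m

  G-0 : ∀ w → G 0 w ≡ + 0
  G-0 w = ℤ∑.sum-zero N λ m _ → trans (cong (ℤ._* ρ w m) φ-0) (ℤ.*-zeroˡ (ρ w m))

  buchstab : ∀ e w .{{_ : NonTrivial w}} → G e (suc w) ≡ G e w ℤ.- π w ℤ.* G (w * e) w
  buchstab zero w = begin
    G 0 (suc w)                             ≡⟨ G-0 (suc w) ⟩
    + 0                                     ≡⟨ cong₂ ℤ._-_ (G-0 w) (trans (cong (π w ℤ.*_) (G-0 w)) (ℤ.*-zeroʳ (π w))) ⟨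
    G 0 w ℤ.- π w ℤ.* G 0 w                 ≡⟨ cong (λ x → G 0 w ℤ.- π w ℤ.* G x w) (*-zeroʳ w) ⟨
    G 0 w ℤ.- π w ℤ.* G (w * 0) w           ∎
    where open ≡-Reasoning
  buchstab e@(suc _) w = begin
    ∑ᶻ N (λ m → φ (e * m) ℤ.* ρ (suc w) m)
      ≡⟨ ℤ∑.sum-≗ N (λ m → trans (cong (φ (e * m) ℤ.*_) (ρ-suc w m)) (eq₁ (φ (e * m)) (ρ w m) (ι (w ∣? m)))) ⟩
    ∑ᶻ N (λ m → φ (e * m) ℤ.* ρ w m ℤ.- f m)
      ≡⟨ ∑ᶻ-sub N _ f ⟩
    G e w ℤ.- ∑ᶻ N f
      ≡⟨ cong (λ x → G e w ℤ.- x) (trans (ℤ∑.sum-multiples N w f off above) (trans (ℤ∑.sum-≗ N rewrite-f) (ℤ∑.sum-⊗ˡ N (π w) _))) ⟩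
    G e w ℤ.- π w ℤ.* G (w * e) w ∎
    where
    open ≡-Reasoning
    instance _ = nonTrivial⇒nonZero w
    f : ℕ → ℤ
    f m = ι (w ∣? m) ℤ.* (φ (e * m) ℤ.* ρ w m)
    eq₁ : ∀ x r i → x ℤ.* (r ℤ.- i ℤ.* r) ≡ x ℤ.* r ℤ.- i ℤ.* (x ℤ.* r)
    eq₁ = ℤ-Solver.solve-∀
    eq₂ : ∀ x p r → x ℤ.* (p ℤ.* r) ≡ p ℤ.* (x ℤ.* r)
    eq₂ = ℤ-Solver.solve-∀
    eq₃ : ∀ e w m → e * (w * m) ≡ w * e * m
    eq₃ = solve-∀
    off : ∀ m → ¬ w ∣ m → f m ≡ + 0
    off m w∤m = trans (cong (ℤ._* (φ (e * m) ℤ.* ρ w m)) (ι-no {d = w ∣? m} w∤m)) (ℤ.*-zeroˡ (φ (e * m) ℤ.* ρ w m))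
    above : ∀ m → N ≤ m → f m ≡ + 0
    above m N≤m = trans (cong (λ x → ι (w ∣? m) ℤ.* (x ℤ.* ρ w m)) (φ-N (e * m) (≤-trans N≤m (m≤n*m m e))))
      (trans (cong (ι (w ∣? m) ℤ.*_) (ℤ.*-zeroˡ (ρ w m))) (ℤ.*-zeroʳ (ι (w ∣? m))))
    rewrite-f : ∀ m → f (w * m) ≡ π w ℤ.* (φ (w * e * m) ℤ.* ρ w m)
    rewrite-f m = trans (cong₂ ℤ._*_ (ι-yes {d = w ∣? w * m} (m∣m*n m)) (cong₂ ℤ._*_ (cong φ (eq₃ e w m)) (ρ-* w m)))
      (trans (ℤ.*-identityˡ _) (eq₂ (φ (w * e * m)) (π w) (ρ w m)))

  module _ (D z T₁ : ℕ) (T₂ : ℕ → ℕ)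
    (typeI : ∑ D (λ e → ∣ ∑ᶻ N (λ m → φ (e * m)) ∣) ≤ T₁)
    (typeII : ∀ v → v < z → Prime v → ∀ (a : ℕ → ℤ) → (∀ e → ∣ a e ∣ ≤ 1) → (∀ e → v * e < D → a e ≡ + 0) →
       ∣ ∑ᶻ D (λ e → a e ℤ.* G (v * e) v) ∣ ≤ T₂ v) where

    -- Buchstab's identity is iterated only while the sifting divisor e stays below D.
    iterated-buchstab : ∀ u → 2 + u ≤ z → (c : ℕ → ℤ) → (∀ e → ∣ c e ∣ ≤ ∣ ρ (2 + u) e ∣) →
      ∣ ∑ᶻ D (λ e → c e ℤ.* G e (2 + u)) ∣ ≤ T₁ + ∑ (2 + u) T₂
    iterated-buchstab zero _ c c≤ = begin
      ∣ ∑ᶻ D (λ e → c e ℤ.* G e 2) ∣                ≤⟨ ∣∑ᶻ∣≤ D _ ⟩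
      ∑ D (λ e → ∣ c e ℤ.* G e 2 ∣)                 ≤⟨ ∑-mono D (λ e _ → ∣x*y∣≤ (c e) (G e 2) (≤-trans (c≤ e) (∣ρ∣≤1 2 e))
                                                         (≤-reflexive (cong ∣_∣ (ℤ∑.sum-≗ N λ m → ℤ.*-identityʳ (φ (e * m)))))) ⟩
      ∑ D (λ e → ∣ ∑ᶻ N (λ m → φ (e * m)) ∣)        ≤⟨ typeI ⟩
      T₁                                            ≤⟨ m≤m+n T₁ _ ⟩
      T₁ + ∑ 2 T₂                                   ∎
      where open ≤-Reasoning
    iterated-buchstab (suc u) w<z c c≤ = begin
      ∣ ∑ᶻ D (λ e → c e ℤ.* G e (suc w)) ∣
        ≡⟨ cong ∣_∣ step ⟩
      ∣ ∑ᶻ D (λ e → c′ e ℤ.* G e w) ℤ.- π w ℤ.* ∑ᶻ D (λ e → a e ℤ.* G (w * e) w) ∣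
        ≤⟨ ∣i-j∣≤∣i∣+∣j∣ (∑ᶻ D (λ e → c′ e ℤ.* G e w)) _ ⟩
      ∣ ∑ᶻ D (λ e → c′ e ℤ.* G e w) ∣ + ∣ π w ℤ.* ∑ᶻ D (λ e → a e ℤ.* G (w * e) w) ∣
        ≤⟨ +-mono-≤ (iterated-buchstab u (<⇒≤ w<z) c′ c′≤) tail≤ ⟩
      T₁ + ∑ w T₂ + T₂ w
        ≡⟨ +-assoc T₁ (∑ w T₂) (T₂ w) ⟩
      T₁ + ∑ (suc w) T₂ ∎
      where
      open ≤-Reasoning
      w = 2 + u
      c″ c′ a : ℕ → ℤ
      c″ e = ι (w ∣? e) ℤ.* c (e / w)
      c′ e = c e ℤ.- π w ℤ.* c″ e
      a e = ι (D ≤? w * e) ℤ.* c e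
      ∣c∣≤1 : ∀ e → ∣ c e ∣ ≤ 1
      ∣c∣≤1 e = ≤-trans (c≤ e) (∣ρ∣≤1 (suc w) e)
      tail≤ : ∣ π w ℤ.* ∑ᶻ D (λ e → a e ℤ.* G (w * e) w) ∣ ≤ T₂ w
      tail≤ with prime? w
      ... | no _   = ≤-trans (≤-reflexive (cong ∣_∣ (ℤ.*-zeroˡ (∑ᶻ D (λ e → a e ℤ.* G (w * e) w))))) z≤n
      ... | yes pw = ≤-trans (≤-reflexive (cong ∣_∣ (ℤ.*-identityˡ (∑ᶻ D (λ e → a e ℤ.* G (w * e) w)))))
        (typeII w w<z pw a (λ e → ∣x*y∣≤ (ι (D ≤? w * e)) (c e) (∣ι∣≤1 (D ≤? w * e)) (∣c∣≤1 e))
          λ e we<D → trans (cong (ℤ._* c e) (ι-no {d = D ≤? w * e} (<⇒≱ we<D))) (ℤ.*-zeroˡ (c e)))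
      c′≤ : ∀ e → ∣ c′ e ∣ ≤ ∣ ρ w e ∣
      c′≤ e with w ∣? e
      ... | no w∤e = begin
        ∣ c e ℤ.- π w ℤ.* (+ 0 ℤ.* c (e / w)) ∣   ≡⟨ cong ∣_∣ (eq (c e) (π w) (c (e / w))) ⟩
        ∣ c e ∣                                   ≤⟨ ≤-trans (c≤ e) (∣ρ∣-antitone w e) ⟩
        ∣ ρ w e ∣                                 ∎
        where eq : ∀ x p y → x ℤ.- p ℤ.* (+ 0 ℤ.* y) ≡ x
              eq = ℤ-Solver.solve-∀
      ... | yes w∣e@(divides-refl k) = begin
        ∣ c (k * w) ℤ.- π w ℤ.* (+ 1 ℤ.* c (k * w / w)) ∣
          ≡⟨ cong ∣_∣ (trans (cong₂ (λ x y → x ℤ.- π w ℤ.* (+ 1 ℤ.* c y))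
               (ℤ.∣i∣≡0⇒i≡0 {c (k * w)} (n≤0⇒n≡0 (≤-trans (c≤ (k * w)) (≤-reflexive (cong ∣_∣ (ρ-suc-∣ w∣e)))))) (m*n/n≡m k w))
             (eq (π w) (c k))) ⟩
        ∣ ℤ.- (π w ℤ.* c k) ∣       ≡⟨ trans (ℤ.∣-i∣≡∣i∣ (π w ℤ.* c k)) (ℤ.∣i*j∣≡∣i∣*∣j∣ (π w) (c k)) ⟩
        ∣ π w ∣ * ∣ c k ∣           ≤⟨ *-monoʳ-≤ ∣ π w ∣ (≤-trans (c≤ k) (∣ρ∣-antitone w k)) ⟩
        ∣ π w ∣ * ∣ ρ w k ∣         ≡⟨ ℤ.∣i*j∣≡∣i∣*∣j∣ (π w) (ρ w k) ⟨
        ∣ π w ℤ.* ρ w k ∣           ≡⟨ cong ∣_∣ (trans (sym (ρ-* w k)) (cong (ρ w) (*-comm w k))) ⟩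
        ∣ ρ w (k * w) ∣             ∎
        where eq : ∀ p y → + 0 ℤ.- p ℤ.* (+ 1 ℤ.* y) ≡ ℤ.- (p ℤ.* y)
              eq = ℤ-Solver.solve-∀
      f : ℕ → ℤ
      f e = ι (e <? D) ℤ.* (c″ e ℤ.* G e w)
      multiples : ∑ᶻ D (λ e → c″ e ℤ.* G e w) ≡ ∑ᶻ D (λ e → ι (w * e <? D) ℤ.* (c e ℤ.* G (w * e) w))
      multiples = trans
        (ℤ∑.sum-cong D λ e e<D → sym (trans (cong (ℤ._* (c″ e ℤ.* G e w)) (ι-yes {d = e <? D} e<D)) (ℤ.*-identityˡ _)))
        (trans (ℤ∑.sum-multiples D w f
            (λ e w∤e → trans (cong (λ x → ι (e <? D) ℤ.* (x ℤ.* c (e / w) ℤ.* G e w)) (ι-no {d = w ∣? e} w∤e)) (eq (ι (e <? D)) (c (e / w)) (G e w)))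
            (λ e D≤e → trans (cong (ℤ._* (c″ e ℤ.* G e w)) (ι-no {d = e <? D} (≤⇒≯ D≤e))) (ℤ.*-zeroˡ (c″ e ℤ.* G e w))))
          (ℤ∑.sum-≗ D λ e → cong (λ x → ι (w * e <? D) ℤ.* (x ℤ.* G (w * e) w))
            (trans (cong₂ ℤ._*_ (ι-yes {d = w ∣? w * e} (m∣m*n e)) (cong c (trans (cong (_/ w) (*-comm w e)) (m*n/n≡m e w)))) (ℤ.*-identityˡ (c e)))))
        where eq : ∀ x y z → x ℤ.* (+ 0 ℤ.* y ℤ.* z) ≡ + 0
              eq = ℤ-Solver.solve-∀
      ι-split : ∀ e → ι (w * e <? D) ℤ.+ ι (D ≤? w * e) ≡ + 1
      ι-split e with w * e <? D
      ... | yes lt = cong (λ x → + 1 ℤ.+ x) (ι-no {d = D ≤? w * e} (<⇒≱ lt))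
      ... | no ¬lt = cong (λ x → + 0 ℤ.+ x) (ι-yes {d = D ≤? w * e} (≮⇒≥ ¬lt))
      full≡ : ∑ᶻ D (λ e → c e ℤ.* G (w * e) w) ≡ ∑ᶻ D (λ e → c″ e ℤ.* G e w) ℤ.+ ∑ᶻ D (λ e → a e ℤ.* G (w * e) w)
      full≡ = trans
        (trans (ℤ∑.sum-≗ D λ e → trans (sym (trans (cong (ℤ._* (c e ℤ.* G (w * e) w)) (ι-split e)) (ℤ.*-identityˡ _)))
                                       (eq (ι (w * e <? D)) (ι (D ≤? w * e)) (c e) (G (w * e) w)))
               (ℤ∑.sum-⊕ D _ _))
        (cong (ℤ._+ ∑ᶻ D (λ e → a e ℤ.* G (w * e) w)) (sym multiples))
        where eq : ∀ i j x y → (i ℤ.+ j) ℤ.* (x ℤ.* y) ≡ i ℤ.* (x ℤ.* y) ℤ.+ (j ℤ.* x) ℤ.* y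
              eq = ℤ-Solver.solve-∀
      step : ∑ᶻ D (λ e → c e ℤ.* G e (suc w)) ≡
             ∑ᶻ D (λ e → c′ e ℤ.* G e w) ℤ.- π w ℤ.* ∑ᶻ D (λ e → a e ℤ.* G (w * e) w)
      step = trans
        (trans (ℤ∑.sum-≗ D λ e → trans (cong (c e ℤ.*_) (buchstab e w)) (eq₁ (c e) (G e w) (π w) (G (w * e) w)))
          (trans (∑ᶻ-sub D _ _) (cong (λ x → ∑ᶻ D (λ e → c e ℤ.* G e w) ℤ.- x)
            (trans (ℤ∑.sum-⊗ˡ D (π w) _) (cong (π w ℤ.*_) full≡)))))
        (trans (eq₂ (∑ᶻ D (λ e → c e ℤ.* G e w)) (π w) (∑ᶻ D (λ e → c″ e ℤ.* G e w)) (∑ᶻ D (λ e → a e ℤ.* G (w * e) w)))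
          (cong (ℤ._- π w ℤ.* ∑ᶻ D (λ e → a e ℤ.* G (w * e) w))
            (sym (trans (ℤ∑.sum-≗ D λ e → eq₃ (c e) (π w) (c″ e) (G e w))
              (trans (∑ᶻ-sub D _ _) (cong (λ x → ∑ᶻ D (λ e → c e ℤ.* G e w) ℤ.- x) (ℤ∑.sum-⊗ˡ D (π w) _)))))))
        where
        eq₁ : ∀ c g p h → c ℤ.* (g ℤ.- p ℤ.* h) ≡ c ℤ.* g ℤ.- p ℤ.* (c ℤ.* h)
        eq₁ = ℤ-Solver.solve-∀
        eq₂ : ∀ x p y z → x ℤ.- p ℤ.* (y ℤ.+ z) ≡ x ℤ.- p ℤ.* y ℤ.- p ℤ.* z
        eq₂ = ℤ-Solver.solve-∀
        eq₃ : ∀ c p d g → (c ℤ.- p ℤ.* d) ℤ.* g ≡ c ℤ.* g ℤ.- p ℤ.* (d ℤ.* g)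
        eq₃ = ℤ-Solver.solve-∀

    ∣rough-sum∣≤ : ∀ u → 2 + u ≤ z → 1 < D → ∣ G 1 (2 + u) ∣ ≤ T₁ + ∑ (2 + u) T₂
    ∣rough-sum∣≤ u 2+u≤z 1<D = ≤-trans
      (≤-reflexive (cong ∣_∣ (sym (trans
        (ℤ∑.sum-single (λ e → ι (e ≟ 1) ℤ.* G e (2 + u)) 1 1<D λ e _ e≢1 →
          trans (cong (ℤ._* G e (2 + u)) (ι-no {d = e ≟ 1} e≢1)) (ℤ.*-zeroˡ (G e (2 + u))))
        (ℤ.*-identityˡ (G 1 (2 + u)))))))
      (iterated-buchstab u 2+u≤z (λ e → ι (e ≟ 1)) bound)
      where
      bound : ∀ e → ∣ ι (e ≟ 1) ∣ ≤ ∣ ρ (2 + u) e ∣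
      bound e with e ≟ 1
      ... | no _     = z≤n
      ... | yes refl = ≤-reflexive (sym (cong ∣_∣ (ι-yes {d = rough? (2 + u) 1} (ℙ.rough-1 (2 + u)))))

  sift-further : ∀ z u → 2 ≤ z → G 1 (z + u) ≡ G 1 z ℤ.- ∑ᶻ (z + u) (λ v → ι (z ≤? v) ℤ.* (π v ℤ.* G v v))
  sift-further z zero 2≤z rewrite +-identityʳ z = sym (trans
    (cong (λ x → G 1 z ℤ.- x) (ℤ∑.sum-zero z λ v v<z → trans (cong (ℤ._* (π v ℤ.* G v v)) (ι-no {d = z ≤? v} (<⇒≱ v<z))) (ℤ.*-zeroˡ (π v ℤ.* G v v))))
    (ℤ.+-identityʳ (G 1 z)))
  sift-further z (suc u) 2≤z rewrite +-suc z u = begin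
    G 1 (suc w)
      ≡⟨ buchstab 1 w {{n>1⇒nonTrivial (≤-trans 2≤z (m≤m+n z u))}} ⟩
    G 1 w ℤ.- π w ℤ.* G (w * 1) w
      ≡⟨ cong₂ ℤ._-_ (sift-further z u 2≤z) (trans (cong (λ x → π w ℤ.* G x w) (*-identityʳ w))
           (sym (trans (cong (ℤ._* (π w ℤ.* G w w)) (ι-yes {d = z ≤? w} (m≤m+n z u))) (ℤ.*-identityˡ (π w ℤ.* G w w))))) ⟩
    G 1 z ℤ.- S ℤ.- ι (z ≤? w) ℤ.* (π w ℤ.* G w w)
      ≡⟨ eq (G 1 z) S (ι (z ≤? w) ℤ.* (π w ℤ.* G w w)) ⟩
    G 1 z ℤ.- (S ℤ.+ ι (z ≤? w) ℤ.* (π w ℤ.* G w w)) ∎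
    where
    open ≡-Reasoning
    w = z + u
    S = ∑ᶻ w (λ v → ι (z ≤? v) ℤ.* (π v ℤ.* G v v))
    eq : ∀ x y t → x ℤ.- y ℤ.- t ≡ x ℤ.- (y ℤ.+ t)
    eq = ℤ-Solver.solve-∀

  module _ (lo hi z Z : ℕ) (φ-above : ∀ n → hi < n → φ n ≡ + 0) (φ-below : ∀ n → n ≤ lo → φ n ≡ + 0)
           (2≤z : 2 ≤ z) (z≤Z : z ≤ Z) (Z≤lo : Z ≤ lo) (hi<z³ : hi < z * (z * z)) (hi<Z² : hi < Z * Z) where

    private
      0*≡ : ∀ {x} y z → x ≡ + 0 → x ℤ.* y ≡ x ℤ.* z
      0*≡ y z refl = trans (ℤ.*-zeroˡ y) (sym (ℤ.*-zeroˡ z))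

    semiprimes : ∀ v → z ≤ v → v < Z → G v v ≡ ∑ᶻ N (λ m → φ (v * m) ℤ.* (π m ℤ.* ι (v ≤? m)))
    semiprimes v z≤v v<Z = ℤ∑.sum-≗ N pointwise
      where
      pointwise : ∀ m → φ (v * m) ℤ.* ρ v m ≡ φ (v * m) ℤ.* (π m ℤ.* ι (v ≤? m))
      pointwise 0 = 0*≡ (ρ v 0) (π 0 ℤ.* ι (v ≤? 0)) (trans (cong φ (*-zeroʳ v)) φ-0)
      pointwise 1 = 0*≡ (ρ v 1) (π 1 ℤ.* ι (v ≤? 1)) (trans (cong φ (*-identityʳ v)) (φ-below v (≤-trans (<⇒≤ v<Z) Z≤lo)))
      pointwise m@(2+ _) with hi <? v * m
      ... | yes hi<vm = 0*≡ (ρ v m) (π m ℤ.* ι (v ≤? m)) (φ-above (v * m) hi<vm)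
      ... | no hi≮vm  = cong (φ (v * m) ℤ.*_)
        (trans (ι-cong (rough? v m) (prime? m ×-dec v ≤? m)
                 (λ r → ℙ.rough∧square>⇒prime r m<v² , ℙ.rough⇒≤ r)
                 (λ (pm , v≤m) → rough-weaken v≤m (ℙ.prime⇒rough pm)))
               (ι-×-dec (prime? m) (v ≤? m)))
        where
        m<v² : m < v * v
        m<v² = *-cancelˡ-< v m (v * v) (≤-<-trans (≮⇒≥ hi≮vm) (<-≤-trans hi<z³ (*-mono-≤ z≤v (*-mono-≤ z≤v z≤v))))

    primes : G 1 Z ≡ ∑ᶻ N (λ m → φ m ℤ.* π m)
    primes = ℤ∑.sum-≗ N λ m → trans (cong (λ x → φ x ℤ.* ρ Z m) (*-identityˡ m)) (pointwise m)
      where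
      pointwise : ∀ m → φ m ℤ.* ρ Z m ≡ φ m ℤ.* π m
      pointwise m with m ≤? lo | hi <? m
      ... | yes m≤lo | _ = 0*≡ (ρ Z m) (π m) (φ-below m m≤lo)
      ... | no _ | yes hi<m = 0*≡ (ρ Z m) (π m) (φ-above m hi<m)
      ... | no m≰lo | no hi≮m = cong (φ m ℤ.*_) (ι-cong (rough? Z m) (prime? m)
        (λ r → ℙ.rough∧square>⇒prime {{n>1⇒nonTrivial (≤-<-trans (≤-trans (<⇒≤ 2≤z) (≤-trans z≤Z Z≤lo)) (≰⇒> m≰lo))}} r (≤-<-trans (≮⇒≥ hi≮m) hi<Z²))
        (λ pm → rough-weaken (≤-trans Z≤lo (<⇒≤ (≰⇒> m≰lo))) (ℙ.prime⇒rough pm)))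

    ∣prime-sum∣≤ : ∀ {T₃ T₄} → ∣ G 1 z ∣ ≤ T₃ →
      ∣ ∑ᶻ Z (λ v → ∑ᶻ N λ m → (ι (z ≤? v) ℤ.* π v) ℤ.* π m ℤ.* (ι (v ≤? m) ℤ.* φ (1 * v * m))) ∣ ≤ T₄ →
      ∣ ∑ᶻ N (λ m → φ m ℤ.* π m) ∣ ≤ T₃ + T₄
    ∣prime-sum∣≤ {T₃} {T₄} ≤T₃ ≤T₄ = begin
      ∣ ∑ᶻ N (λ m → φ m ℤ.* π m) ∣                 ≡⟨ cong ∣_∣ (trans (sym primes) (cong (G 1) (sym (m+[n∸m]≡n z≤Z)))) ⟩
      ∣ G 1 (z + (Z ∸ z)) ∣                        ≡⟨ cong ∣_∣ (sift-further z (Z ∸ z) 2≤z) ⟩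
      ∣ G 1 z ℤ.- ∑ᶻ (z + (Z ∸ z)) (λ v → ι (z ≤? v) ℤ.* (π v ℤ.* G v v)) ∣
                                                   ≤⟨ ∣i-j∣≤∣i∣+∣j∣ (G 1 z) _ ⟩
      ∣ G 1 z ∣ + ∣ ∑ᶻ (z + (Z ∸ z)) (λ v → ι (z ≤? v) ℤ.* (π v ℤ.* G v v)) ∣
                                                   ≤⟨ +-mono-≤ ≤T₃ (≤-trans (≤-reflexive (cong ∣_∣ (trans (cong (λ n → ∑ᶻ n _) (m+[n∸m]≡n z≤Z)) (ℤ∑.sum-cong Z pointwise)))) ≤T₄) ⟩
      T₃ + T₄                                      ∎
      where
      open ≤-Reasoning
      pointwise : ∀ v → v < Z → ι (z ≤? v) ℤ.* (π v ℤ.* G v v) ≡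
        ∑ᶻ N λ m → (ι (z ≤? v) ℤ.* π v) ℤ.* π m ℤ.* (ι (v ≤? m) ℤ.* φ (1 * v * m))
      pointwise v v<Z with z ≤? v
      ... | no _    = trans (ℤ.*-zeroˡ (π v ℤ.* G v v)) (sym (ℤ∑.sum-zero N λ m _ → eq (π v) (π m) (ι (v ≤? m) ℤ.* φ (1 * v * m))))
        where eq : ∀ x y t → + 0 ℤ.* x ℤ.* y ℤ.* t ≡ + 0
              eq = ℤ-Solver.solve-∀
      ... | yes z≤v = trans (cong (λ x → + 1 ℤ.* (π v ℤ.* x)) (semiprimes v z≤v v<Z))
        (trans (ℤ.*-identityˡ (π v ℤ.* _)) (trans (sym (ℤ∑.sum-⊗ˡ N (π v) _)) (ℤ∑.sum-≗ N λ m →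
          trans (cong (λ x → π v ℤ.* (φ (x * m) ℤ.* (π m ℤ.* ι (v ≤? m)))) (sym (*-identityˡ v)))
                (eq (π v) (φ (1 * v * m)) (π m) (ι (v ≤? m))))))
        where eq : ∀ p f q i → p ℤ.* (f ℤ.* (q ℤ.* i)) ≡ + 1 ℤ.* p ℤ.* q ℤ.* (i ℤ.* f)
              eq = ℤ-Solver.solve-∀

-- Primes in short intervals

Good : ℕ → Set
Good p = ∃[ j ] (8 * (j * j) + j ≤ 2 * p × 2 * p ≤ 8 * (j * j) + 3 * j)

good-phase : ∀ {p F} R .{{_ : NonZero R}} .{{_ : NonZero (16 * R)}} → F * F ≤ 8 * R * (8 * R) * p → 8 * R * (8 * R) * p < suc F * suc F →
  R ≤ F % (16 * R) → F % (16 * R) < 3 * R → Good p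
good-phase {p} {F} R lower upper R≤ρ ρ<3R = j , *-cancelˡ-≤ 32 low , ≮⇒≥ high
  where
  open ≤-Reasoning
  j = F / (16 * R)
  ρ′ = F % (16 * R)
  RR≢0 : NonZero (R * R)
  RR≢0 = m*n≢0 R R
  F≡ : F ≡ ρ′ + j * (16 * R)
  F≡ = m≡m%n+[m/n]*n F (16 * R)
  low : 32 * (8 * (j * j) + j) ≤ 32 * (2 * p)
  low = *-cancelˡ-≤ (R * R) {{RR≢0}} (begin
    R * R * (32 * (8 * (j * j) + j))              ≤⟨ m≤m+n _ (R * R) ⟩
    R * R * (32 * (8 * (j * j) + j)) + R * R      ≡⟨ eq₁ R j ⟩
    (R + j * (16 * R)) * (R + j * (16 * R))       ≤⟨ *-mono-≤ (+-monoˡ-≤ (j * (16 * R)) R≤ρ) (+-monoˡ-≤ (j * (16 * R)) R≤ρ) ⟩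
    (ρ′ + j * (16 * R)) * (ρ′ + j * (16 * R))     ≡⟨ cong (λ x → x * x) F≡ ⟨
    F * F                                         ≤⟨ lower ⟩
    8 * R * (8 * R) * p                           ≡⟨ eq₂ R p ⟩
    R * R * (32 * (2 * p))                        ∎)
    where
    eq₁ : ∀ r j → r * r * (32 * (8 * (j * j) + j)) + r * r ≡ (r + j * (16 * r)) * (r + j * (16 * r))
    eq₁ = solve-∀
    eq₂ : ∀ r p → 8 * r * (8 * r) * p ≡ r * r * (32 * (2 * p))
    eq₂ = solve-∀
  high : ¬ 8 * (j * j) + 3 * j < 2 * p
  high lt = <⇒≱ upper (begin
    suc F * suc F                                           ≤⟨ *-mono-≤ F< F< ⟩
    (3 * R + j * (16 * R)) * (3 * R + j * (16 * R))         ≤⟨ m≤m+n _ (23 * (R * R)) ⟩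
    (3 * R + j * (16 * R)) * (3 * R + j * (16 * R)) + 23 * (R * R)  ≡⟨ eq₁ R j ⟩
    32 * (R * R) * suc (8 * (j * j) + 3 * j)                ≤⟨ *-monoʳ-≤ (32 * (R * R)) lt ⟩
    32 * (R * R) * (2 * p)                                  ≡⟨ eq₂ R p ⟩
    8 * R * (8 * R) * p                                     ∎)
    where
    F< : suc F ≤ 3 * R + j * (16 * R)
    F< = subst (λ x → suc x ≤ 3 * R + j * (16 * R)) (sym F≡) (+-monoˡ-≤ (j * (16 * R)) ρ<3R)
    eq₁ : ∀ r j → (3 * r + j * (16 * r)) * (3 * r + j * (16 * r)) + 23 * (r * r) ≡ 32 * (r * r) * suc (8 * (j * j) + 3 * j)
    eq₁ = solve-∀
    eq₂ : ∀ r p → 32 * (r * r) * (2 * p) ≡ 8 * r * (8 * r) * p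
    eq₂ = solve-∀

module Powers (σ : ℕ) .{{_ : NonZero σ}} where
  opaque
    infix 9 σ^_
    σ^_ : ℕ → ℕ
    σ^ k = σ ^ k

  opaque
    unfolding σ^_

    σ^≡ : ∀ k → σ^ k ≡ σ ^ k
    σ^≡ k = refl

    σ^-* : ∀ a b → σ^ a * σ^ b ≡ σ^ (a + b)
    σ^-* a b = sym (^-distribˡ-+-* σ a b)

    σ^-mono : ∀ {a b} → a ≤ b → σ^ a ≤ σ^ b
    σ^-mono = ^-monoʳ-≤ σ

    σ^-suc : ∀ a → σ * σ^ a ≡ σ^ (suc a)
    σ^-suc a = refl

    instance
      σ^≢0 : ∀ {a} → NonZero (σ^ a)
      σ^≢0 {a} = m^n≢0 σ a

opaque
  sieve-constant : ℕ
  sieve-constant = 4000000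

opaque
  unfolding sieve-constant

  sieve-constant≥ : 36960 + (2880 * 40 * 32 + 2880 * 40) ≤ sieve-constant
  sieve-constant≥ = ≤ᵇ⇒≤ (36960 + (2880 * 40 * 32 + 2880 * 40)) 4000000 _

sieve-total : ∀ a b u v r l {x d y C} → l ≤ l * l → d * y ≡ x → a + (b * u * v + b * u) ≤ C →
  a * (r * (l * x)) + b * (r * (d * (l * u * (l * v * y)))) + b * (r * (d * (l * u * y))) ≤ r * (C * (l * l * x))
sieve-total a b u v r l {x} {d} {y} {C} l≤l² dy≡x const≤ = begin
  a * (r * (l * x)) + b * (r * (d * (l * u * (l * v * y)))) + b * (r * (d * (l * u * y)))
    ≡⟨ eq₁ a b u v r l x d y ⟩
  r * (a * l * x + (b * u * v * (l * l) + b * u * l) * (d * y))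
    ≡⟨ cong (λ t → r * (a * l * x + (b * u * v * (l * l) + b * u * l) * t)) dy≡x ⟩
  r * (a * l * x + (b * u * v * (l * l) + b * u * l) * x)
    ≤⟨ *-monoʳ-≤ r (+-mono-≤ (*-monoˡ-≤ x (*-monoʳ-≤ a l≤l²)) (*-monoˡ-≤ x (+-monoʳ-≤ (b * u * v * (l * l)) (*-monoʳ-≤ (b * u) l≤l²)))) ⟩
  r * (a * (l * l) * x + (b * u * v * (l * l) + b * u * (l * l)) * x)
    ≡⟨ cong (r *_) (eq₂ a (b * u * v) (b * u) (l * l) x) ⟩
  r * ((a + (b * u * v + b * u)) * (l * l * x))
    ≤⟨ *-monoʳ-≤ r (*-monoˡ-≤ (l * l * x) const≤) ⟩
  r * (C * (l * l * x)) ∎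
  where
  open ≤-Reasoning
  eq₁ : ∀ a b u v r l x d y → a * (r * (l * x)) + b * (r * (d * (l * u * (l * v * y)))) + b * (r * (d * (l * u * y))) ≡
    r * (a * l * x + (b * u * v * (l * l) + b * u * l) * (d * y))
  eq₁ = solve-∀
  eq₂ : ∀ a b c l x → a * l * x + (b * l + c * l) * x ≡ (a + (b + c)) * (l * x)
  eq₂ = solve-∀

module ShortInterval (ℓ lo : ℕ) (5≤ℓ : 5 ≤ ℓ) where

  σ : ℕ
  σ = 2 ^ ℓ

  instance
    σ≢0 : NonZero σ
    σ≢0 = m^n≢0 2 ℓ

  32≤σ : 32 ≤ σ
  32≤σ = ^-monoʳ-≤ 2 5≤ℓ

  open Powers σ public

  σ^≤2^ : ∀ k → σ^ k ≡ 2 ^ (ℓ * k)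
  σ^≤2^ k = trans (σ^≡ k) (^-*-assoc 2 ℓ k)

  c*σ^≤ : ∀ c k → c ≤ 32 → c * σ^ k ≤ σ^ (suc k)
  c*σ^≤ c k c≤32 = ≤-trans (*-monoˡ-≤ (σ^ k) (≤-trans c≤32 32≤σ)) (≤-reflexive (σ^-suc k))

  literal≤ : ∀ {a b} → {_ : Bool.T (a ≤ᵇ b)} → a ≤ b
  literal≤ {a} {b} {t} = ≤ᵇ⇒≤ a b t

  module _ (σ^94≤lo : σ^ 94 ≤ lo) (hi<σ^96 : lo + σ^ 92 < σ^ 96) where

    s R Y g g₀ Δ₀ : ℕ
    s = σ^ 2
    R = σ^ 51
    Y = σ^ 92
    g = σ^ 48
    g₀ = σ^ 47
    Δ₀ = σ^ 6

    private
      2≤s : 2 ≤ s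
      2≤s = ≤-trans (≤-trans (*-monoʳ-≤ 2 {1} {σ^ 1} (>-nonZero⁻¹ (σ^ 1))) (c*σ^≤ 2 1 literal≤)) ≤-refl

      σ^3≡ : ∀ a b c → σ^ a * (σ^ b * σ^ c) ≡ σ^ (a + (b + c))
      σ^3≡ a b c = trans (cong (σ^ a *_) (σ^-* b c)) (σ^-* a (b + c))

    open Weight R s lo Y g g₀ 2≤s
      (≤-trans (<⇒≤ hi<σ^96) (≤-reflexive (sym (σ^-* 48 48))))
      (≤-trans (≤-reflexive (σ^-* 47 47)) σ^94≤lo)
      (≤-trans (≤-reflexive (σ^-* 2 92)) (≤-trans σ^94≤lo (m≤m+n lo (lo + 0))))
      (≤-trans (≤-reflexive (cong (2 *_) (σ^-* 2 48))) (c*σ^≤ 2 50 literal≤))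
      (≤-trans (s≤s (m≤m+n s (s + 0))) (≤-trans (+-monoˡ-≤ (2 * s) {1} {s} (>-nonZero⁻¹ s)) (≤-trans (c*σ^≤ 3 2 literal≤) (σ^-mono literal≤))))
      (≤-trans (≤-reflexive (σ^-* 2 48)) (σ^-mono literal≤))
      public

    φ-0 : φ 0 ≡ + 0
    φ-0 = φ-below 0 z≤n

    open Sieve φ N φ-N φ-0

    D z : ℕ
    D = σ^ 44
    z = σ^ 32

    T₁ : ℕ
    T₁ = 36960 * (R * (ℓ * σ^ 90))

    T₂ : ℕ → ℕ
    T₂ zero      = 0
    T₂ v@(suc _) = 2880 * (R * (Δ₀ * σ * (ℓ * 40 * (Y / (v * (s * Δ₀))))))
      where instance _ = m*n≢0 v (s * Δ₀) {{_}} {{m*n≢0 s Δ₀}}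

    typeI : ∑ D (λ e → ∣ ∑ᶻ N (λ m → φ (e * m)) ∣) ≤ T₁
    typeI = *-cancelˡ-≤ s (begin
      s * ∑ D (λ e → ∣ ∑ᶻ N (λ m → φ (e * m)) ∣)      ≡⟨ ℕ∑.sum-⊗ˡ D s _ ⟨
      ∑ D (λ e → s * ∣ ∑ᶻ N (λ m → φ (e * m)) ∣)      ≤⟨ ∑-mono D each ⟩
      ∑ D (λ e → 840 * (R * Y÷ e))                    ≡⟨ trans (ℕ∑.sum-≗ D λ e → sym (*-assoc 840 R (Y÷ e))) (ℕ∑.sum-⊗ˡ D (840 * R) Y÷) ⟩
      840 * R * ∑ D Y÷                                ≡⟨ cong (λ n → 840 * R * ∑ n Y÷) (σ^≤2^ 44) ⟩
      840 * R * ∑ (2 ^ (ℓ * 44)) Y÷                   ≤⟨ *-monoʳ-≤ (840 * R) (∑-harmonic (ℓ * 44) Y÷ Y refl e*Y÷e≤Y) ⟩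
      840 * R * (ℓ * 44 * Y)                          ≡⟨ cong (λ y → 840 * R * (ℓ * 44 * y)) (σ^-* 2 90) ⟨
      840 * R * (ℓ * 44 * (s * σ^ 90))                ≡⟨ eq 840 44 R ℓ s (σ^ 90) ⟩
      s * T₁                                          ∎)
      where
      open ≤-Reasoning
      eq : ∀ a b r l s x → a * r * (l * b * (s * x)) ≡ s * (a * b * (r * (l * x)))
      eq = solve-∀
      Y÷ : ℕ → ℕ
      Y÷ zero      = 0
      Y÷ e@(suc _) = Y / e
      e*Y÷e≤Y : ∀ e → e * Y÷ e ≤ Y
      e*Y÷e≤Y zero    = z≤n
      e*Y÷e≤Y (suc e) = ≤-trans (≤-reflexive (*-comm (suc e) (Y / suc e))) (m/n*n≤m Y (suc e))
      each : ∀ e → e < D → s * ∣ ∑ᶻ N (λ m → φ (e * m)) ∣ ≤ 840 * (R * Y÷ e)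
      each zero      _   = ≤-trans (≤-reflexive (trans (cong (λ x → s * ∣ x ∣) (ℤ∑.sum-zero N λ _ _ → φ-0)) (*-zeroʳ s))) z≤n
      each e@(suc _) e<D = ∣∑φ-multiples∣≤ e
        (≤-trans (*-monoʳ-≤ 32 (≤-trans (*-monoʳ-≤ s (<⇒≤ e<D)) (≤-reflexive (σ^-* 2 44)))) (c*σ^≤ 32 46 ≤-refl))
        (≤-trans (*-monoʳ-≤ s (<⇒≤ e<D)) (≤-trans (≤-reflexive (σ^-* 2 44)) (σ^-mono literal≤)))

    σ²≡s : σ * σ ≡ s
    σ²≡s = trans (cong (σ *_) (sym (trans (σ^≡ 1) (^-identityʳ σ)))) (σ^-suc 1)

    hi≤Yσ^4 : lo + Y ≤ Y * σ^ 4
    hi≤Yσ^4 = ≤-trans (<⇒≤ hi<σ^96) (≤-reflexive (sym (σ^-* 92 4)))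

    σ^k*B : ∀ k → σ^ k * (s * Δ₀) ≡ σ^ (k + 8)
    σ^k*B k = σ^3≡ k 2 6

    module Sums (q k : ℕ) .{{_ : NonZero q}} (q≤z : q ≤ z) (k≤40 : k ≤ 40) (sqE≤Y : s * (q * σ^ (k + 8)) ≤ Y) =
      BilinearSum q Δ₀ σ (σ^ k) (σ^ 4) (ℓ * 40) σ²≡s hi≤Yσ^4
        (≤-trans (σ^-mono k≤40) (≤-reflexive (σ^≤2^ 40)))
        (≤-trans (*-monoʳ-≤ 16 (≤-trans (*-monoʳ-≤ s (*-mono-≤ q≤z (≤-reflexive (σ^-* 6 2)))) (≤-reflexive (σ^3≡ 2 32 8))))
                 (≤-trans (c*σ^≤ 16 42 literal≤) (σ^-mono literal≤)))
        (≤-trans (≤-reflexive (cong (λ x → s * (q * x)) (σ^k*B k))) sqE≤Y)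
        (≤-trans (≤-reflexive (trans (cong₂ _*_ (σ^-* 2 48) (σ^k*B k)) (σ^-* 50 (k + 8))))
                 (≤-trans (σ^-mono (+-monoʳ-≤ 50 (+-monoˡ-≤ 8 k≤40))) (≤-reflexive (sym (σ^-* 92 6)))))

    typeII : ∀ v → v < z → Prime v → ∀ (a : ℕ → ℤ) → (∀ e → ∣ a e ∣ ≤ 1) → (∀ e → v * e < D → a e ≡ + 0) →
      ∣ ∑ᶻ D (λ e → a e ℤ.* G (v * e) v) ∣ ≤ T₂ v
    typeII v@(suc _) v<z _ a ∣a∣≤1 a-small = begin
      ∣ ∑ᶻ D (λ e → a e ℤ.* G (v * e) v) ∣
        ≡⟨ cong ∣_∣ (trans (ℤ∑.sum-≗ D pointwise) (cong (λ n → ∑ᶻ n (λ m → ∑ᶻ N λ n → summand m n)) (sym (σ^k*B 36)))) ⟩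
      ∣ ∑ᶻ (σ^ 36 * (s * Δ₀)) (λ m → ∑ᶻ N λ n → summand m n) ∣
        ≤⟨ ∣bilinear-sum∣≤ ⟩
      2880 * (R * (Δ₀ * σ * (ℓ * 40 * A))) ∎
      where
      open ≤-Reasoning
      open Sums v 36 (<⇒≤ v<z) literal≤ (≤-trans (*-monoʳ-≤ s (*-monoˡ-≤ (σ^ 44) (<⇒≤ v<z))) (≤-trans (≤-reflexive (σ^3≡ 2 32 44)) (σ^-mono literal≤)))
        a (ρ v) (λ _ → 0) ∣a∣≤1 (∣ρ∣≤1 v)
        (λ m m< → a-small m (<-≤-trans (*-mono-< v<z m<) (≤-reflexive (trans (cong (z *_) (σ^k*B 4)) (σ^-* 32 12)))))
      pointwise : ∀ e → a e ℤ.* G (v * e) v ≡ ∑ᶻ N (λ n → summand e n)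
      pointwise e = trans (sym (ℤ∑.sum-⊗ˡ N (a e) _)) (ℤ∑.sum-≗ N λ n →
        trans (eq (a e) (φ (v * e * n)) (ρ v n)) (cong (λ x → a e ℤ.* ρ v n ℤ.* (x ℤ.* φ (v * e * n))) (sym (ι-yes {d = 0 ≤? n} z≤n))))
        where eq : ∀ a f r → a ℤ.* (f ℤ.* r) ≡ a ℤ.* r ℤ.* (+ 1 ℤ.* f)
              eq = ℤ-Solver.solve-∀

    semiprime-sum : ∣ ∑ᶻ g (λ v → ∑ᶻ N λ m → (ι (z ≤? v) ℤ.* π v) ℤ.* π m ℤ.* (ι (v ≤? m) ℤ.* φ (1 * v * m))) ∣ ≤
      2880 * (R * (Δ₀ * σ * (ℓ * 40 * σ^ 84)))
    semiprime-sum = begin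
      ∣ ∑ᶻ g (λ m → ∑ᶻ N λ n → summand m n) ∣
        ≡⟨ cong (λ n → ∣ ∑ᶻ n (λ m → ∑ᶻ N λ n → summand m n) ∣) (σ^k*B 40) ⟨
      ∣ ∑ᶻ (σ^ 40 * (s * Δ₀)) (λ m → ∑ᶻ N λ n → summand m n) ∣
        ≤⟨ ∣bilinear-sum∣≤ ⟩
      2880 * (R * (Δ₀ * σ * (ℓ * 40 * A)))
        ≤⟨ *-monoʳ-≤ 2880 (*-monoʳ-≤ R (*-monoʳ-≤ (Δ₀ * σ) (*-monoʳ-≤ (ℓ * 40) A≤))) ⟩
      2880 * (R * (Δ₀ * σ * (ℓ * 40 * σ^ 84))) ∎
      where
      open ≤-Reasoning
      open Sums 1 40 (>-nonZero⁻¹ z) ≤-refl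
        (≤-trans (≤-reflexive (trans (cong (s *_) (*-identityˡ (σ^ 48))) (σ^-* 2 48))) (σ^-mono literal≤))
        (λ v → ι (z ≤? v) ℤ.* π v) π (λ v → v) (λ v → ∣x*y∣≤ (ι (z ≤? v)) (π v) (∣ι∣≤1 (z ≤? v)) (∣ι∣≤1 (prime? v))) (λ v → ∣ι∣≤1 (prime? v))
        (λ v v< → trans (cong (ℤ._* π v) (ι-no {d = z ≤? v} (<⇒≱ (<-≤-trans v< (≤-trans (≤-reflexive (σ^k*B 4)) (σ^-mono literal≤)))))) (ℤ.*-zeroˡ (π v)))
      A≤ : A ≤ σ^ 84
      A≤ = *-cancelʳ-≤ A (σ^ 84) (1 * (s * Δ₀)) (≤-trans (m/n*n≤m Y (1 * (s * Δ₀)))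
        (≤-reflexive (sym (trans (cong (σ^ 84 *_) (*-identityˡ (s * Δ₀))) (σ^k*B 84)))))

    ∑T₂≤ : ∑ z T₂ ≤ 2880 * (R * (Δ₀ * σ * (ℓ * 40 * (ℓ * 32 * σ^ 84))))
    ∑T₂≤ = begin
      ∑ z T₂                                      ≡⟨ trans (ℕ∑.sum-≗ z T₂≡) (ℕ∑.sum-⊗ˡ z K Y÷) ⟩
      K * ∑ z Y÷                                  ≡⟨ cong (λ n → K * ∑ n Y÷) (σ^≤2^ 32) ⟩
      K * ∑ (2 ^ (ℓ * 32)) Y÷                     ≤⟨ *-monoʳ-≤ K (∑-harmonic (ℓ * 32) Y÷ (σ^ 84) refl v*Y÷v≤) ⟩
      K * (ℓ * 32 * σ^ 84)                        ≡⟨ eq 2880 R (Δ₀ * σ) (ℓ * 40) (ℓ * 32 * σ^ 84) ⟩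
      2880 * (R * (Δ₀ * σ * (ℓ * 40 * (ℓ * 32 * σ^ 84)))) ∎
      where
      open ≤-Reasoning
      K = 2880 * (R * (Δ₀ * σ * (ℓ * 40)))
      eq : ∀ c r d l x → c * (r * (d * l)) * x ≡ c * (r * (d * (l * x)))
      eq = solve-∀
      instance
        B≢0 : NonZero (s * Δ₀)
        B≢0 = m*n≢0 s Δ₀
      Y÷ : ℕ → ℕ
      Y÷ zero      = 0
      Y÷ v@(suc _) = Y / (v * (s * Δ₀))
        where instance _ = m*n≢0 v (s * Δ₀)
      T₂≡ : ∀ v → T₂ v ≡ K * Y÷ v
      T₂≡ zero    = sym (*-zeroʳ K)
      T₂≡ (suc v) = sym (eq 2880 R (Δ₀ * σ) (ℓ * 40) (Y÷ (suc v)))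
      v*Y÷v≤ : ∀ v → v * Y÷ v ≤ σ^ 84
      v*Y÷v≤ zero      = z≤n
      v*Y÷v≤ v@(suc _) = *-cancelʳ-≤ (v * Y÷ v) (σ^ 84) (s * Δ₀) (≤-trans (≤-reflexive (eq′ v (Y÷ v) (s * Δ₀)))
        (≤-trans (m/n*n≤m Y (v * (s * Δ₀)) {{m*n≢0 v (s * Δ₀)}}) (≤-reflexive (sym (σ^k*B 84)))))
        where eq′ : ∀ v y b → v * y * b ≡ y * (v * b)
              eq′ = solve-∀

    primes≡1 : ℕ
    primes≡1 = ∑ N λ m → ∣ ι (In? m) ℤ.* π m ∣

    2≤z : 2 ≤ z
    2≤z = ≤-trans 2≤s (σ^-mono literal≤)

    rough-sum : ∣ G 1 z ∣ ≤ T₁ + ∑ z T₂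
    rough-sum = go (m≤n⇒∃[o]m+o≡n 2≤z)
      where
      go : ∃[ u ] 2 + u ≡ z → ∣ G 1 z ∣ ≤ T₁ + ∑ z T₂
      go (u , 2+u≡z) = subst (λ x → ∣ G 1 x ∣ ≤ T₁ + ∑ x T₂) 2+u≡z
        (∣rough-sum∣≤ D z T₁ T₂ typeI typeII u (≤-reflexive 2+u≡z) (≤-trans 2≤z (σ^-mono literal≤)))

    private
     NoGood : Set
     NoGood = ∀ p → Prime p → lo < p → p ≤ hi → p % 4 ≡ 1 → ¬ Good p

    phase-sum-term : NoGood → ∀ m → φ m ℤ.* π m ≡ ℤ.- + R ℤ.* + ∣ ι (In? m) ℤ.* π m ∣
    phase-sum-term none m with In? m | prime? m
    ... | no _ | no _  = trans (cong (ℤ._* + 0) (ℤ.*-zeroˡ (h (F m)))) (sym (ℤ.*-zeroʳ (ℤ.- + R)))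
    ... | no _ | yes _ = trans (cong (ℤ._* + 1) (ℤ.*-zeroˡ (h (F m)))) (sym (ℤ.*-zeroʳ (ℤ.- + R)))
    ... | yes _ | no _ = trans (ℤ.*-zeroʳ (+ 1 ℤ.* h (F m))) (sym (ℤ.*-zeroʳ (ℤ.- + R)))
    ... | yes ((lo<m , m≤hi) , m%4≡1) | yes pm = cong (ℤ._* + 1) (trans (ℤ.*-identityˡ (h (F m)))
      (h-out (F m) λ (R≤ , <3R) → none m pm lo<m m≤hi m%4≡1 (good-phase R (F-lower m) (F-upper m) R≤ <3R)))

    phase-sum : NoGood → ∑ᶻ N (λ m → φ m ℤ.* π m) ≡ ℤ.- (+ R ℤ.* + primes≡1)
    phase-sum none = trans (ℤ∑.sum-≗ N (phase-sum-term none)) (trans (ℤ∑.sum-⊗ˡ N (ℤ.- + R) _)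
      (trans (cong (ℤ.- + R ℤ.*_) (∑ᶻ-+ N _)) (sym (ℤ.neg-distribˡ-* (+ R) (+ primes≡1)))))

    -- If no prime is Good then h (F p) = −R for each of them, which the sieve contradicts unless they are few.
    primes≡1≤ : (∀ p → Prime p → lo < p → p ≤ hi → p % 4 ≡ 1 → ¬ Good p) → primes≡1 ≤ sieve-constant * (ℓ * ℓ * σ^ 91)
    primes≡1≤ none = *-cancelˡ-≤ R (≤-trans (≤-reflexive (sym R*primes≡1)) (≤-trans upper total))
      where
      C₁ C₂ C₃ : ℕ
      C₁ = ℓ * σ^ 91
      C₂ = Δ₀ * σ * (ℓ * 40 * (ℓ * 32 * σ^ 84))
      C₃ = Δ₀ * σ * (ℓ * 40 * σ^ 84)
      R*primes≡1 : ∣ ∑ᶻ N (λ m → φ m ℤ.* π m) ∣ ≡ R * primes≡1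
      R*primes≡1 = trans (cong ∣_∣ (phase-sum none)) (trans (ℤ.∣-i∣≡∣i∣ (+ R ℤ.* + primes≡1)) (∣+m*i∣ R (+ primes≡1)))
      T₁≤ : T₁ ≤ 36960 * (R * C₁)
      T₁≤ = *-monoʳ-≤ 36960 {R * (ℓ * σ^ 90)} {R * C₁} (*-monoʳ-≤ R (*-monoʳ-≤ ℓ (σ^-mono literal≤)))
      upper : ∣ ∑ᶻ N (λ m → φ m ℤ.* π m) ∣ ≤ T₁ + ∑ z T₂ + 2880 * (R * C₃)
      upper = ∣prime-sum∣≤ lo hi z g φ-above φ-below 2≤z (σ^-mono literal≤) (≤-trans (σ^-mono literal≤) σ^94≤lo)
        (<-≤-trans hi<σ^96 (≤-reflexive (sym (σ^3≡ 32 32 32)))) (<-≤-trans hi<σ^96 (≤-reflexive (sym (σ^-* 48 48))))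
        {T₁ + ∑ z T₂} {2880 * (R * C₃)} rough-sum semiprime-sum
      ℓ≤ℓ² : ℓ ≤ ℓ * ℓ
      ℓ≤ℓ² = m≤m*n ℓ ℓ {{>-nonZero (≤-trans (s≤s z≤n) 5≤ℓ)}}
      total : T₁ + ∑ z T₂ + 2880 * (R * C₃) ≤ R * (sieve-constant * (ℓ * ℓ * σ^ 91))
      total = ≤-trans
        (+-mono-≤ {T₁ + ∑ z T₂} {36960 * (R * C₁) + 2880 * (R * C₂)} {2880 * (R * C₃)} {2880 * (R * C₃)}
          (+-mono-≤ {T₁} {36960 * (R * C₁)} {∑ z T₂} {2880 * (R * C₂)} T₁≤ ∑T₂≤) ≤-refl)
        (sieve-total 36960 2880 40 32 R ℓ {σ^ 91} {Δ₀ * σ} {σ^ 84} {sieve-constant} ℓ≤ℓ²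
          (trans (cong (_* σ^ 84) (trans (*-comm Δ₀ σ) (σ^-suc 6))) (σ^-* 7 84)) sieve-constant≥)

-- The divisor sum of χ₄

χ₄ : ℕ → ℤ
χ₄ 1 = + 1
χ₄ 3 = -[1+ 0 ]
χ₄ _ = + 0

χ : ℕ → ℤ
χ n = χ₄ (n % 4)

χ-* : ∀ m n → χ (m * n) ≡ χ m ℤ.* χ n
χ-* m n = trans (cong χ₄ (%-distribˡ-* m n 4)) (table (m % 4) (n % 4) (m%n<n m 4) (m%n<n n 4))
  where
  table : ∀ a b → a < 4 → b < 4 → χ₄ ((a * b) % 4) ≡ χ₄ a ℤ.* χ₄ b
  table 0 b _ _ = sym (ℤ.*-zeroˡ (χ₄ b))
  table 1 0 _ _ = refl
  table 1 1 _ _ = refl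
  table 1 2 _ _ = refl
  table 1 3 _ _ = refl
  table 2 0 _ _ = refl
  table 2 1 _ _ = refl
  table 2 2 _ _ = refl
  table 2 3 _ _ = refl
  table 3 0 _ _ = refl
  table 3 1 _ _ = refl
  table 3 2 _ _ = refl
  table 3 3 _ _ = refl
  table (suc (suc (suc (suc _)))) _ (s≤s (s≤s (s≤s (s≤s ())))) _
  table _ (suc (suc (suc (suc _)))) _ (s≤s (s≤s (s≤s (s≤s ()))))

divisor-sum : ℕ → ℕ → ℤ
divisor-sum M n = ∑ᶻ M λ d → χ d ℤ.* ι (d ∣? n)

opaque
  r : ℕ → ℤ
  r n = divisor-sum (suc n) n

  r-def : ∀ n → r n ≡ divisor-sum (suc n) n
  r-def n = refl

χ-summand-above : ∀ {d n} → .{{_ : NonZero n}} → n < d → χ d ℤ.* ι (d ∣? n) ≡ + 0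
χ-summand-above {d} {n} n<d = trans (cong (χ d ℤ.*_) (ι-no {d = d ∣? n} λ d∣n → <⇒≱ n<d (∣⇒≤ d∣n))) (ℤ.*-zeroʳ (χ d))

r≡divisor-sum : ∀ {M n} .{{_ : NonZero n}} → n < M → r n ≡ divisor-sum M n
r≡divisor-sum {M} {n} n<M = trans (r-def n) (sym (ℤ∑.sum-extend _ n<M λ d n<d → χ-summand-above n<d))

module Hecke (p : ℕ) (pp : Prime p) where

  private instance
    p≢0 : NonZero p
    p≢0 = ℙ.prime⇒nonZero pp

  ∣-cancel : ∀ {d m} → ¬ p ∣ d → d ∣ p * m → d ∣ m
  ∣-cancel {d} {m} p∤d = coprime-divisor (Coprime.sym coprime)
    where
    coprime : Coprime.Coprime p d
    coprime {k} (k∣p , k∣d) with ℙ.prime⇒irreducible pp k∣p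
    ... | inj₁ k≡1  = k≡1
    ... | inj₂ refl = contradiction k∣d p∤d

  multiples-part : ∀ {M} n .{{_ : NonZero n}} → n < M →
    ∑ᶻ M (λ d → ι (p ∣? d) ℤ.* (χ d ℤ.* ι (d ∣? n))) ≡ χ p ℤ.* ∑ᶻ M (λ d → χ d ℤ.* ι (p * d ∣? n))
  multiples-part {M} n n<M = trans
    (ℤ∑.sum-multiples M p f
      (λ d p∤d → trans (cong (ℤ._* (χ d ℤ.* ι (d ∣? n))) (ι-no {d = p ∣? d} p∤d)) (ℤ.*-zeroˡ (χ d ℤ.* ι (d ∣? n))))
      (λ d M≤d → trans (cong (ι (p ∣? d) ℤ.*_) (χ-summand-above (<-≤-trans n<M M≤d))) (ℤ.*-zeroʳ (ι (p ∣? d)))))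
    (trans (ℤ∑.sum-≗ M λ d → trans (cong₂ ℤ._*_ (ι-yes {d = p ∣? p * d} (m∣m*n d)) (cong (ℤ._* ι (p * d ∣? n)) (χ-* p d)))
                                   (eq (χ p) (χ d) (ι (p * d ∣? n))))
           (ℤ∑.sum-⊗ˡ M (χ p) _))
    where
    f : ℕ → ℤ
    f d = ι (p ∣? d) ℤ.* (χ d ℤ.* ι (d ∣? n))
    eq : ∀ x y i → + 1 ℤ.* (x ℤ.* y ℤ.* i) ≡ x ℤ.* (y ℤ.* i)
    eq = ℤ-Solver.solve-∀

  -- The relation r (p m) + χ p · r (m / p) = (1 + χ p) r m, where r (m / p) is written as a sum over d with p d ∣ m.
  hecke : ∀ m .{{_ : NonZero m}} →
    r (p * m) ≡ (+ 1 ℤ.+ χ p) ℤ.* r m ℤ.- χ p ℤ.* ∑ᶻ (suc (p * m)) (λ d → χ d ℤ.* ι (p * d ∣? m))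
  hecke m = begin
    r (p * m)
      ≡⟨ trans (r-def (p * m)) (split (p * m)) ⟩
    ∑ᶻ M (λ d → ι (p ∣? d) ℤ.* (χ d ℤ.* ι (d ∣? p * m))) ℤ.+ ∑ᶻ M (λ d → ι (¬? (p ∣? d)) ℤ.* (χ d ℤ.* ι (d ∣? p * m)))
      ≡⟨ cong₂ ℤ._+_ (trans (multiples-part (p * m) ≤-refl) (cong (χ p ℤ.*_) (trans (ℤ∑.sum-≗ M λ d → cong (χ d ℤ.*_)
            (ι-cong (p * d ∣? p * m) (d ∣? m) (*-cancelˡ-∣ p) (*-monoʳ-∣ p))) (sym (r≡divisor-sum m<M)))))
          (ℤ∑.sum-≗ M coprime-part) ⟩
    χ p ℤ.* r m ℤ.+ W
      ≡⟨ eq (χ p) (r m) V W ⟩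
    χ p ℤ.* r m ℤ.+ (χ p ℤ.* V ℤ.+ W) ℤ.- χ p ℤ.* V
      ≡⟨ cong (λ x → χ p ℤ.* r m ℤ.+ x ℤ.- χ p ℤ.* V) (trans (cong (ℤ._+ W) (sym (multiples-part m m<M))) (sym (trans (r≡divisor-sum m<M) (split m)))) ⟩
    χ p ℤ.* r m ℤ.+ r m ℤ.- χ p ℤ.* V
      ≡⟨ eq′ (χ p) (r m) V ⟩
    (+ 1 ℤ.+ χ p) ℤ.* r m ℤ.- χ p ℤ.* V ∎
    where
    open ≡-Reasoning
    instance _ = m*n≢0 p m
    M = suc (p * m)
    m<M : m < M
    m<M = s≤s (m≤n*m m p)
    V W : ℤ
    V = ∑ᶻ M (λ d → χ d ℤ.* ι (p * d ∣? m))
    W = ∑ᶻ M (λ d → ι (¬? (p ∣? d)) ℤ.* (χ d ℤ.* ι (d ∣? m)))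
    eq : ∀ x r v w → x ℤ.* r ℤ.+ w ≡ x ℤ.* r ℤ.+ (x ℤ.* v ℤ.+ w) ℤ.- x ℤ.* v
    eq = ℤ-Solver.solve-∀
    eq′ : ∀ x r v → x ℤ.* r ℤ.+ r ℤ.- x ℤ.* v ≡ (+ 1 ℤ.+ x) ℤ.* r ℤ.- x ℤ.* v
    eq′ = ℤ-Solver.solve-∀
    ι-¬ : ∀ d → ι (p ∣? d) ℤ.+ ι (¬? (p ∣? d)) ≡ + 1
    ι-¬ d with p ∣? d
    ... | yes _ = refl
    ... | no _  = refl
    split : ∀ n → divisor-sum M n ≡
      ∑ᶻ M (λ d → ι (p ∣? d) ℤ.* (χ d ℤ.* ι (d ∣? n))) ℤ.+ ∑ᶻ M (λ d → ι (¬? (p ∣? d)) ℤ.* (χ d ℤ.* ι (d ∣? n)))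
    split n = trans (ℤ∑.sum-≗ M λ d → trans (sym (trans (cong (ℤ._* (χ d ℤ.* ι (d ∣? n))) (ι-¬ d)) (ℤ.*-identityˡ _)))
                                            (ℤ.*-distribʳ-+ (χ d ℤ.* ι (d ∣? n)) (ι (p ∣? d)) (ι (¬? (p ∣? d)))))
                    (ℤ∑.sum-⊕ M _ _)
    coprime-part : ∀ d → ι (¬? (p ∣? d)) ℤ.* (χ d ℤ.* ι (d ∣? p * m)) ≡ ι (¬? (p ∣? d)) ℤ.* (χ d ℤ.* ι (d ∣? m))
    coprime-part d with p ∣? d
    ... | yes _  = trans (ℤ.*-zeroˡ (χ d ℤ.* ι (d ∣? p * m))) (sym (ℤ.*-zeroˡ (χ d ℤ.* ι (d ∣? m))))
    ... | no p∤d = cong (λ x → + 1 ℤ.* (χ d ℤ.* x)) (ι-cong (d ∣? p * m) (d ∣? m) (∣-cancel p∤d) (λ d∣m → ∣-trans d∣m (n∣m*n p)))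

  hecke-∤ : ∀ {m} .{{_ : NonZero m}} → ¬ p ∣ m → r (p * m) ≡ (+ 1 ℤ.+ χ p) ℤ.* r m
  hecke-∤ {m} p∤m = trans (hecke m) (trans (cong (λ x → (+ 1 ℤ.+ χ p) ℤ.* r m ℤ.- χ p ℤ.* x)
      (ℤ∑.sum-zero (suc (p * m)) λ d _ → trans (cong (χ d ℤ.*_) (ι-no {d = p * d ∣? m} λ pd∣m → p∤m (∣-trans (m∣m*n d) pd∣m))) (ℤ.*-zeroʳ (χ d))))
    (eq ((+ 1 ℤ.+ χ p) ℤ.* r m) (χ p)))
    where eq : ∀ a x → a ℤ.- x ℤ.* + 0 ≡ a
          eq = ℤ-Solver.solve-∀

  hecke-∣ : ∀ k .{{_ : NonZero k}} → r (p * (p * k)) ≡ (+ 1 ℤ.+ χ p) ℤ.* r (p * k) ℤ.- χ p ℤ.* r k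
  hecke-∣ k = trans (hecke (p * k)) (cong (λ x → (+ 1 ℤ.+ χ p) ℤ.* r (p * k) ℤ.- χ p ℤ.* x)
    (trans (ℤ∑.sum-≗ (suc (p * (p * k))) λ d → cong (χ d ℤ.*_) (ι-cong (p * d ∣? p * k) (d ∣? k) (*-cancelˡ-∣ p) (*-monoʳ-∣ p)))
           (sym (r≡divisor-sum (s≤s (≤-trans (m≤n*m k p) (m≤n*m (p * k) p)))))))
    where instance _ = m*n≢0 p k

χ-cases : ∀ n → χ n ≡ + 0 ⊎ χ n ≡ + 1 ⊎ χ n ≡ -[1+ 0 ]
χ-cases n = table (n % 4) (m%n<n n 4)
  where
  table : ∀ a → a < 4 → χ₄ a ≡ + 0 ⊎ χ₄ a ≡ + 1 ⊎ χ₄ a ≡ -[1+ 0 ]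
  table 0 _ = inj₁ refl
  table 1 _ = inj₂ (inj₁ refl)
  table 2 _ = inj₁ refl
  table 3 _ = inj₂ (inj₂ refl)
  table (suc (suc (suc (suc _)))) (s≤s (s≤s (s≤s (s≤s ()))))

prime-factor : ∀ n → 2 ≤ n → ∃[ p ] ∃[ m ] (Prime p × n ≡ p * m × NonZero m × m < n)
prime-factor n 2≤n with factorise n {{>-nonZero (≤-trans z<s 2≤n)}}
... | record { factors = []     ; isFactorisation = n≡1 } = contradiction 2≤n (<⇒≱ (≤-reflexive (cong suc n≡1)))
... | record { factors = p ∷ ps ; isFactorisation = n≡ ; factorsPrime = pp ∷ _ } =
  p , product ps , pp , n≡ , m≢0 , subst (product ps <_) (sym n≡) (m<n*m (product ps) p {{m≢0}} (nonTrivial⇒n>1 p {{ℙ.prime⇒nonTrivial pp}}))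
  where
  m≢0 : NonZero (product ps)
  m≢0 = m*n≢0⇒n≢0 p {{subst NonZero n≡ (>-nonZero (≤-trans z<s 2≤n))}}
  m<n*m : ∀ m n .{{_ : NonZero m}} → 1 < n → m < n * m
  m<n*m m n 1<n = subst (_< n * m) (*-identityˡ m) (*-monoˡ-< m 1<n)

private
  0≤y-x : ∀ {x y} → x ℤ.≤ y → y ℤ.≤ (+ 1 ℤ.+ + 1) ℤ.* y ℤ.- + 1 ℤ.* x
  0≤y-x {x} {y} x≤y = subst₂ ℤ._≤_ (ℤ.+-identityʳ y) (eq x y) (ℤ.+-monoʳ-≤ y (ℤ.i≤j⇒0≤j-i x≤y))
    where eq : ∀ x y → y ℤ.+ (y ℤ.- x) ≡ (+ 1 ℤ.+ + 1) ℤ.* y ℤ.- + 1 ℤ.* x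
          eq = ℤ-Solver.solve-∀

  i≤i+i : ∀ {i} → + 0 ℤ.≤ i → i ℤ.≤ (+ 1 ℤ.+ + 1) ℤ.* i
  i≤i+i {i} 0≤i = subst₂ ℤ._≤_ (ℤ.+-identityʳ i) (eq i) (ℤ.+-monoʳ-≤ i 0≤i)
    where eq : ∀ i → i ℤ.+ i ≡ (+ 1 ℤ.+ + 1) ℤ.* i
          eq = ℤ-Solver.solve-∀

r-monotone : ∀ b p → Prime p → χ p ≡ + 1 → (∀ j → j < b → .{{_ : NonZero j}} → + 0 ℤ.≤ r j) →
  ∀ k .{{_ : NonZero k}} → k < b → r k ℤ.≤ r (p * k)
r-monotone (suc b) p pp χp≡1 r≥0 k k<1+b with p ∣? k
... | no p∤k = subst (r k ℤ.≤_) (sym (trans (Hecke.hecke-∤ p pp p∤k) (cong (λ x → (+ 1 ℤ.+ x) ℤ.* r k) χp≡1))) (i≤i+i (r≥0 k k<1+b))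
... | yes (divides-refl k′) = subst₂ ℤ._≤_ (cong r (*-comm p k′))
    (sym (trans (cong (λ x → r (p * x)) (*-comm k′ p)) (trans (Hecke.hecke-∣ p pp k′)
      (cong (λ x → (+ 1 ℤ.+ x) ℤ.* r (p * k′) ℤ.- x ℤ.* r k′) χp≡1))))
    (0≤y-x (r-monotone b p pp χp≡1 (λ j j<b → r≥0 j (m<n⇒m<1+n j<b)) k′ (<-≤-trans k′<k (≤-pred k<1+b))))
  where
  instance _ = m*n≢0⇒m≢0 k′ {p}
  k′<k : k′ < k′ * p
  k′<k = m<m*n k′ p (nonTrivial⇒n>1 p {{ℙ.prime⇒nonTrivial pp}})

r-nonNegative-< : ∀ b n .{{_ : NonZero n}} → n < b → + 0 ℤ.≤ r n
r-nonNegative-< (suc b) 1 _ = subst (+ 0 ℤ.≤_) (sym (r-def 1)) (ℤ.+≤+ z≤n)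
r-nonNegative-< (suc b) n@(2+ _) n<1+b with prime-factor n (s≤s (s≤s z≤n))
... | p , m , pp , n≡pm , m≢0 , m<n = subst (λ x → + 0 ℤ.≤ r x) (sym n≡pm) (by-cases (χ-cases p) (p ∣? m))
  where
  open Hecke p pp
  instance _ = m≢0
  m<b = <-≤-trans m<n (≤-pred n<1+b)
  IH : ∀ j → j < b → .{{_ : NonZero j}} → + 0 ℤ.≤ r j
  IH j j<b = r-nonNegative-< b j j<b
  eq₀ : ∀ x → (+ 1 ℤ.+ + 0) ℤ.* x ≡ x
  eq₀ = ℤ-Solver.solve-∀
  eq₁ : ∀ x y → (+ 1 ℤ.+ + 0) ℤ.* x ℤ.- + 0 ℤ.* y ≡ x
  eq₁ = ℤ-Solver.solve-∀
  eq₂ : ∀ x → (+ 1 ℤ.+ -[1+ 0 ]) ℤ.* x ≡ + 0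
  eq₂ = ℤ-Solver.solve-∀
  eq₃ : ∀ x y → (+ 1 ℤ.+ -[1+ 0 ]) ℤ.* x ℤ.- -[1+ 0 ] ℤ.* y ≡ y
  eq₃ = ℤ-Solver.solve-∀
  by-cases : χ p ≡ + 0 ⊎ χ p ≡ + 1 ⊎ χ p ≡ -[1+ 0 ] → Dec (p ∣ m) → + 0 ℤ.≤ r (p * m)
  by-cases (inj₂ (inj₁ χp≡1)) _ = ℤ.≤-trans (IH m m<b) (r-monotone b p pp χp≡1 IH m m<b)
  by-cases (inj₁ χp≡0) (no p∤m) =
    subst (+ 0 ℤ.≤_) (sym (trans (hecke-∤ p∤m) (trans (cong (λ x → (+ 1 ℤ.+ x) ℤ.* r m) χp≡0) (eq₀ (r m))))) (IH m m<b)
  by-cases (inj₂ (inj₂ χp≡-1)) (no p∤m) =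
    subst (+ 0 ℤ.≤_) (sym (trans (hecke-∤ p∤m) (trans (cong (λ x → (+ 1 ℤ.+ x) ℤ.* r m) χp≡-1) (eq₂ (r m))))) ℤ.≤-refl
  by-cases χp (yes (divides k m≡kp)) = case χp of λ
    { (inj₁ χp≡0) → subst (+ 0 ℤ.≤_) (sym (trans r≡ (trans (cong (λ x → (+ 1 ℤ.+ x) ℤ.* r m ℤ.- x ℤ.* r k) χp≡0) (eq₁ (r m) (r k))))) (IH m m<b)
    ; (inj₂ (inj₁ χp≡1)) → ℤ.≤-trans (IH m m<b) (r-monotone b p pp χp≡1 IH m m<b)
    ; (inj₂ (inj₂ χp≡-1)) → subst (+ 0 ℤ.≤_) (sym (trans r≡ (trans (cong (λ x → (+ 1 ℤ.+ x) ℤ.* r m ℤ.- x ℤ.* r k) χp≡-1) (eq₃ (r m) (r k))))) (IH k (≤-<-trans k≤m m<b)) }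
    where
    instance
      k≢0 : NonZero k
      k≢0 = m*n≢0⇒m≢0 k {p} {{subst NonZero m≡kp m≢0}}
      p≢0 : NonZero p
      p≢0 = ℙ.prime⇒nonZero pp
    m≡pk : m ≡ p * k
    m≡pk = trans m≡kp (*-comm k p)
    k≤m : k ≤ m
    k≤m = subst (k ≤_) (sym m≡kp) (m≤m*n k p)
    r≡ : r (p * m) ≡ (+ 1 ℤ.+ χ p) ℤ.* r m ℤ.- χ p ℤ.* r k
    r≡ = trans (cong (λ x → r (p * x)) m≡pk) (trans (hecke-∣ k) (cong (λ x → (+ 1 ℤ.+ χ p) ℤ.* r x ℤ.- χ p ℤ.* r k) (sym m≡pk)))

r-nonNegative : ∀ n .{{_ : NonZero n}} → + 0 ℤ.≤ r n
r-nonNegative n = r-nonNegative-< (suc n) n ≤-refl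

rⁿ : ℕ → ℕ
rⁿ n = ∣ r n ∣

+rⁿ≡r : ∀ n .{{_ : NonZero n}} → + rⁿ n ≡ r n
+rⁿ≡r n = ℤ.0≤i⇒+∣i∣≡i (r-nonNegative n)

module _ (p : ℕ) (pp : Prime p) where
  open Hecke p pp

  private instance
    p≢0 : NonZero p
    p≢0 = ℙ.prime⇒nonZero pp

  rⁿ-*-split : χ p ≡ + 1 → ∀ m .{{_ : NonZero m}} → rⁿ (p * m) ≤ 2 * rⁿ m
  rⁿ-*-split χp≡1 m = ℤ.drop‿+≤+ (subst₂ ℤ._≤_ (sym (+rⁿ≡r (p * m) {{m*n≢0 p m}}))
    (trans (cong (+ 2 ℤ.*_) (sym (+rⁿ≡r m))) (sym (ℤ.pos-* 2 (rⁿ m)))) (bound (p ∣? m)))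
    where
    eq : ∀ x y → + 2 ℤ.* x ℤ.- ((+ 1 ℤ.+ + 1) ℤ.* x ℤ.- + 1 ℤ.* y) ≡ y
    eq = ℤ-Solver.solve-∀
    bound : Dec (p ∣ m) → r (p * m) ℤ.≤ + 2 ℤ.* r m
    bound (no p∤m)  = ℤ.≤-reflexive (trans (hecke-∤ p∤m) (cong (λ x → (+ 1 ℤ.+ x) ℤ.* r m) χp≡1))
    bound (yes (divides-refl k)) = subst (ℤ._≤ + 2 ℤ.* r (k * p))
      (sym (trans (cong (λ x → r (p * x)) (*-comm k p)) (trans (hecke-∣ k) (trans (cong (λ x → (+ 1 ℤ.+ x) ℤ.* r (p * k) ℤ.- x ℤ.* r k) χp≡1)
        (cong (λ x → (+ 1 ℤ.+ + 1) ℤ.* r x ℤ.- + 1 ℤ.* r k) (*-comm p k))))))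
      (ℤ.0≤i-j⇒j≤i (subst (+ 0 ℤ.≤_) (sym (eq (r (k * p)) (r k))) (r-nonNegative k)))
      where instance _ = m*n≢0⇒m≢0 k {p}

  rⁿ-*-ramified : χ p ≡ + 0 → ∀ m .{{_ : NonZero m}} → rⁿ (p * m) ≡ rⁿ m
  rⁿ-*-ramified χp≡0 m = cong ∣_∣ (trans (hecke m) (trans (cong (λ x → (+ 1 ℤ.+ x) ℤ.* r m ℤ.- x ℤ.* V) χp≡0) (eq (r m) V)))
    where
    V = ∑ᶻ (suc (p * m)) (λ d → χ d ℤ.* ι (p * d ∣? m))
    eq : ∀ x y → (+ 1 ℤ.+ + 0) ℤ.* x ℤ.- + 0 ℤ.* y ≡ x
    eq = ℤ-Solver.solve-∀

  rⁿ-*-inert-∤ : χ p ≡ -[1+ 0 ] → ∀ m .{{_ : NonZero m}} → ¬ p ∣ m → rⁿ (p * m) ≡ 0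
  rⁿ-*-inert-∤ χp≡-1 m p∤m = cong ∣_∣ (trans (hecke-∤ p∤m) (trans (cong (λ x → (+ 1 ℤ.+ x) ℤ.* r m) χp≡-1) (eq (r m))))
    where eq : ∀ x → (+ 1 ℤ.+ -[1+ 0 ]) ℤ.* x ≡ + 0
          eq = ℤ-Solver.solve-∀

  rⁿ-*-inert-∣ : χ p ≡ -[1+ 0 ] → ∀ k .{{_ : NonZero k}} → rⁿ (p * (p * k)) ≡ rⁿ k
  rⁿ-*-inert-∣ χp≡-1 k = cong ∣_∣ (trans (hecke-∣ k) (trans (cong (λ x → (+ 1 ℤ.+ x) ℤ.* r (p * k) ℤ.- x ℤ.* r k) χp≡-1) (eq (r (p * k)) (r k))))
    where eq : ∀ x y → (+ 1 ℤ.+ -[1+ 0 ]) ℤ.* x ℤ.- -[1+ 0 ] ℤ.* y ≡ y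
          eq = ℤ-Solver.solve-∀

ιⁿ : ∀ {P : Set} → Dec P → ℕ
ιⁿ d = ∣ ι d ∣

ιⁿ-yes : ∀ {P : Set} {d : Dec P} → P → ιⁿ d ≡ 1
ιⁿ-yes {d = d} p = cong ∣_∣ (ι-yes {d = d} p)

ιⁿ-no : ∀ {P : Set} {d : Dec P} → ¬ P → ιⁿ d ≡ 0
ιⁿ-no {d = d} ¬p = cong ∣_∣ (ι-no {d = d} ¬p)

ιⁿ-cong : ∀ {P Q : Set} (d : Dec P) (e : Dec Q) → (P → Q) → (Q → P) → ιⁿ d ≡ ιⁿ e
ιⁿ-cong d e f g = cong ∣_∣ (ι-cong d e f g)

ιⁿ-mono : ∀ {P Q : Set} (d : Dec P) (e : Dec Q) → (P → Q) → ιⁿ d ≤ ιⁿ e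
ιⁿ-mono (yes p) e f = ≤-reflexive (sym (ιⁿ-yes {d = e} (f p)))
ιⁿ-mono (no _)  e f = z≤n

∑-multiples-suc : ∀ X p .{{_ : NonZero p}} (f : ℕ → ℕ) → (∀ n → ¬ p ∣ n → f n ≡ 0) →
  ∑ X (λ i → f (suc i)) ≡ ∑ (X / p) (λ i → f (p * suc i))
∑-multiples-suc X p f off = begin
  ∑ X (λ i → f (suc i))                     ≡⟨ ℕ∑.sum-cong X (λ i i<X → inside (suc i) (s≤s z≤n) i<X) ⟨
  ∑ X (λ i → f′ (suc i))                    ≡⟨ cong (_+ ∑ X (λ i → f′ (suc i))) f′0≡0 ⟨
  f′ 0 + ∑ X (λ i → f′ (suc i))             ≡⟨ ℕ∑.sum-head X f′ ⟨
  ∑ (suc X) f′                              ≡⟨ ℕ∑.sum-multiples (suc X) p f′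
                                                 (λ n p∤n → trans (cong (ιⁿ (range? n) *_) (off n p∤n)) (*-zeroʳ (ιⁿ (range? n))))
                                                 (λ n X<n → outside n λ (_ , n≤X) → <⇒≱ X<n n≤X) ⟩
  ∑ (suc X) (λ m → f′ (p * m))              ≡⟨ ℕ∑.sum-window 1 (X / p) (λ m → f′ (p * m)) (s≤s (m/n≤m X p))
                                                 (λ { zero _ → trans (cong f′ (*-zeroʳ p)) f′0≡0 ; (suc _) (s≤s ()) })
                                                 (λ m X/p<m → outside (p * m) λ (_ , pm≤X) → <⇒≱ (<-≤-trans (m<suc[m/n]*n X p) (≤-trans (*-monoˡ-≤ p X/p<m) (≤-reflexive (*-comm m p)))) pm≤X) ⟩
  ∑ (X / p) (λ i → f′ (p * suc i))          ≡⟨ ℕ∑.sum-cong (X / p) (λ i i<X/p → inside (p * suc i)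
                                                 (≤-trans (>-nonZero⁻¹ p) (m≤m*n p (suc i)))
                                                 (≤-trans (*-monoʳ-≤ p i<X/p) (≤-trans (≤-reflexive (*-comm p (X / p))) (m/n*n≤m X p)))) ⟩
  ∑ (X / p) (λ i → f (p * suc i))           ∎
  where
  open ≡-Reasoning
  range? : ∀ n → Dec (1 ≤ n × n ≤ X)
  range? n = 1 ≤? n ×-dec n ≤? X
  f′ : ℕ → ℕ
  f′ n = ιⁿ (range? n) * f n
  inside : ∀ n → 1 ≤ n → n ≤ X → f′ n ≡ f n
  inside n 1≤n n≤X = trans (cong (_* f n) (ιⁿ-yes {d = range? n} (1≤n , n≤X))) (*-identityˡ (f n))
  outside : ∀ n → ¬ (1 ≤ n × n ≤ X) → f′ n ≡ 0
  outside n out = cong (_* f n) (ιⁿ-no {d = range? n} out)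
  f′0≡0 : f′ 0 ≡ 0
  f′0≡0 = outside 0 λ { (() , _) }

∑-multiples-count : ∀ X d .{{_ : NonZero d}} → ∑ X (λ i → ιⁿ (d ∣? suc i)) ≡ X / d
∑-multiples-count X d = trans (∑-multiples-suc X d (λ n → ιⁿ (d ∣? n)) λ n d∤n → ιⁿ-no {d = d ∣? n} d∤n)
  (trans (ℕ∑.sum-≗ (X / d) λ i → ιⁿ-yes {d = d ∣? d * suc i} (m∣m*n (suc i))) (trans (∑-const (X / d) 1) (*-identityʳ (X / d))))

∑r : ℕ → ℕ
∑r X = ∑ X λ i → rⁿ (suc i)

private
  +-telescoping : ∀ k (a b : ℕ → ℕ) → (∀ j → b j ≤ a j) →
    ∑ᶻ k (λ j → + a j ℤ.- + b j) ≡ + ∑ k (λ j → a j ∸ b j)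
  +-telescoping k a b b≤a = trans (ℤ∑.sum-≗ k λ j → trans (ℤ.m-n≡m⊖n (a j) (b j)) (ℤ.⊖-≥ (b≤a j))) (∑ᶻ-+ k _)

  alternating-≤ : ∀ k (a b : ℕ → ℕ) → (∀ j → b j ≤ a j) → (∀ j → a (suc j) ≤ b j) →
    ∑ k (λ j → a j ∸ b j) + a k ≤ a 0
  alternating-≤ zero    a b b≤a a≤b = ≤-refl
  alternating-≤ (suc k) a b b≤a a≤b = ≤-trans (≤-reflexive (+-assoc (∑ k (λ j → a j ∸ b j)) (a k ∸ b k) (a (suc k))))
    (≤-trans (+-monoʳ-≤ (∑ k (λ j → a j ∸ b j)) (≤-trans (+-monoʳ-≤ (a k ∸ b k) (a≤b k)) (≤-reflexive (m∸n+n≡m (b≤a k)))))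
             (alternating-≤ k a b b≤a a≤b))

  ∑r≡ : ∀ X → ∑r X ≡ ∑ (suc X) (λ j → X / suc (j * 4) ∸ X / (3 + j * 4))
  ∑r≡ X = ℤ.+-injective (begin
    + ∑r X
      ≡⟨ ∑ᶻ-+ X (λ i → rⁿ (suc i)) ⟨
    ∑ᶻ X (λ i → + rⁿ (suc i))
      ≡⟨ ℤ∑.sum-cong X (λ i i<X → trans (+rⁿ≡r (suc i)) (r≡divisor-sum {M} (<-≤-trans (s≤s i<X) (m≤m*n (suc X) 4)))) ⟩
    ∑ᶻ X (λ i → ∑ᶻ M λ d → χ d ℤ.* ι (d ∣? suc i))
      ≡⟨ ℤ∑.sum-swap X M _ ⟩
    ∑ᶻ M (λ d → ∑ᶻ X λ i → χ d ℤ.* ι (d ∣? suc i))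
      ≡⟨ ℤ∑.sum-≗ M (λ d → ℤ∑.sum-⊗ˡ X (χ d) _) ⟩
    ∑ᶻ (suc X * 4) (λ d → χ d ℤ.* cnt d)
      ≡⟨ ℤ∑.sum-blocks (suc X) 4 (λ d → χ d ℤ.* cnt d) ⟩
    ∑ᶻ (suc X) (λ j → + 0 ℤ.+ term j 0 ℤ.+ term j 1 ℤ.+ term j 2 ℤ.+ term j 3)
      ≡⟨ ℤ∑.sum-≗ (suc X) four ⟩
    ∑ᶻ (suc X) (λ j → + (X / suc (j * 4)) ℤ.- + (X / (3 + j * 4)))
      ≡⟨ +-telescoping (suc X) _ _ (λ j → /-monoʳ-≤ X (m≤n+m (suc (j * 4)) 2)) ⟩
    + ∑ (suc X) (λ j → X / suc (j * 4) ∸ X / (3 + j * 4)) ∎)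
    where
    open ≡-Reasoning
    M = suc X * 4
    cnt : ℕ → ℤ
    cnt d = ∑ᶻ X (λ i → ι (d ∣? suc i))
    term : ℕ → ℕ → ℤ
    term j c = χ (j * 4 + c) ℤ.* cnt (j * 4 + c)
    cnt≡ : ∀ d .{{_ : NonZero d}} → cnt d ≡ + (X / d)
    cnt≡ d = trans (ℤ∑.sum-≗ X λ i → ι≡ (d ∣? suc i)) (trans (∑ᶻ-+ X _) (cong +_ (∑-multiples-count X d)))
      where
      ι≡ : ∀ {P : Set} (d : Dec P) → ι d ≡ + ιⁿ d
      ι≡ (yes _) = refl
      ι≡ (no _)  = refl
    χ-class : ∀ j c → χ (j * 4 + c) ≡ χ c
    χ-class j c = cong χ₄ (trans (cong (_% 4) (+-comm (j * 4) c)) ([m+kn]%n≡m%n c j 4))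
    four : ∀ j → + 0 ℤ.+ term j 0 ℤ.+ term j 1 ℤ.+ term j 2 ℤ.+ term j 3 ≡ + (X / suc (j * 4)) ℤ.- + (X / (3 + j * 4))
    four j = trans
      (cong₂ ℤ._+_ (cong₂ ℤ._+_ (cong₂ (λ x y → + 0 ℤ.+ x ℤ.+ y)
          (cong (ℤ._* cnt (j * 4 + 0)) (χ-class j 0))
          (cong₂ ℤ._*_ (χ-class j 1) (trans (cong cnt (+-comm (j * 4) 1)) (cnt≡ (suc (j * 4))))))
          (cong (ℤ._* cnt (j * 4 + 2)) (χ-class j 2)))
        (cong₂ ℤ._*_ (χ-class j 3) (trans (cong cnt (+-comm (j * 4) 3)) (cnt≡ (3 + j * 4)))))
      (eq (cnt (j * 4 + 0)) (+ (X / suc (j * 4))) (cnt (j * 4 + 2)) (+ (X / (3 + j * 4))))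
      where eq : ∀ a b c d → + 0 ℤ.+ + 0 ℤ.* a ℤ.+ + 1 ℤ.* b ℤ.+ + 0 ℤ.* c ℤ.+ -[1+ 0 ] ℤ.* d ≡ b ℤ.- d
            eq = ℤ-Solver.solve-∀

∑r≤ : ∀ X → ∑r X ≤ X
∑r≤ X = ≤-trans (≤-reflexive (∑r≡ X)) (≤-trans (m≤m+n _ _)
  (≤-trans (alternating-≤ (suc X) (λ j → X / suc (j * 4)) (λ j → X / (3 + j * 4))
             (λ j → /-monoʳ-≤ X (m≤n+m (suc (j * 4)) 2)) (λ j → /-monoʳ-≤ X (m≤n+m (3 + j * 4) 2)))
           (≤-reflexive (n/1≡n X))))

2X≤3∑r : ∀ X → 2 * X ≤ 3 * ∑r X
2X≤3∑r X = begin
  2 * X                       ≡⟨ m+n∸n≡m (2 * X) X ⟨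
  2 * X + X ∸ X               ≡⟨ cong (_∸ X) (+-comm (2 * X) X) ⟩
  3 * X ∸ X                   ≤⟨ ∸-monoʳ-≤ (3 * X) (≤-trans (≤-reflexive (*-comm 3 (X / 3))) (m/n*n≤m X 3)) ⟩
  3 * X ∸ 3 * (X / 3)         ≡⟨ *-distribˡ-∸ 3 X (X / 3) ⟨
  3 * (X ∸ X / 3)             ≡⟨ cong (λ x → 3 * (x ∸ X / 3)) (n/1≡n X) ⟨
  3 * (X / 1 ∸ X / 3)         ≤⟨ *-monoʳ-≤ 3 (∑-term {suc X} (λ j → X / suc (j * 4) ∸ X / (3 + j * 4)) {0} z<s) ⟩
  3 * ∑ (suc X) (λ j → X / suc (j * 4) ∸ X / (3 + j * 4))  ≡⟨ cong (3 *_) (∑r≡ X) ⟨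
  3 * ∑r X                    ∎
  where open ≤-Reasoning

-- The p-adic valuation, truncated at J.
v : ℕ → ℕ → ℕ → ℕ
v J p n = ∑ J λ j → ιⁿ (p ^ suc j ∣? n)

∑rv : ℕ → ℕ → ℕ → ℕ
∑rv J p X = ∑ X λ i → rⁿ (suc i) * v J p (suc i)

v-∤ : ∀ J p n → ¬ p ∣ n → v J p n ≡ 0
v-∤ J p n p∤n = ℕ∑.sum-zero J λ j _ → ιⁿ-no {d = p ^ suc j ∣? n} λ p^∣n → p∤n (∣-trans (m∣m*n (p ^ j)) p^∣n)

v-* : ∀ J p m .{{_ : NonZero p}} → v (suc J) p (p * m) ≡ suc (v J p m)
v-* J p m = trans (ℕ∑.sum-head J λ j → ιⁿ (p ^ suc j ∣? p * m))
  (cong₂ _+_ (ιⁿ-yes {d = p ^ 1 ∣? p * m} (subst (_∣ p * m) (sym (^-identityʳ p)) (m∣m*n m)))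
             (ℕ∑.sum-≗ J λ j → ιⁿ-cong (p ^ (2 + j) ∣? p * m) (p ^ suc j ∣? m) (*-cancelˡ-∣ p) (*-monoʳ-∣ p)))

∑rv-suc : ∀ J p X .{{_ : NonZero p}} → ∑rv (suc J) p X ≡ ∑ (X / p) λ i → rⁿ (p * suc i) * suc (v J p (suc i))
∑rv-suc J p X = trans (∑-multiples-suc X p (λ n → rⁿ n * v (suc J) p n) λ n p∤n →
    trans (cong (rⁿ n *_) (v-∤ (suc J) p n p∤n)) (*-zeroʳ (rⁿ n)))
  (ℕ∑.sum-≗ (X / p) λ i → cong (rⁿ (p * suc i) *_) (v-* J p (suc i)))

p*[X/p]≤X : ∀ p X .{{_ : NonZero p}} → p * (X / p) ≤ X
p*[X/p]≤X p X = ≤-trans (≤-reflexive (*-comm p (X / p))) (m/n*n≤m X p)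

private
  ∑-r*suc : ∀ Y (f : ℕ → ℕ) → ∑ Y (λ i → rⁿ (suc i) * suc (f (suc i))) ≡ ∑r Y + ∑ Y (λ i → rⁿ (suc i) * f (suc i))
  ∑-r*suc Y f = trans (ℕ∑.sum-≗ Y λ i → *-suc (rⁿ (suc i)) (f (suc i))) (ℕ∑.sum-⊕ Y _ _)

module _ (p : ℕ) (pp : Prime p) where

  private
    instance
      p≢0 : NonZero p
      p≢0 = ℙ.prime⇒nonZero pp
    2≤p : 2 ≤ p
    2≤p = nonTrivial⇒n>1 p {{ℙ.prime⇒nonTrivial pp}}

  ∑rv-split-≤ : χ p ≡ + 1 → 4 ≤ p → ∀ J X → p * ∑rv J p X ≤ 4 * X
  ∑rv-split-≤ χp≡1 4≤p zero    X = ≤-trans (≤-reflexive (trans (cong (p *_) (ℕ∑.sum-zero X λ i _ → *-zeroʳ (rⁿ (suc i)))) (*-zeroʳ p))) z≤n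
  ∑rv-split-≤ χp≡1 4≤p (suc J) X = begin
    p * ∑rv (suc J) p X                                               ≡⟨ cong (p *_) (∑rv-suc J p X) ⟩
    p * ∑ Y (λ i → rⁿ (p * suc i) * suc (v J p (suc i)))            ≤⟨ *-monoʳ-≤ p (∑-mono Y λ i _ → *-monoˡ-≤ (suc (v J p (suc i))) (rⁿ-*-split p pp χp≡1 (suc i))) ⟩
    p * ∑ Y (λ i → 2 * rⁿ (suc i) * suc (v J p (suc i)))            ≡⟨ cong (p *_) (trans (ℕ∑.sum-≗ Y λ i → *-assoc 2 (rⁿ (suc i)) _) (trans (ℕ∑.sum-⊗ˡ Y 2 _) (cong (2 *_) (∑-r*suc Y (v J p))))) ⟩
    p * (2 * (∑r Y + ∑rv J p Y))                                      ≡⟨ eq₁ p (∑r Y) (∑rv J p Y) ⟩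
    2 * (p * ∑r Y) + 2 * (p * ∑rv J p Y)                              ≤⟨ +-mono-≤ (*-monoʳ-≤ 2 (≤-trans (*-monoʳ-≤ p (∑r≤ Y)) (p*[X/p]≤X p X)))
                                                                                (*-monoʳ-≤ 2 (≤-trans (∑rv-split-≤ χp≡1 4≤p J Y) (≤-trans (*-monoˡ-≤ Y 4≤p) (p*[X/p]≤X p X)))) ⟩
    2 * X + 2 * X                                                   ≡⟨ eq₂ X ⟩
    4 * X                                                           ∎
    where
    open ≤-Reasoning
    Y = X / p
    eq₁ : ∀ p a b → p * (2 * (a + b)) ≡ 2 * (p * a) + 2 * (p * b)
    eq₁ = solve-∀
    eq₂ : ∀ x → 2 * x + 2 * x ≡ 4 * x
    eq₂ = solve-∀

  ∑rv-ramified-≤ : χ p ≡ + 0 → ∀ J X → ∑rv J p X ≤ X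
  ∑rv-ramified-≤ χp≡0 zero    X = ≤-trans (≤-reflexive (ℕ∑.sum-zero X λ i _ → *-zeroʳ (rⁿ (suc i)))) z≤n
  ∑rv-ramified-≤ χp≡0 (suc J) X = begin
    ∑rv (suc J) p X                                                   ≡⟨ ∑rv-suc J p X ⟩
    ∑ Y (λ i → rⁿ (p * suc i) * suc (v J p (suc i)))                ≡⟨ ℕ∑.sum-≗ Y (λ i → cong (_* suc (v J p (suc i))) (rⁿ-*-ramified p pp χp≡0 (suc i))) ⟩
    ∑ Y (λ i → rⁿ (suc i) * suc (v J p (suc i)))                    ≡⟨ ∑-r*suc Y (v J p) ⟩
    ∑r Y + ∑rv J p Y                                                  ≤⟨ +-mono-≤ (∑r≤ Y) (∑rv-ramified-≤ χp≡0 J Y) ⟩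
    Y + Y                                                           ≡⟨ cong (λ x → Y + x) (+-identityʳ Y) ⟨
    2 * Y                                                           ≤⟨ ≤-trans (*-monoˡ-≤ Y 2≤p) (p*[X/p]≤X p X) ⟩
    X                                                               ∎
    where
    open ≤-Reasoning
    Y = X / p

  ∑rv-inert-≤ : χ p ≡ -[1+ 0 ] → ∀ J X → p * p * ∑rv (J + J) p X ≤ 3 * X
  ∑rv-inert-≤ χp≡-1 zero    X = ≤-trans (≤-reflexive (trans (cong (p * p *_) (ℕ∑.sum-zero X λ i _ → *-zeroʳ (rⁿ (suc i)))) (*-zeroʳ (p * p)))) z≤n
  ∑rv-inert-≤ χp≡-1 (suc J) X = begin
    p * p * ∑rv (suc (J + suc J)) p X                                 ≡⟨ cong (λ j → p * p * ∑rv (suc j) p X) (+-suc J J) ⟩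
    p * p * ∑rv (2 + (J + J)) p X                                     ≡⟨ cong (p * p *_) unfolded ⟩
    p * p * (∑r Z + (∑r Z + ∑rv (J + J) p Z))                         ≡⟨ eq₁ (p * p) (∑r Z) (∑rv (J + J) p Z) ⟩
    2 * (p * p * ∑r Z) + p * p * ∑rv (J + J) p Z                      ≤⟨ +-mono-≤ (*-monoʳ-≤ 2 (≤-trans (*-monoʳ-≤ (p * p) (∑r≤ Z)) p²Z≤X)) (≤-trans (∑rv-inert-≤ χp≡-1 J Z) (≤-trans (*-monoˡ-≤ Z 3≤p²) p²Z≤X)) ⟩
    2 * X + X                                                       ≡⟨ +-comm (2 * X) X ⟩
    3 * X                                                           ∎
    where
    open ≤-Reasoning
    Y = X / p
    Z = Y / p
    eq₁ : ∀ p a b → p * (a + (a + b)) ≡ 2 * (p * a) + p * b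
    eq₁ = solve-∀
    3≤p² : 3 ≤ p * p
    3≤p² = ≤-trans (n≤1+n 3) (*-mono-≤ 2≤p 2≤p)
    p²Z≤X : p * p * Z ≤ X
    p²Z≤X = ≤-trans (≤-reflexive (*-assoc p p Z)) (≤-trans (*-monoʳ-≤ p (p*[X/p]≤X p Y)) (p*[X/p]≤X p X))
    unfolded : ∑rv (2 + (J + J)) p X ≡ ∑r Z + (∑r Z + ∑rv (J + J) p Z)
    unfolded = trans (∑rv-suc (suc (J + J)) p X)
      (trans (∑-multiples-suc Y p (λ m → rⁿ (p * m) * suc (v (suc (J + J)) p m)) off)
      (trans (ℕ∑.sum-≗ Z λ i → cong₂ _*_ (rⁿ-*-inert-∣ p pp χp≡-1 (suc i)) (cong suc (v-* (J + J) p (suc i))))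
      (trans (∑-r*suc Z (λ n → suc (v (J + J) p n))) (cong (λ x → ∑r Z + x) (∑-r*suc Z (v (J + J) p))))))
      where
      off : ∀ m → ¬ p ∣ m → rⁿ (p * m) * suc (v (suc (J + J)) p m) ≡ 0
      off zero      p∤0 = contradiction (p ∣0) p∤0
      off m@(suc _) p∤m = cong (_* suc (v (suc (J + J)) p m)) (rⁿ-*-inert-∤ p pp χp≡-1 m p∤m)

lg : ℕ → ℕ
lg zero    = 0
lg (suc n) with 2 ^ suc (lg n) ≤? suc n
... | yes _ = suc (lg n)
... | no _  = lg n

2^lg≤suc : ∀ n → 2 ^ lg (suc n) ≤ suc n
2^lg≤suc zero    = ≤-refl
2^lg≤suc (suc n) with 2 ^ suc (lg (suc n)) ≤? 2+ n
... | yes le = le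
... | no _   = m≤n⇒m≤1+n (2^lg≤suc n)

2^lg≤ : ∀ n .{{_ : NonZero n}} → 2 ^ lg n ≤ n
2^lg≤ (suc n) = 2^lg≤suc n

<2^suc-lg : ∀ n → n < 2 ^ suc (lg n)
<2^suc-lg zero    = z<s
<2^suc-lg (suc n) with 2 ^ suc (lg n) ≤? suc n
... | yes _  = ≤-trans (s≤s (<2^suc-lg n)) (≤-trans (≤-reflexive (+-comm 1 (2 ^ suc (lg n))))
                 (≤-trans (+-monoʳ-≤ (2 ^ suc (lg n)) (m^n>0 2 (suc (lg n))))
                          (≤-reflexive (cong (λ x → 2 ^ suc (lg n) + x) (sym (+-identityʳ (2 ^ suc (lg n))))))))
... | no ¬le = ≰⇒> ¬le

2^-reflects-< : ∀ {a b} → 2 ^ a < 2 ^ b → a < b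
2^-reflects-< {a} {b} lt = ≰⇒> λ b≤a → <⇒≱ lt (^-monoʳ-≤ 2 b≤a)

lg-upper : ∀ {n k} .{{_ : NonZero n}} → n < 2 ^ k → lg n < k
lg-upper {n} n<2^k = 2^-reflects-< (≤-<-trans (2^lg≤ n) n<2^k)

lg-lower : ∀ {n k} → 2 ^ k ≤ n → k ≤ lg n
lg-lower {n} {k} 2^k≤n = ≤-pred (2^-reflects-< (≤-<-trans 2^k≤n (<2^suc-lg n)))

lg-* : ∀ m n .{{_ : NonZero m}} .{{_ : NonZero n}} → lg (m * n) ≤ suc (lg m) + lg n
lg-* m n = ≤-pred (subst (lg (m * n) <_) (+-suc (suc (lg m)) (lg n)) (lg-upper {{m*n≢0 m n}}
  (subst (m * n <_) (sym (^-distribˡ-+-* 2 (suc (lg m)) (suc (lg n)))) (*-mono-< (<2^suc-lg m) (<2^suc-lg n)))))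

weight : ℕ → ℕ
weight p = ιⁿ (prime? p) * suc (lg p)

lg≤∑ : ∀ J X n .{{_ : NonZero n}} → n ≤ X → n < 2 ^ J → lg n ≤ ∑ (suc X) λ p → weight p * v J p n
lg≤∑ J X 1 _ _ = z≤n
lg≤∑ zero X (2+ _) _ (s≤s ())
lg≤∑ (suc J) X n@(2+ _) n≤X n<2^ with prime-factor n (s≤s (s≤s z≤n))
... | p , m , pp , n≡pm , m≢0 , m<n = begin
  lg n                                                              ≡⟨ cong lg n≡pm ⟩
  lg (p * m)                                                        ≤⟨ lg-* p m ⟩
  suc (lg p) + lg m                                                 ≤⟨ +-monoʳ-≤ (suc (lg p)) (lg≤∑ J X m (≤-trans (<⇒≤ m<n) n≤X) m<2^J) ⟩
  suc (lg p) + ∑ (suc X) (λ q → weight q * v J q m)                 ≡⟨ cong (_+ ∑ (suc X) (λ q → weight q * v J q m)) single ⟨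
  ∑ (suc X) (λ q → weight q * ιⁿ (q ≟ p)) + ∑ (suc X) (λ q → weight q * v J q m)
                                                                    ≡⟨ trans (ℕ∑.sum-≗ (suc X) λ q → *-distribˡ-+ (weight q) (ιⁿ (q ≟ p)) (v J q m)) (ℕ∑.sum-⊕ (suc X) _ _) ⟨
  ∑ (suc X) (λ q → weight q * (ιⁿ (q ≟ p) + v J q m))               ≤⟨ ∑-mono (suc X) (λ q _ → *-monoʳ-≤ (weight q) (v-step q)) ⟩
  ∑ (suc X) (λ q → weight q * v (suc J) q n)                        ∎
  where
  open ≤-Reasoning
  instance
    _ = m≢0
    _ = ℙ.prime⇒nonZero pp
  p≤X : p ≤ X
  p≤X = ≤-trans (≤-trans (m≤m*n p m) (≤-reflexive (sym n≡pm))) n≤X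
  m<2^J : m < 2 ^ J
  m<2^J = *-cancelˡ-< 2 m (2 ^ J) (≤-<-trans (*-monoˡ-≤ m (nonTrivial⇒n>1 p {{ℙ.prime⇒nonTrivial pp}})) (subst (_< 2 ^ suc J) n≡pm n<2^))
  single : ∑ (suc X) (λ q → weight q * ιⁿ (q ≟ p)) ≡ suc (lg p)
  single = trans (ℕ∑.sum-single _ p (s≤s p≤X) λ q _ q≢p → trans (cong (weight q *_) (ιⁿ-no {d = q ≟ p} q≢p)) (*-zeroʳ (weight q)))
    (trans (cong₂ _*_ (trans (cong (_* suc (lg p)) (ιⁿ-yes {d = prime? p} pp)) (*-identityˡ (suc (lg p)))) (ιⁿ-yes {d = p ≟ p} refl)) (*-identityʳ (suc (lg p))))
  v-step : ∀ q → ιⁿ (q ≟ p) + v J q m ≤ v (suc J) q n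
  v-step q with q ≟ p
  ... | yes refl = ≤-reflexive (trans (sym (v-* J p m)) (cong (v (suc J) p) (sym n≡pm)))
  ... | no _     = ≤-trans (∑-mono J λ j _ → ιⁿ-mono (q ^ suc j ∣? m) (q ^ suc j ∣? n) λ q^∣m → subst (q ^ suc j ∣_) (sym n≡pm) (∣-trans q^∣m (n∣m*n p)))
                           (m≤m+n _ _)

-- Σ r n log n over n ≤ X = 2^{2k}, bounded below by log n ≥ k on n ≥ 2^k and above through the factorisation of n.
log-inequality : ∀ k J → 2 ≤ k → 2 ^ (k + k) < 2 ^ J →
  k * 2 ^ (k + k) ≤ 3 * ∑ (suc (2 ^ (k + k))) (λ p → weight p * ∑rv J p (2 ^ (k + k)))
log-inequality k J 2≤k X<2^J = +-cancelʳ-≤ (k * X) (k * X) _ (begin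
  k * X + k * X                                           ≡⟨ eq₁ k X ⟩
  k * (2 * X)                                             ≤⟨ *-monoʳ-≤ k (2X≤3∑r X) ⟩
  k * (3 * ∑r X)                                          ≡⟨ eq₂ k (∑r X) ⟩
  3 * (k * ∑r X)                                          ≤⟨ *-monoʳ-≤ 3 k∑r≤ ⟩
  3 * (∑ X (λ i → rⁿ (suc i) * lg (suc i)) + k * 2 ^ k)   ≤⟨ *-monoʳ-≤ 3 (+-monoˡ-≤ (k * 2 ^ k) swap≤) ⟩
  3 * (S + k * 2 ^ k)                                     ≡⟨ eq₃ S k (2 ^ k) ⟩
  3 * S + k * (3 * 2 ^ k)                                 ≤⟨ +-monoʳ-≤ (3 * S) (*-monoʳ-≤ k 3*2^k≤X) ⟩
  3 * S + k * X                                           ∎)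
  where
  open ≤-Reasoning
  X = 2 ^ (k + k)
  S = ∑ (suc X) (λ p → weight p * ∑rv J p X)
  eq₁ : ∀ k x → k * x + k * x ≡ k * (2 * x)
  eq₁ = solve-∀
  eq₂ : ∀ k x → k * (3 * x) ≡ 3 * (k * x)
  eq₂ = solve-∀
  eq₃ : ∀ s k y → 3 * (s + k * y) ≡ 3 * s + k * (3 * y)
  eq₃ = solve-∀
  X≡ : X ≡ 2 ^ k * 2 ^ k
  X≡ = ^-distribˡ-+-* 2 k k
  3*2^k≤X : 3 * 2 ^ k ≤ X
  3*2^k≤X = ≤-trans (*-monoˡ-≤ (2 ^ k) (≤-trans (n≤1+n 3) (^-monoʳ-≤ 2 2≤k))) (≤-reflexive (sym X≡))
  2^k≤X : 2 ^ k ≤ X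
  2^k≤X = ≤-trans (m≤n*m (2 ^ k) 3) 3*2^k≤X
  pointwise : ∀ i → k * rⁿ (suc i) ≤ rⁿ (suc i) * lg (suc i) + ιⁿ (i <? 2 ^ k) * (k * rⁿ (suc i))
  pointwise i with i <? 2 ^ k
  ... | yes _ = ≤-trans (≤-reflexive (sym (*-identityˡ (k * rⁿ (suc i))))) (m≤n+m (1 * (k * rⁿ (suc i))) (rⁿ (suc i) * lg (suc i)))
  ... | no i≮ = ≤-trans (≤-reflexive (*-comm k (rⁿ (suc i)))) (≤-trans (*-monoʳ-≤ (rⁿ (suc i)) (lg-lower (≤-trans (≮⇒≥ i≮) (n≤1+n i)))) (m≤m+n _ _))
  small : ∑ X (λ i → ιⁿ (i <? 2 ^ k) * (k * rⁿ (suc i))) ≤ k * 2 ^ k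
  small = begin
    ∑ X (λ i → ιⁿ (i <? 2 ^ k) * (k * rⁿ (suc i)))       ≡⟨ ℕ∑.sum-extend _ 2^k≤X (λ i 2^k≤i → cong (_* (k * rⁿ (suc i))) (ιⁿ-no {d = i <? 2 ^ k} (≤⇒≯ 2^k≤i))) ⟩
    ∑ (2 ^ k) (λ i → ιⁿ (i <? 2 ^ k) * (k * rⁿ (suc i))) ≡⟨ ℕ∑.sum-cong (2 ^ k) (λ i i< → trans (cong (_* (k * rⁿ (suc i))) (ιⁿ-yes {d = i <? 2 ^ k} i<)) (*-identityˡ (k * rⁿ (suc i)))) ⟩
    ∑ (2 ^ k) (λ i → k * rⁿ (suc i))                     ≡⟨ ℕ∑.sum-⊗ˡ (2 ^ k) k _ ⟩
    k * ∑r (2 ^ k)                                       ≤⟨ *-monoʳ-≤ k (∑r≤ (2 ^ k)) ⟩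
    k * 2 ^ k                                            ∎
  k∑r≤ : k * ∑r X ≤ ∑ X (λ i → rⁿ (suc i) * lg (suc i)) + k * 2 ^ k
  k∑r≤ = begin
    k * ∑r X                                             ≡⟨ ℕ∑.sum-⊗ˡ X k _ ⟨
    ∑ X (λ i → k * rⁿ (suc i))                           ≤⟨ ∑-mono X (λ i _ → pointwise i) ⟩
    ∑ X (λ i → rⁿ (suc i) * lg (suc i) + ιⁿ (i <? 2 ^ k) * (k * rⁿ (suc i)))  ≡⟨ ℕ∑.sum-⊕ X _ _ ⟩
    ∑ X (λ i → rⁿ (suc i) * lg (suc i)) + ∑ X (λ i → ιⁿ (i <? 2 ^ k) * (k * rⁿ (suc i)))  ≤⟨ +-monoʳ-≤ _ small ⟩
    ∑ X (λ i → rⁿ (suc i) * lg (suc i)) + k * 2 ^ k      ∎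
  swap≤ : ∑ X (λ i → rⁿ (suc i) * lg (suc i)) ≤ S
  swap≤ = begin
    ∑ X (λ i → rⁿ (suc i) * lg (suc i))
      ≤⟨ ∑-mono X (λ i i<X → *-monoʳ-≤ (rⁿ (suc i)) (lg≤∑ J X (suc i) i<X (≤-<-trans i<X X<2^J))) ⟩
    ∑ X (λ i → rⁿ (suc i) * ∑ (suc X) (λ p → weight p * v J p (suc i)))
      ≡⟨ ℕ∑.sum-≗ X (λ i → trans (sym (ℕ∑.sum-⊗ˡ (suc X) (rⁿ (suc i)) _)) (ℕ∑.sum-≗ (suc X) λ p → eq₄ (rⁿ (suc i)) (weight p) (v J p (suc i)))) ⟩
    ∑ X (λ i → ∑ (suc X) λ p → weight p * (rⁿ (suc i) * v J p (suc i)))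
      ≡⟨ ℕ∑.sum-swap X (suc X) _ ⟩
    ∑ (suc X) (λ p → ∑ X λ i → weight p * (rⁿ (suc i) * v J p (suc i)))
      ≡⟨ ℕ∑.sum-≗ (suc X) (λ p → ℕ∑.sum-⊗ˡ X (weight p) _) ⟩
    S ∎
    where eq₄ : ∀ r w v → r * (w * v) ≡ w * (r * v)
          eq₄ = solve-∀

-- Summing over scales

module CountWindow (ℓ lo : ℕ) (5≤ℓ : 5 ≤ ℓ) where
  open ShortInterval ℓ lo 5≤ℓ

  prime≡1? : ∀ p → Dec (Prime p × p % 4 ≡ 1)
  prime≡1? p = prime? p ×-dec p % 4 ≟ 1

  window-count≤ : σ^ 94 ≤ lo → lo + σ^ 92 < σ^ 96 →
    (∀ p → Prime p → lo < p → p ≤ lo + σ^ 92 → p % 4 ≡ 1 → ¬ Good p) →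
    ∑ (σ^ 92) (λ t → ιⁿ (prime≡1? (suc lo + t))) ≤ sieve-constant * (ℓ * ℓ * σ^ 91)
  window-count≤ h₁ h₂ none = begin
    ∑ (σ^ 92) (λ t → ιⁿ (prime≡1? (suc lo + t)))        ≤⟨ ∑-mono (σ^ 92) pointwise ⟩
    ∑ (σ^ 92) (λ t → f (suc lo + t))                    ≤⟨ m≤n+m _ _ ⟩
    ∑ (suc lo) f + ∑ (σ^ 92) (λ t → f (suc lo + t))     ≡⟨ ℕ∑.sum-split (suc lo) (σ^ 92) f ⟨
    ∑ (suc lo + σ^ 92) f                                ≤⟨ ∑-mono-range f (hi<N h₁ h₂) ⟩
    primes≡1 h₁ h₂                                      ≤⟨ primes≡1≤ h₁ h₂ none ⟩
    sieve-constant * (ℓ * ℓ * σ^ 91)                    ∎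
    where
    open ≤-Reasoning
    f : ℕ → ℕ
    f m = ∣ ι (In? h₁ h₂ m) ℤ.* π m ∣
    pointwise : ∀ t → t < σ^ 92 → ιⁿ (prime≡1? (suc lo + t)) ≤ f (suc lo + t)
    pointwise t t<Y = by-cases (prime≡1? (suc lo + t))
      where
      m = suc lo + t
      by-cases : (d : Dec (Prime m × m % 4 ≡ 1)) → ιⁿ d ≤ f m
      by-cases (no _) = z≤n
      by-cases (yes (pm , m%4≡1)) = ≤-reflexive (sym (cong ∣_∣ (cong₂ ℤ._*_
        (ι-yes {d = In? h₁ h₂ m} ((s≤s (m≤m+n lo t) , ≤-trans (≤-reflexive (sym (+-suc lo t))) (+-monoʳ-≤ lo t<Y)) , m%4≡1))
        (ι-yes {d = prime? m} pm))))

growth : ∀ a₀ C → 4 ≤ a₀ → a₀ * a₀ * (a₀ + 2) * C ≤ 2 ^ a₀ → ∀ m → let a = m + a₀ in a * a * (a + 2) * C ≤ 2 ^ a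
growth a₀ C 4≤a₀ base zero    = base
growth a₀ C 4≤a₀ base (suc m) = begin
  suc a * suc a * (suc a + 2) * C        ≤⟨ *-monoˡ-≤ C (step a (≤-trans 4≤a₀ (m≤n+m a₀ m))) ⟩
  2 * (a * a * (a + 2)) * C              ≡⟨ *-assoc 2 (a * a * (a + 2)) C ⟩
  2 * (a * a * (a + 2) * C)              ≤⟨ *-monoʳ-≤ 2 (growth a₀ C 4≤a₀ base m) ⟩
  2 * 2 ^ a                              ∎
  where
  open ≤-Reasoning
  a = m + a₀
  step : ∀ a → 4 ≤ a → suc a * suc a * (suc a + 2) ≤ 2 * (a * a * (a + 2))
  step a 4≤a with b , refl ← m≤n⇒∃[o]m+o≡n 4≤a = m+n≤o⇒m≤o _ {b * b * b + 11 * (b * b) + 33 * b + 17} (≤-reflexive (eq b))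
    where eq : ∀ b → (5 + b) * (5 + b) * (5 + b + 2) + (b * b * b + 11 * (b * b) + 33 * b + 17) ≡ 2 * ((4 + b) * (4 + b) * (4 + b + 2))
          eq = solve-∀

2^-suc-* : ∀ e ℓ → 2 ^ (suc ℓ * e) ≡ 2 ^ e * 2 ^ (ℓ * e)
2^-suc-* e ℓ = ^-distribˡ-+-* 2 e (ℓ * e)

2*2^≤ : ∀ e ℓ .{{_ : NonZero e}} → 2 * 2 ^ (ℓ * e) ≤ 2 ^ (suc ℓ * e)
2*2^≤ e ℓ = ^-monoʳ-≤ 2 {suc (ℓ * e)} {e + ℓ * e} (+-monoˡ-≤ (ℓ * e) (>-nonZero⁻¹ e))

2∣2^ : ∀ n .{{_ : NonZero n}} → 2 ∣ 2 ^ n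
2∣2^ (suc n) = m∣m*n (2 ^ n)

opaque
  -- Kept opaque because powers of two with literal exponents unfold exponentially.
  exponent : ℕ
  exponent = 94

opaque
  unfolding exponent

  exponent≡94 : exponent ≡ 94
  exponent≡94 = refl

ratio : ℕ
ratio = 2 ^ exponent

scale : ℕ → ℕ
scale ℓ = 2 ^ (ℓ * exponent)

private instance
  exponent≢0 : NonZero exponent
  exponent≢0 = subst NonZero (sym exponent≡94) _

scale≡ : ∀ ℓ → scale ℓ ≡ 2 ^ (ℓ * 94)
scale≡ ℓ = cong (λ e → 2 ^ (ℓ * e)) exponent≡94

scale-suc : ∀ ℓ → scale (suc ℓ) ≡ ratio * scale ℓ
scale-suc = 2^-suc-* exponent

2*scale≤ : ∀ ℓ → 2 * scale ℓ ≤ scale (suc ℓ)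
2*scale≤ ℓ = 2*2^≤ exponent ℓ

2∣scale : ∀ ℓ .{{_ : NonZero ℓ}} → 2 ∣ scale ℓ
2∣scale ℓ = 2∣2^ (ℓ * exponent) {{m*n≢0 ℓ exponent}}

scale-mono : ∀ {a b} → a ≤ b → scale a ≤ scale b
scale-mono {a} {b} a≤b = ^-monoʳ-≤ 2 (*-monoˡ-≤ exponent a≤b)

scale<2^ : ∀ ℓ k → ℓ * 94 < k → scale ℓ < 2 ^ k
scale<2^ ℓ k lt = subst (_< 2 ^ k) (sym (scale≡ ℓ)) (^-monoʳ-< 2 (s≤s (s≤s z≤n)) lt)

lg-scale : ∀ p ℓ .{{_ : NonZero p}} → p < scale ℓ → suc (lg p) ≤ 94 * ℓ
lg-scale p ℓ p< = subst (lg p <_) (*-comm ℓ 94) (lg-upper (subst (p <_) (scale≡ ℓ) p<))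

scale-constant : ℕ
scale-constant = ratio * (sieve-constant * 376)

opaque
  unfolding exponent sieve-constant

  growth-base : 200 * 200 * (200 + 2) * scale-constant ≤ 2 ^ 200
  growth-base = ≤ᵇ⇒≤ (200 * 200 * (200 + 2) * (2 ^ 94 * (4000000 * 376))) (2 ^ 200) _

scale-growth : ∀ m → let ℓ = m + 200 in ℓ * ℓ * (ℓ + 2) * scale-constant ≤ 2 ^ ℓ
scale-growth = growth 200 scale-constant (m≤m+n 4 196) growth-base

prime-χ≡0 : ∀ {p} → Prime p → χ p ≡ + 0 → p ≡ 2
prime-χ≡0 {p} pp χp≡0 with ℙ.prime⇒irreducible pp (m%n≡0⇒n∣m p 2 (trans (sym (m∣n⇒o%n%m≡o%m 2 4 p (divides 2 refl))) (table (p % 4) (m%n<n p 4) χp≡0)))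
  where
  table : ∀ a → a < 4 → χ₄ a ≡ + 0 → a % 2 ≡ 0
  table 0 _ _ = refl
  table 2 _ _ = refl
  table (suc (suc (suc (suc _)))) (s≤s (s≤s (s≤s (s≤s ())))) _
... | inj₂ 2≡p = sym 2≡p

χ≡1⇒%4≡1 : ∀ p → χ p ≡ + 1 → p % 4 ≡ 1
χ≡1⇒%4≡1 p = table (p % 4)
  where
  table : ∀ a → χ₄ a ≡ + 1 → a ≡ 1
  table 0 ()
  table 1 _ = refl
  table 2 ()
  table 3 ()
  table (suc (suc (suc (suc _)))) ()

%4≡1⇒χ≡1 : ∀ p → p % 4 ≡ 1 → χ p ≡ + 1
%4≡1⇒χ≡1 p p%4≡1 = cong χ₄ p%4≡1

prime≡1⇒4≤ : ∀ {p} → Prime p → p % 4 ≡ 1 → 4 ≤ p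
prime≡1⇒4≤ {p} pp p%4≡1 = ≮⇒≥ λ p<4 →
  contradiction (nonTrivial⇒n>1 p {{ℙ.prime⇒nonTrivial pp}}) (<⇒≱ (s≤s (≤-reflexive (trans (sym (m<n⇒m%n≡m p<4)) p%4≡1))))

-- Σ (1 + lg q) 3X / q² converges; the invariant is the closed form of Σ (i+1) / 2^i.
∑-inverse-squares : ∀ X (f : ℕ → ℕ) → f 0 ≡ 0 → (∀ q → q * q * f q ≤ suc (lg q) * (3 * X)) → ∀ i → ∑ (2 ^ i) f ≤ 12 * X
∑-inverse-squares X f f0≡0 f≤ i = *-cancelˡ-≤ (2 ^ i) {{m^n≢0 2 i}} (≤-trans (m≤m+n _ _) (≤-trans (invariant i) (≤-reflexive (*-comm (12 * X) (2 ^ i)))))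
  where
  open ≤-Reasoning
  block : ∀ i → 2 ^ i * ∑ (2 ^ i) (λ t → f (2 ^ i + t)) ≤ suc i * (3 * X)
  block i = begin
    2 ^ i * ∑ (2 ^ i) (λ t → f (2 ^ i + t))       ≡⟨ ℕ∑.sum-⊗ˡ (2 ^ i) (2 ^ i) _ ⟨
    ∑ (2 ^ i) (λ t → 2 ^ i * f (2 ^ i + t))       ≤⟨ ∑-average (2 ^ i) (suc i * (3 * X)) each ⟩
    suc i * (3 * X)                               ∎
    where
    instance _ = m^n≢0 2 i
    each : ∀ t → t < 2 ^ i → 2 ^ i * (2 ^ i * f (2 ^ i + t)) ≤ suc i * (3 * X)
    each t t<2^i = begin
      2 ^ i * (2 ^ i * f q)        ≡⟨ *-assoc (2 ^ i) (2 ^ i) (f q) ⟨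
      2 ^ i * 2 ^ i * f q          ≤⟨ *-monoˡ-≤ (f q) (*-mono-≤ (m≤m+n (2 ^ i) t) (m≤m+n (2 ^ i) t)) ⟩
      q * q * f q                  ≤⟨ f≤ q ⟩
      suc (lg q) * (3 * X)         ≤⟨ *-monoˡ-≤ (3 * X) (lg-upper {q} {suc i} {{>-nonZero (≤-trans (m^n>0 2 i) (m≤m+n (2 ^ i) t))}}
                                        (≤-trans (+-monoʳ-< (2 ^ i) t<2^i) (≤-reflexive (cong (λ x → 2 ^ i + x) (sym (+-identityʳ (2 ^ i))))))) ⟩
      suc i * (3 * X)              ∎
      where q = 2 ^ i + t
  invariant : ∀ i → 2 ^ i * ∑ (2 ^ i) f + (2 * i + 4) * (3 * X) ≤ 12 * X * 2 ^ i
  invariant zero rewrite f0≡0 = ≤-reflexive (eq X)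
    where eq : ∀ x → 4 * (3 * x) ≡ 12 * x * 1
          eq = solve-∀
  invariant (suc i) = begin
    2 ^ suc i * ∑ (2 ^ suc i) f + (2 * suc i + 4) * (3 * X)
      ≡⟨ cong (λ x → 2 ^ suc i * x + (2 * suc i + 4) * (3 * X)) (trans (cong (λ n → ∑ n f) (cong (λ x → 2 ^ i + x) (+-identityʳ (2 ^ i)))) (ℕ∑.sum-split (2 ^ i) (2 ^ i) f)) ⟩
    2 * 2 ^ i * (S + B) + (2 * suc i + 4) * (3 * X)
      ≡⟨ eq₁ (2 ^ i) S B i (3 * X) ⟩
    2 * (2 ^ i * S) + 2 * (2 ^ i * B) + (2 * i + 6) * (3 * X)
      ≤⟨ +-monoˡ-≤ ((2 * i + 6) * (3 * X)) (+-monoʳ-≤ (2 * (2 ^ i * S)) (*-monoʳ-≤ 2 (block i))) ⟩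
    2 * (2 ^ i * S) + 2 * (suc i * (3 * X)) + (2 * i + 6) * (3 * X)
      ≡⟨ eq₂ (2 ^ i * S) i (3 * X) ⟩
    2 * (2 ^ i * S + (2 * i + 4) * (3 * X))
      ≤⟨ *-monoʳ-≤ 2 (invariant i) ⟩
    2 * (12 * X * 2 ^ i)
      ≡⟨ eq₃ (12 * X) (2 ^ i) ⟩
    12 * X * 2 ^ suc i ∎
    where
    S = ∑ (2 ^ i) f
    B = ∑ (2 ^ i) (λ t → f (2 ^ i + t))
    eq₁ : ∀ p s b i x → 2 * p * (s + b) + (2 * suc i + 4) * x ≡ 2 * (p * s) + 2 * (p * b) + (2 * i + 6) * x
    eq₁ = solve-∀
    eq₂ : ∀ s i x → 2 * s + 2 * (suc i * x) + (2 * i + 6) * x ≡ 2 * (s + (2 * i + 4) * x)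
    eq₂ = solve-∀
    eq₃ : ∀ x p → 2 * (x * p) ≡ x * (2 * p)
    eq₃ = solve-∀

module Contradiction (ℓ₀ m : ℕ) (200≤ℓ₀ : 200 ≤ ℓ₀)
  (none : ∀ p → Prime p → scale ℓ₀ < p → p ≤ scale (suc (m + ℓ₀)) → p % 4 ≡ 1 → ¬ Good p) where

  L k half X c : ℕ
  L = m + ℓ₀
  k = L * 47
  half = suc k
  X = 2 ^ (k + k)
  c = ∑ (suc (scale ℓ₀)) (λ p → suc (lg p))

  X≡scale : X ≡ scale L
  X≡scale = trans (cong (2 ^_) (eq L)) (sym (scale≡ L))
    where eq : ∀ l → l * 47 + l * 47 ≡ l * 94
          eq = solve-∀

  prime≡1? : ∀ p → Dec (Prime p × p % 4 ≡ 1)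
  prime≡1? p = prime? p ×-dec p % 4 ≟ 1

  W₁ W₂ W₃ : ℕ → ℕ
  W₁ p = ιⁿ (prime≡1? p) * (suc (lg p) * ∑rv (half + half) p X)
  W₂ p = ιⁿ (p ≟ 2) * (2 * X)
  W₃ zero      = 0
  W₃ p@(suc _) = suc (lg p) * (3 * X / (p * p))

  W≤ : ∀ p → weight p * ∑rv (half + half) p X ≤ W₁ p + (W₂ p + W₃ p)
  W≤ p = by-cases (prime? p)
    where
    a = ∑rv (half + half) p X
    split-case : (pp : Prime p) → χ p ≡ + 1 → suc (lg p) * a ≤ W₁ p
    split-case pp χp≡1 = ≤-reflexive (sym (trans (cong (_* (suc (lg p) * a)) (ιⁿ-yes {d = prime≡1? p} (pp , χ≡1⇒%4≡1 p χp≡1))) (*-identityˡ _)))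
    ramified-case : (pp : Prime p) → χ p ≡ + 0 → suc (lg p) * a ≤ W₂ p
    ramified-case pp χp≡0 = ≤-trans (*-mono-≤ {suc (lg p)} {2} (subst (λ q → suc (lg q) ≤ 2) (sym p≡2) ≤-refl) (∑rv-ramified-≤ p pp χp≡0 (half + half) X))
      (≤-reflexive (sym (trans (cong (_* (2 * X)) (ιⁿ-yes {d = p ≟ 2} p≡2)) (*-identityˡ (2 * X)))))
      where p≡2 = prime-χ≡0 pp χp≡0
    inert-case : ∀ q .{{_ : NonZero q}} → Prime q → χ q ≡ -[1+ 0 ] → suc (lg q) * ∑rv (half + half) q X ≤ W₃ q
    inert-case q@(suc _) pq χq≡-1 = *-monoʳ-≤ (suc (lg q)) (≤-trans (≤-reflexive (sym (m*n/n≡m (∑rv (half + half) q X) (q * q))))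
      (/-monoˡ-≤ (q * q) (≤-trans (≤-reflexive (*-comm (∑rv (half + half) q X) (q * q))) (∑rv-inert-≤ q pq χq≡-1 half X))))
    by-cases : (d : Dec (Prime p)) → ιⁿ d * suc (lg p) * a ≤ W₁ p + (W₂ p + W₃ p)
    by-cases (no _)   = z≤n
    by-cases (yes pp) = ≤-trans (≤-reflexive (cong (_* a) (*-identityˡ (suc (lg p))))) (by-χ (χ-cases p))
      where
      by-χ : χ p ≡ + 0 ⊎ χ p ≡ + 1 ⊎ χ p ≡ -[1+ 0 ] → suc (lg p) * a ≤ W₁ p + (W₂ p + W₃ p)
      by-χ (inj₁ χp≡0)        = ≤-trans (ramified-case pp χp≡0) (≤-trans (m≤m+n (W₂ p) (W₃ p)) (m≤n+m (W₂ p + W₃ p) (W₁ p)))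
      by-χ (inj₂ (inj₁ χp≡1)) = ≤-trans (split-case pp χp≡1) (m≤m+n (W₁ p) (W₂ p + W₃ p))
      by-χ (inj₂ (inj₂ χp≡-1)) = ≤-trans (inert-case p {{ℙ.prime⇒nonZero pp}} pp χp≡-1) (≤-trans (m≤n+m (W₃ p) (W₂ p)) (m≤n+m (W₂ p + W₃ p) (W₁ p)))

  ∑rv≤X : ∀ p → Prime p → p % 4 ≡ 1 → ∑rv (half + half) p X ≤ X
  ∑rv≤X p pp p%4≡1 = *-cancelˡ-≤ 4 (≤-trans (*-monoˡ-≤ (∑rv (half + half) p X) (prime≡1⇒4≤ pp p%4≡1))
    (∑rv-split-≤ p pp (%4≡1⇒χ≡1 p p%4≡1) (prime≡1⇒4≤ pp p%4≡1) (half + half) X))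

  small-primes : ∑ (suc (scale ℓ₀)) W₁ ≤ c * X
  small-primes = ≤-trans (∑-mono (suc (scale ℓ₀)) λ p _ → each p (prime≡1? p)) (≤-reflexive (ℕ∑.sum-⊗ʳ (suc (scale ℓ₀)) X (λ p → suc (lg p))))
    where
    each : ∀ p (d : Dec (Prime p × p % 4 ≡ 1)) → ιⁿ d * (suc (lg p) * ∑rv (half + half) p X) ≤ suc (lg p) * X
    each p (no _)               = z≤n
    each p (yes (pp , p%4≡1))   = ≤-trans (≤-reflexive (*-identityˡ _)) (*-monoʳ-≤ (suc (lg p)) (∑rv≤X p pp p%4≡1))

  module AtScale (u : ℕ) (u<m : u < m) where

    ℓ : ℕ
    ℓ = u + ℓ₀

    open Powers (2 ^ ℓ) {{m^n≢0 2 ℓ}}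

    private
      σ = 2 ^ ℓ

    σ^94≡ : σ^ 94 ≡ scale ℓ
    σ^94≡ = trans (trans (σ^≡ 94) (^-*-assoc 2 ℓ 94)) (sym (scale≡ ℓ))

    n : ℕ
    n = ratio * σ^ 2

    n*Y≡ : n * σ^ 92 ≡ scale (suc ℓ)
    n*Y≡ = trans (*-assoc ratio (σ^ 2) (σ^ 92)) (trans (cong (ratio *_) (trans (σ^-* 2 92) σ^94≡)) (sym (scale-suc ℓ)))

    top≤ : scale ℓ + scale (suc ℓ) ≤ scale (2 + ℓ)
    top≤ = begin
      scale ℓ + scale (suc ℓ)            ≤⟨ +-monoˡ-≤ (scale (suc ℓ)) (scale-mono (n≤1+n ℓ)) ⟩
      scale (suc ℓ) + scale (suc ℓ)      ≡⟨ cong (λ x → scale (suc ℓ) + x) (+-identityʳ (scale (suc ℓ))) ⟨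
      2 * scale (suc ℓ)                  ≤⟨ 2*scale≤ (suc ℓ) ⟩
      scale (2 + ℓ)                      ∎
      where open ≤-Reasoning

    200≤ℓ : 200 ≤ ℓ
    200≤ℓ = ≤-trans 200≤ℓ₀ (m≤n+m ℓ₀ u)

    top<σ^96 : scale (2 + ℓ) < σ^ 96
    top<σ^96 = ≤-trans (scale<2^ (2 + ℓ) (ℓ * 96) exponent<) (≤-reflexive (sym (trans (σ^≡ 96) (^-*-assoc 2 ℓ 96))))
      where
      exponent< : (2 + ℓ) * 94 < ℓ * 96
      exponent< = ≤-trans (≤-trans (≤-reflexive (eq ℓ)) (+-monoʳ-≤ (ℓ * 94) (≤-trans (m≤m+n 189 11) (≤-trans 200≤ℓ (m≤m*n ℓ 2))))) (≤-reflexive (eq′ ℓ))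
        where
        eq : ∀ l → suc ((2 + l) * 94) ≡ l * 94 + 189
        eq = solve-∀
        eq′ : ∀ l → l * 94 + l * 2 ≡ l * 96
        eq′ = solve-∀

    q : ℕ → ℕ → ℕ
    q j t = suc (scale ℓ) + (j * σ^ 92 + t)

    q≡ : ∀ j t → q j t ≡ suc (scale ℓ + j * σ^ 92) + t
    q≡ j t = sym (+-assoc (suc (scale ℓ)) (j * σ^ 92) t)

    hi≤top : ∀ j → j < n → scale ℓ + j * σ^ 92 + σ^ 92 ≤ scale (2 + ℓ)
    hi≤top j j<n = begin
      scale ℓ + j * σ^ 92 + σ^ 92        ≡⟨ trans (+-assoc (scale ℓ) (j * σ^ 92) (σ^ 92)) (cong (λ x → scale ℓ + x) (+-comm (j * σ^ 92) (σ^ 92))) ⟩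
      scale ℓ + suc j * σ^ 92            ≤⟨ +-monoʳ-≤ (scale ℓ) (≤-trans (*-monoˡ-≤ (σ^ 92) j<n) (≤-reflexive n*Y≡)) ⟩
      scale ℓ + scale (suc ℓ)            ≤⟨ top≤ ⟩
      scale (2 + ℓ)                      ∎
      where open ≤-Reasoning

    count≤ : ∀ j → j < n → ∑ (σ^ 92) (λ t → ιⁿ (prime≡1? (q j t))) ≤ sieve-constant * (ℓ * ℓ * σ^ 91)
    count≤ j j<n = ≤-trans (≤-reflexive (ℕ∑.sum-≗ (σ^ 92) λ t → cong (λ x → ιⁿ (prime≡1? x)) (q≡ j t)))
      (CountWindow.window-count≤ ℓ lo (≤-trans (m≤m+n 5 195) 200≤ℓ) (≤-trans (≤-reflexive σ^94≡) (m≤m+n (scale ℓ) (j * σ^ 92)))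
        (≤-<-trans (hi≤top j j<n) top<σ^96)
        λ p pp lo<p p≤hi p%4≡1 → none p pp
          (≤-<-trans (≤-trans (scale-mono (m≤n+m ℓ₀ u)) (m≤m+n (scale ℓ) (j * σ^ 92))) lo<p)
          (≤-trans p≤hi (≤-trans (hi≤top j j<n) (scale-mono (s≤s (+-monoˡ-≤ ℓ₀ u<m))))) p%4≡1)
      where lo = scale ℓ + j * σ^ 92

    weight≤ : ∀ j t → j < n → t < σ^ 92 → σ^ 94 * W₁ (q j t) ≤ ιⁿ (prime≡1? (q j t)) * (376 * ((ℓ + 2) * X))
    weight≤ j t j<n t<Y = by-cases (prime≡1? p)
      where
      open ≤-Reasoning
      p = q j t
      p<top : p ≤ scale (2 + ℓ)
      p<top = ≤-trans (≤-trans (≤-reflexive (q≡ j t)) (≤-trans (≤-reflexive (sym (+-suc (scale ℓ + j * σ^ 92) t))) (+-monoʳ-≤ (scale ℓ + j * σ^ 92) t<Y))) (hi≤top j j<n)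
      by-cases : (d : Dec (Prime p × p % 4 ≡ 1)) → σ^ 94 * (ιⁿ d * (suc (lg p) * ∑rv (half + half) p X)) ≤ ιⁿ d * (376 * ((ℓ + 2) * X))
      by-cases (no _) = ≤-reflexive (*-zeroʳ (σ^ 94))
      by-cases (yes (pp , p%4≡1)) = begin
        σ^ 94 * (1 * (suc (lg p) * ∑rv (half + half) p X))      ≡⟨ eq₁ (σ^ 94) (suc (lg p)) (∑rv (half + half) p X) ⟩
        suc (lg p) * (σ^ 94 * ∑rv (half + half) p X)            ≤⟨ *-mono-≤ lg≤′ (≤-trans (*-monoˡ-≤ (∑rv (half + half) p X) σ^94≤p) (∑rv-split-≤ p pp (%4≡1⇒χ≡1 p p%4≡1) (prime≡1⇒4≤ pp p%4≡1) (half + half) X)) ⟩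
        94 * (ℓ + 2) * (4 * X)                          ≡⟨ eq₂ 94 4 (ℓ + 2) X ⟩
        1 * (94 * 4 * ((ℓ + 2) * X))                    ∎
        where
        eq₁ : ∀ s l a → s * (1 * (l * a)) ≡ l * (s * a)
        eq₁ = solve-∀
        eq₂ : ∀ a b l x → a * l * (b * x) ≡ 1 * (a * b * (l * x))
        eq₂ = solve-∀
        σ^94≤p : σ^ 94 ≤ p
        σ^94≤p = ≤-trans (≤-reflexive σ^94≡) (≤-trans (n≤1+n (scale ℓ)) (m≤m+n (suc (scale ℓ)) _))
        p≢top : p ≢ scale (2 + ℓ)
        p≢top p≡ = contradiction (prime≡1⇒odd pp p%4≡1) (λ odd → odd (subst (2 ∣_) (sym p≡) (2∣scale (2 + ℓ))))
          where
          prime≡1⇒odd : ∀ {p} → Prime p → p % 4 ≡ 1 → ¬ 2 ∣ p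
          prime≡1⇒odd {p} _ p%4≡1 2∣p = case trans (m∣n⇒o%n%m≡o%m 2 4 p (divides 2 refl)) (n∣m⇒m%n≡0 p 2 2∣p) of λ eq →
            case trans (sym (cong (_% 2) p%4≡1)) eq of λ ()
        lg≤′ : suc (lg p) ≤ 94 * (ℓ + 2)
        lg≤′ = ≤-trans (lg-scale p (2 + ℓ) (≤∧≢⇒< p<top p≢top)) (≤-reflexive (cong (94 *_) (+-comm 2 ℓ)))

    new-primes : ∑ (n * σ^ 92) (λ i → W₁ (suc (scale ℓ) + i)) ≤ X
    new-primes = *-cancelˡ-≤ (σ^ 94) (begin
      σ^ 94 * ∑ (n * σ^ 92) (λ i → W₁ (suc (scale ℓ) + i))
        ≡⟨ trans (cong (σ^ 94 *_) (ℕ∑.sum-blocks n (σ^ 92) _)) (trans (sym (ℕ∑.sum-⊗ˡ n (σ^ 94) _)) (ℕ∑.sum-≗ n λ j → sym (ℕ∑.sum-⊗ˡ (σ^ 92) (σ^ 94) _))) ⟩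
      ∑ n (λ j → ∑ (σ^ 92) λ t → σ^ 94 * W₁ (q j t))
        ≤⟨ ∑-≤-const n (sieve-constant * (ℓ * ℓ * σ^ 91) * (376 * ((ℓ + 2) * X))) each ⟩
      n * (sieve-constant * (ℓ * ℓ * σ^ 91) * (376 * ((ℓ + 2) * X)))
        ≡⟨ eq₁ ratio (σ^ 2) sieve-constant (ℓ * ℓ) (σ^ 91) 376 (ℓ + 2) X ⟩
      (ℓ * ℓ * (ℓ + 2) * (ratio * (sieve-constant * 376))) * (σ^ 2 * σ^ 91 * X)
        ≤⟨ *-monoˡ-≤ (σ^ 2 * σ^ 91 * X) small ⟩
      σ * (σ^ 2 * σ^ 91 * X)
        ≡⟨ trans (cong (λ x → σ * (x * X)) (σ^-* 2 91)) (trans (sym (*-assoc σ (σ^ 93) X)) (cong (_* X) (σ^-suc 93))) ⟩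
      σ^ 94 * X ∎)
      where
      open ≤-Reasoning
      eq₁ : ∀ a s c l y d e x → a * s * (c * (l * y) * (d * (e * x))) ≡ l * e * (a * (c * d)) * (s * y * x)
      eq₁ = solve-∀
      small : ℓ * ℓ * (ℓ + 2) * scale-constant ≤ σ
      small = subst (λ x → x * x * (x + 2) * scale-constant ≤ 2 ^ x) (m∸n+n≡m 200≤ℓ) (scale-growth (ℓ ∸ 200))
      each : ∀ j → j < n → ∑ (σ^ 92) (λ t → σ^ 94 * W₁ (q j t)) ≤ sieve-constant * (ℓ * ℓ * σ^ 91) * (376 * ((ℓ + 2) * X))
      each j j<n = begin
        ∑ (σ^ 92) (λ t → σ^ 94 * W₁ (q j t))                                    ≤⟨ ∑-mono (σ^ 92) (λ t t<Y → weight≤ j t j<n t<Y) ⟩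
        ∑ (σ^ 92) (λ t → ιⁿ (prime≡1? (q j t)) * (376 * ((ℓ + 2) * X)))         ≡⟨ ℕ∑.sum-⊗ʳ (σ^ 92) (376 * ((ℓ + 2) * X)) _ ⟩
        ∑ (σ^ 92) (λ t → ιⁿ (prime≡1? (q j t))) * (376 * ((ℓ + 2) * X))         ≤⟨ *-monoˡ-≤ (376 * ((ℓ + 2) * X)) (count≤ j j<n) ⟩
        sieve-constant * (ℓ * ℓ * σ^ 91) * (376 * ((ℓ + 2) * X))                ∎

    next-scale : ∑ (suc (scale (suc ℓ))) W₁ ≤ ∑ (suc (scale ℓ)) W₁ + X
    next-scale = begin
      ∑ (suc (scale (suc ℓ))) W₁                                                      ≤⟨ ∑-mono-range W₁ (s≤s (m≤n+m (scale (suc ℓ)) (scale ℓ))) ⟩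
      ∑ (suc (scale ℓ) + scale (suc ℓ)) W₁                                            ≡⟨ cong (λ x → ∑ (suc (scale ℓ) + x) W₁) n*Y≡ ⟨
      ∑ (suc (scale ℓ) + n * σ^ 92) W₁                                                ≡⟨ ℕ∑.sum-split (suc (scale ℓ)) (n * σ^ 92) W₁ ⟩
      ∑ (suc (scale ℓ)) W₁ + ∑ (n * σ^ 92) (λ i → W₁ (suc (scale ℓ) + i))             ≤⟨ +-monoʳ-≤ (∑ (suc (scale ℓ)) W₁) new-primes ⟩
      ∑ (suc (scale ℓ)) W₁ + X                                                        ∎
      where open ≤-Reasoning

  all-scales : ∀ u → u ≤ m → ∑ (suc (scale (u + ℓ₀))) W₁ ≤ (c + u) * X
  all-scales zero    _   = ≤-trans small-primes (≤-reflexive (cong (_* X) (sym (+-identityʳ c))))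
  all-scales (suc u) u<m = begin
    ∑ (suc (scale (suc u + ℓ₀))) W₁          ≤⟨ AtScale.next-scale u u<m ⟩
    ∑ (suc (scale (u + ℓ₀))) W₁ + X          ≤⟨ +-monoˡ-≤ X (all-scales u (<⇒≤ u<m)) ⟩
    (c + u) * X + X                          ≡⟨ eq c u X ⟩
    (c + suc u) * X                          ∎
    where
    open ≤-Reasoning
    eq : ∀ c u x → (c + u) * x + x ≡ (c + suc u) * x
    eq = solve-∀

  ∑W₂≤ : ∑ (suc X) W₂ ≤ 2 * X
  ∑W₂≤ = ≤-trans (≤-reflexive (ℕ∑.sum-⊗ʳ (suc X) (2 * X) _)) (≤-trans (*-monoˡ-≤ (2 * X) at-most-one) (≤-reflexive (*-identityˡ (2 * X))))
    where
    at-most-one : ∑ (suc X) (λ p → ιⁿ (p ≟ 2)) ≤ 1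
    at-most-one with 2 <? suc X
    ... | yes 2<1+X = ≤-trans (≤-reflexive (ℕ∑.sum-single _ 2 2<1+X λ p _ p≢2 → ιⁿ-no {d = p ≟ 2} p≢2)) ≤-refl
    ... | no 2≮1+X  = ≤-trans (≤-reflexive (ℕ∑.sum-zero (suc X) λ p p<1+X → ιⁿ-no {d = p ≟ 2} λ p≡2 → 2≮1+X (subst (_< suc X) p≡2 p<1+X))) z≤n

  ∑W₃≤ : ∑ (suc X) W₃ ≤ 12 * X
  ∑W₃≤ = ≤-trans (∑-mono-range W₃ 1+X≤) (∑-inverse-squares X W₃ refl bound (suc (k + k)))
    where
    1+X≤ : suc X ≤ 2 ^ suc (k + k)
    1+X≤ = ≤-trans (+-monoˡ-≤ X (m^n>0 2 (k + k))) (≤-reflexive (cong (λ x → X + x) (sym (+-identityʳ X))))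
    bound : ∀ q → q * q * W₃ q ≤ suc (lg q) * (3 * X)
    bound zero      = z≤n
    bound q@(suc _) = ≤-trans (≤-reflexive (eq (q * q) (suc (lg q)) (3 * X / (q * q)))) (*-monoʳ-≤ (suc (lg q)) (m/n*n≤m (3 * X) (q * q)))
      where eq : ∀ a b c → a * (b * c) ≡ b * (c * a)
            eq = solve-∀

  L*47≤ : L * 47 ≤ 3 * (c + m + (2 + 12))
  L*47≤ = *-cancelʳ-≤ (L * 47) _ X {{m^n≢0 2 (k + k)}} (begin
    k * X                                                       ≤⟨ log-inequality k (half + half) 2≤k (^-monoʳ-< 2 (s≤s (s≤s z≤n)) (+-mono-< (n<1+n k) (n<1+n k))) ⟩
    3 * ∑ (suc X) (λ p → weight p * ∑rv (half + half) p X)              ≤⟨ *-monoʳ-≤ 3 (∑-mono (suc X) λ p _ → W≤ p) ⟩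
    3 * ∑ (suc X) (λ p → W₁ p + (W₂ p + W₃ p))                  ≡⟨ cong (3 *_) (trans (ℕ∑.sum-⊕ (suc X) W₁ _) (cong (λ x → ∑ (suc X) W₁ + x) (ℕ∑.sum-⊕ (suc X) W₂ W₃))) ⟩
    3 * (∑ (suc X) W₁ + (∑ (suc X) W₂ + ∑ (suc X) W₃))          ≤⟨ *-monoʳ-≤ 3 (+-mono-≤ ∑W₁≤ (+-mono-≤ ∑W₂≤ ∑W₃≤)) ⟩
    3 * ((c + m) * X + (2 * X + 12 * X))                        ≡⟨ eq (c + m) 2 12 X ⟩
    3 * (c + m + (2 + 12)) * X                                  ∎)
    where
    open ≤-Reasoning
    eq : ∀ c a b x → 3 * (c * x + (a * x + b * x)) ≡ 3 * (c + (a + b)) * x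
    eq = solve-∀
    ∑W₁≤ : ∑ (suc X) W₁ ≤ (c + m) * X
    ∑W₁≤ = ≤-trans (≤-reflexive (cong (λ x → ∑ (suc x) W₁) X≡scale)) (all-scales m ≤-refl)
    2≤k : 2 ≤ k
    2≤k = ≤-trans (≤-trans (m≤m+n 2 198) (≤-trans 200≤ℓ₀ (m≤n+m ℓ₀ m))) (m≤m*n L 47)

good? : ∀ p → Dec (Good p)
good? p with anyUpTo? (λ j → 8 * (j * j) + j ≤? 2 * p ×-dec 2 * p ≤? 8 * (j * j) + 3 * j) (suc (2 * p))
... | yes (j , _ , le₁ , le₂) = yes (j , le₁ , le₂)
... | no none = no λ (j , le₁ , le₂) → none (j , s≤s (≤-trans (m≤n+m j (8 * (j * j))) le₁) , le₁ , le₂)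

n<2^n : ∀ n → n < 2 ^ n
n<2^n zero    = z<s
n<2^n (suc n) = ≤-trans (s≤s (n<2^n n)) (≤-trans (+-monoˡ-≤ (2 ^ n) (m^n>0 2 n)) (≤-reflexive (cong (λ x → 2 ^ n + x) (sym (+-identityʳ (2 ^ n))))))

infinitely-many-good : ∀ N → ∃[ p ] (N < p × Prime p × p % 4 ≡ 1 × Good p)
infinitely-many-good N = from-dec (anyUpTo? (λ p → N <? p ×-dec (prime? p ×-dec (p % 4 ≟ 1 ×-dec good? p))) (suc (scale (suc (m + ℓ₀)))))
  where
  ℓ₀ c m : ℕ
  ℓ₀ = N + 200
  c = ∑ (suc (scale ℓ₀)) (λ p → suc (lg p))
  m = suc c
  N≤scale : N ≤ scale ℓ₀
  N≤scale = ≤-trans (≤-trans (<⇒≤ (n<2^n N)) (^-monoʳ-≤ 2 (≤-trans (m≤m+n N 200) (m≤m*n ℓ₀ 94)))) (≤-reflexive (sym (scale≡ ℓ₀)))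
  from-dec : Dec (∃ λ p → p < suc (scale (suc (m + ℓ₀))) × (N < p × Prime p × p % 4 ≡ 1 × Good p)) →
             ∃[ p ] (N < p × Prime p × p % 4 ≡ 1 × Good p)
  from-dec (yes (p , _ , found)) = p , found
  from-dec (no none) = contradiction
    (Contradiction.L*47≤ ℓ₀ m (m≤n+m 200 N) λ p pp lo<p p≤hi p%4≡1 good → none (p , s≤s p≤hi , ≤-<-trans N≤scale lo<p , pp , p%4≡1 , good))
    (<⇒≱ (begin-strict
      3 * (c + m + 14)                             <⟨ n<1+n _ ⟩
      suc (3 * (c + m + 14))                       ≤⟨ m≤m+n _ (41 * c + 1) ⟩
      suc (3 * (c + suc c + 14)) + (41 * c + 1)    ≡⟨ eq c ⟩
      suc c * 47                                   ≤⟨ *-monoˡ-≤ 47 (m≤m+n m ℓ₀) ⟩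
      (m + ℓ₀) * 47                                ∎))
    where
    open ≤-Reasoning
    eq : ∀ c → suc (3 * (c + suc c + 14)) + (41 * c + 1) ≡ suc c * 47
    eq = solve-∀

-- Paley graphs

open import Defs

all-integers? : ∀ (f : ℤ → ℤ) B → (∀ x → B ≤ ∣ x ∣ → + 0 ℤ.≤ f x) → Dec (∀ x → + 0 ℤ.≤ f x)
all-integers? f B large with allUpTo? (λ n → + 0 ℤ.≤? f (+ n) ×-dec + 0 ℤ.≤? f (ℤ.- + n)) B
... | no ¬all = no λ all → ¬all λ {n} _ → all (+ n) , all (ℤ.- + n)
... | yes all = yes check
  where
  check : ∀ x → + 0 ℤ.≤ f x
  check x with B ≤? ∣ x ∣
  ... | yes B≤∣x∣ = large x B≤∣x∣
  check (+ n)    | no B≰ = proj₁ (all (≰⇒> B≰))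
  check -[1+ n ] | no B≰ = proj₂ (all {suc n} (≰⇒> B≰))

maximum : ∀ {P : ℕ → Set} b → (∀ y → y < b → Dec (P y)) → (∀ y → P y → y < b) →
  ∃[ r ] (((P r × (∀ y → P y → y ≤ r)) ⊎ ((∀ y → ¬ P y) × r ≡ 0)) × (P r → r < b))
maximum zero    P? bound = 0 , inj₂ ((λ y Py → contradiction (bound y Py) λ ()) , refl) , bound 0
maximum (suc b) P? bound with P? b ≤-refl
... | yes Pb = b , inj₁ (Pb , λ y Py → ≤-pred (bound y Py)) , λ _ → ≤-refl
... | no ¬Pb with maximum b (λ y y<b → P? y (m<n⇒m<1+n y<b)) (λ y Py → ≤∧≢⇒< (≤-pred (bound y Py)) λ { refl → ¬Pb Py })
...   | r , isMax , r< = r , isMax , m<n⇒m<1+n ∘ r<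

quadratic-nonNegative : ∀ u β γ x → .{{_ : NonZero u}} → ∣ β ∣ + ∣ γ ∣ ≤ ∣ x ∣ →
  + 0 ℤ.≤ + u ℤ.* (x ℤ.* x) ℤ.+ β ℤ.* x ℤ.+ γ
quadratic-nonNegative u β γ x large = subst (+ 0 ℤ.≤_)
  (trans (cong (ℤ._+ (β ℤ.* x ℤ.+ γ)) (trans (ℤ.pos-* u (∣ x ∣ * ∣ x ∣)) (cong (+ u ℤ.*_) (+∣i∣²≡i² x))))
         (sym (ℤ.+-assoc (+ u ℤ.* (x ℤ.* x)) (β ℤ.* x) γ)))
  (0≤+c+z (u * (∣ x ∣ * ∣ x ∣)) (β ℤ.* x ℤ.+ γ) (begin
    ∣ β ℤ.* x ℤ.+ γ ∣                     ≤⟨ ℤ.∣i+j∣≤∣i∣+∣j∣ (β ℤ.* x) γ ⟩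
    ∣ β ℤ.* x ∣ + ∣ γ ∣                   ≡⟨ cong (_+ ∣ γ ∣) (ℤ.∣i*j∣≡∣i∣*∣j∣ β x) ⟩
    ∣ β ∣ * ∣ x ∣ + ∣ γ ∣                 ≤⟨ +-monoʳ-≤ (∣ β ∣ * ∣ x ∣) (γ≤ ∣ x ∣ large) ⟩
    ∣ β ∣ * ∣ x ∣ + ∣ γ ∣ * ∣ x ∣         ≡⟨ *-distribʳ-+ (∣ x ∣) (∣ β ∣) (∣ γ ∣) ⟨
    (∣ β ∣ + ∣ γ ∣) * ∣ x ∣               ≤⟨ *-monoˡ-≤ ∣ x ∣ large ⟩
    ∣ x ∣ * ∣ x ∣                         ≤⟨ m≤n*m (∣ x ∣ * ∣ x ∣) u ⟩
    u * (∣ x ∣ * ∣ x ∣)                   ∎))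
  where
  open ≤-Reasoning
  0≤+c+z : ∀ c z → ∣ z ∣ ≤ c → + 0 ℤ.≤ + c ℤ.+ z
  0≤+c+z c (+ n)    _  = ℤ.+≤+ z≤n
  0≤+c+z c -[1+ n ] le = ℤ.i≤j⇒0≤j-i (ℤ.+≤+ le)
  γ≤ : ∀ a → ∣ β ∣ + ∣ γ ∣ ≤ a → ∣ γ ∣ ≤ ∣ γ ∣ * a
  γ≤ zero    le = ≤-trans (m+n≤o⇒n≤o ∣ β ∣ le) z≤n
  γ≤ (suc a) _  = m≤m*n ∣ γ ∣ (suc a)

module Parameters (m′ : ℕ) where

  M p : ℕ
  M = suc m′
  p = suc (4 * M)

  p≡ : + p ≡ + 1 ℤ.+ + 4 ℤ.* + M
  p≡ = cong (λ q → + 1 ℤ.+ q) (ℤ.pos-* 4 M)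

  k≡ : paley-k p ≡ + 2 ℤ.* + M
  k≡ = trans (cong +_ (trans (cong (_/ 2) (eq M)) (m*n/n≡m (2 * M) 2))) (ℤ.pos-* 2 M)
    where eq : ∀ n → 4 * n ≡ 2 * n * 2
          eq = solve-∀

  μ≡ : paley-μ p ≡ + M
  μ≡ = cong +_ (trans (cong (_/ 4) (*-comm 4 M)) (m*n/n≡m M 4))

  λ≡ : paley-λ p ≡ + M ℤ.- + 1
  λ≡ = cong +_ (trans (cong (λ q → (q ∸ 4) / 4) (*-suc 4 m′)) (trans (cong (_/ 4) (*-comm 4 m′)) (m*n/n≡m m′ 4)))

  private
    R-in : ℤ → ℤ → ℤ → ℤ → ℤ → ℤ → ℤ → ℤ
    R-in v k l μ x y d = x ℤ.* (x ℤ.+ + 1) ℤ.* (v ℤ.- y) ℤ.- + 2 ℤ.* x ℤ.* y ℤ.* k ℤ.+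
      (+ 2 ℤ.* x ℤ.+ l ℤ.- μ ℤ.+ + 1) ℤ.* y ℤ.* d ℤ.+ y ℤ.* (y ℤ.- + 1) ℤ.* μ ℤ.- y ℤ.* d ℤ.* d

  polynomial : ℤ → ℤ → ℤ → ℤ → ℤ
  polynomial v x y d = x ℤ.* (x ℤ.+ + 1) ℤ.* (v ℤ.- y) ℤ.- + 4 ℤ.* + M ℤ.* x ℤ.* y ℤ.+ + 2 ℤ.* x ℤ.* y ℤ.* d
    ℤ.+ y ℤ.* (y ℤ.- + 1) ℤ.* + M ℤ.- y ℤ.* d ℤ.* d

  R-polynomial : ∀ x y d → R p x y d ≡ polynomial (+ p) x y d
  R-polynomial x y d = trans
    (trans (cong₂ (λ k l → R-in (+ p) k l (paley-μ p) x y d) k≡ λ≡) (cong (λ μ → R-in (+ p) (+ 2 ℤ.* + M) (+ M ℤ.- + 1) μ x y d) μ≡))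
    (eq (+ p) x y d (+ M))
    where
    eq : ∀ v x y d M → x ℤ.* (x ℤ.+ + 1) ℤ.* (v ℤ.- y) ℤ.- + 2 ℤ.* x ℤ.* y ℤ.* (+ 2 ℤ.* M) ℤ.+
           (+ 2 ℤ.* x ℤ.+ (M ℤ.- + 1) ℤ.- M ℤ.+ + 1) ℤ.* y ℤ.* d ℤ.+ y ℤ.* (y ℤ.- + 1) ℤ.* M ℤ.- y ℤ.* d ℤ.* d ≡
         x ℤ.* (x ℤ.+ + 1) ℤ.* (v ℤ.- y) ℤ.- + 4 ℤ.* M ℤ.* x ℤ.* y ℤ.+ + 2 ℤ.* x ℤ.* y ℤ.* d
           ℤ.+ y ℤ.* (y ℤ.- + 1) ℤ.* M ℤ.- y ℤ.* d ℤ.* d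
    eq = ℤ-Solver.solve-∀

  even-value : ∀ d h → R p (+ h) (+ (2 * h)) d ≡
    + h ℤ.* (+ 2 ℤ.* + M ℤ.+ + 1 ℤ.- + h ℤ.- + 2 ℤ.* ((+ h ℤ.- d) ℤ.* (+ h ℤ.- d)))
  even-value d h = trans (R-polynomial (+ h) (+ (2 * h)) d)
    (trans (cong₂ (λ v y → polynomial v (+ h) y d) p≡ (ℤ.pos-* 2 h)) (eq (+ h) d (+ M)))
    where
    eq : ∀ h d M → h ℤ.* (h ℤ.+ + 1) ℤ.* (+ 1 ℤ.+ + 4 ℤ.* M ℤ.- + 2 ℤ.* h) ℤ.- + 4 ℤ.* M ℤ.* h ℤ.* (+ 2 ℤ.* h) ℤ.+ + 2 ℤ.* h ℤ.* (+ 2 ℤ.* h) ℤ.* d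
           ℤ.+ (+ 2 ℤ.* h) ℤ.* (+ 2 ℤ.* h ℤ.- + 1) ℤ.* M ℤ.- (+ 2 ℤ.* h) ℤ.* d ℤ.* d ≡
         h ℤ.* (+ 2 ℤ.* M ℤ.+ + 1 ℤ.- h ℤ.- + 2 ℤ.* ((h ℤ.- d) ℤ.* (h ℤ.- d)))
    eq = ℤ-Solver.solve-∀

  odd-value : ∀ d h → R p (+ h) (+ (1 + 2 * h)) d ≡
    + 2 ℤ.* + h ℤ.* (+ M ℤ.- (+ h ℤ.- d) ℤ.* (+ h ℤ.- d) ℤ.- (+ h ℤ.- d)) ℤ.- d ℤ.* d
  odd-value d h = trans (R-polynomial (+ h) (+ (1 + 2 * h)) d)
    (trans (cong₂ (λ v y → polynomial v (+ h) y d) p≡ (cong (λ q → + 1 ℤ.+ q) (ℤ.pos-* 2 h))) (eq (+ h) d (+ M)))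
    where
    eq : ∀ h d M → h ℤ.* (h ℤ.+ + 1) ℤ.* (+ 1 ℤ.+ + 4 ℤ.* M ℤ.- (+ 1 ℤ.+ + 2 ℤ.* h)) ℤ.- + 4 ℤ.* M ℤ.* h ℤ.* (+ 1 ℤ.+ + 2 ℤ.* h) ℤ.+ + 2 ℤ.* h ℤ.* (+ 1 ℤ.+ + 2 ℤ.* h) ℤ.* d
           ℤ.+ (+ 1 ℤ.+ + 2 ℤ.* h) ℤ.* (+ 1 ℤ.+ + 2 ℤ.* h ℤ.- + 1) ℤ.* M ℤ.- (+ 1 ℤ.+ + 2 ℤ.* h) ℤ.* d ℤ.* d ≡
         + 2 ℤ.* h ℤ.* (M ℤ.- (h ℤ.- d) ℤ.* (h ℤ.- d) ℤ.- (h ℤ.- d)) ℤ.- d ℤ.* d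
    eq = ℤ-Solver.solve-∀

SqrtLe-neg⇐ : ∀ p A B → B * B ≤ A * A * p → SqrtLe p (ℤ.- + A) (ℤ.- + B)
SqrtLe-neg⇐ p A B le = inj₁ (ℤ.neg-≤-pos {A} {0} , inj₂ (subst₂ ℤ._≤_
  (trans (ℤ.pos-* B B) (eq₁ (+ B)))
  (trans (ℤ.pos-* (A * A) p) (cong (ℤ._* + p) (trans (ℤ.pos-* A A) (eq₁ (+ A))))) (ℤ.+≤+ le)))
  where eq₁ : ∀ x → x ℤ.* x ≡ (ℤ.- x) ℤ.* (ℤ.- x)
        eq₁ = ℤ-Solver.solve-∀

SqrtLe-neg⇒ : ∀ p A B .{{_ : NonZero B}} → SqrtLe p (ℤ.- + A) (ℤ.- + B) → B * B ≤ A * A * p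
SqrtLe-neg⇒ p A       (suc B) (inj₁ (_ , inj₁ ()))
SqrtLe-neg⇒ p A       (suc B) (inj₁ (_ , inj₂ le)) = ℤ.drop‿+≤+ (subst₂ ℤ._≤_
  (trans (eq₁ (+ suc B)) (sym (ℤ.pos-* (suc B) (suc B))))
  (sym (trans (ℤ.pos-* (A * A) p) (cong (ℤ._* + p) (trans (ℤ.pos-* A A) (sym (eq₁ (+ A))))))) le)
  where eq₁ : ∀ x → (ℤ.- x) ℤ.* (ℤ.- x) ≡ x ℤ.* x
        eq₁ = ℤ-Solver.solve-∀
SqrtLe-neg⇒ p zero    (suc B) (inj₂ (ℤ.+<+ () , _))
SqrtLe-neg⇒ p (suc A) (suc B) (inj₂ (() , _))

module Paley (d m′ j′ : ℕ) (big : 8 * suc d ≤ suc j′)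
  (lower : 8 * (suc j′ * suc j′) + suc j′ ≤ 2 * suc (4 * suc m′))
  (upper : 2 * suc (4 * suc m′) ≤ 8 * (suc j′ * suc j′) + 3 * suc j′) where

  open Parameters m′

  j n : ℕ
  j = suc j′
  n = 2 * j + 2 * d

  even-gap : ∀ e → 2 * M + 1 < (j + e + d) + 2 * ((j + e) * (j + e))
  even-gap e = *-cancelˡ-< 4 _ _ (begin-strict
    4 * (2 * M + 1)                                          ≡⟨ eq₁ M ⟩
    2 * suc (4 * M) + 2                                      ≤⟨ +-monoˡ-≤ 2 upper ⟩
    8 * (j * j) + 3 * j + 2                                  <⟨ +-monoʳ-< (8 * (j * j) + 3 * j) 2<j ⟩
    8 * (j * j) + 3 * j + j                                  ≤⟨ m≤m+n _ (4 * e + 4 * d + 8 * (2 * (j * e) + e * e)) ⟩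
    8 * (j * j) + 3 * j + j + (4 * e + 4 * d + 8 * (2 * (j * e) + e * e))  ≡⟨ eq₂ j e d ⟩
    4 * ((j + e + d) + 2 * ((j + e) * (j + e)))              ∎)
    where
    open ≤-Reasoning
    2<j : 2 < j
    2<j = ≤-trans (m≤m+n 3 (5 + 8 * d)) (≤-trans (≤-reflexive (eq d)) big)
      where eq : ∀ d → 3 + (5 + 8 * d) ≡ 8 * suc d
            eq = solve-∀
    eq₁ : ∀ m → 4 * (2 * m + 1) ≡ 2 * suc (4 * m) + 2
    eq₁ = solve-∀
    eq₂ : ∀ j e d → 8 * (j * j) + 3 * j + j + (4 * e + 4 * d + 8 * (2 * (j * e) + e * e)) ≡ 4 * ((j + e + d) + 2 * ((j + e) * (j + e)))
    eq₂ = solve-∀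

  odd-gap : ∀ e → M < (j + e) * (j + e) + (j + e)
  odd-gap e = *-cancelˡ-< 8 _ _ (begin-strict
    8 * M                                           <⟨ m<m+n (8 * M) {2} z<s ⟩
    8 * M + 2                                       ≡⟨ eq₁ M ⟩
    2 * suc (4 * M)                                 ≤⟨ upper ⟩
    8 * (j * j) + 3 * j                             ≤⟨ m≤m+n _ (5 * j + 8 * e + 8 * (2 * (j * e) + e * e)) ⟩
    8 * (j * j) + 3 * j + (5 * j + 8 * e + 8 * (2 * (j * e) + e * e))  ≡⟨ eq₂ j e ⟩
    8 * ((j + e) * (j + e) + (j + e))               ∎)
    where
    open ≤-Reasoning
    eq₁ : ∀ m → 8 * m + 2 ≡ 2 * suc (4 * m)
    eq₁ = solve-∀
    eq₂ : ∀ j e → 8 * (j * j) + 3 * j + (5 * j + 8 * e + 8 * (2 * (j * e) + e * e)) ≡ 8 * ((j + e) * (j + e) + (j + e))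
    eq₂ = solve-∀

  private
    negative : ∀ {i k} → NonZero k → i ≡ ℤ.- + k → ¬ + 0 ℤ.≤ i
    negative {k = suc k} _ refl ()

    shift : ∀ a s h x → a ℤ.- h ℤ.- x ≡ (a ℤ.+ s) ℤ.- (h ℤ.+ x) ℤ.- s
    shift = ℤ-Solver.solve-∀

    cancel : ∀ x s → x ℤ.- x ℤ.- s ≡ ℤ.- s
    cancel = ℤ-Solver.solve-∀

    a+b-b : ∀ a b → (a ℤ.+ b) ℤ.- b ≡ a
    a+b-b = ℤ-Solver.solve-∀

  even-negative : ∀ e → let h = j + e + d in ¬ + 0 ℤ.≤ R p (+ h) (+ (2 * h)) (+ d)
  even-negative e = from-gap (m≤n⇒∃[o]m+o≡n (even-gap e))
    where
    h = j + e + d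
    from-gap : ∃[ t ] suc (2 * M + 1) + t ≡ h + 2 * ((j + e) * (j + e)) → ¬ + 0 ℤ.≤ R p (+ h) (+ (2 * h)) (+ d)
    from-gap (t , eq) = negative {k = h * suc t} (m*n≢0 h (suc t))
        (trans (even-value (+ d) h) (trans (cong (+ h ℤ.*_) inner) (trans (sym (ℤ.neg-distribʳ-* (+ h) (+ suc t))) (cong ℤ.-_ (sym (ℤ.pos-* h (suc t)))))))
      where
      S = + h ℤ.+ + 2 ℤ.* (+ (j + e) ℤ.* + (j + e))
      cast : + 2 ℤ.* + M ℤ.+ + 1 ℤ.+ + suc t ≡ S
      cast = trans (cong (λ x → x ℤ.+ + 1 ℤ.+ + suc t) (sym (ℤ.pos-* 2 M)))
        (trans (cong +_ (trans (+-suc (2 * M + 1) t) eq))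
               (cong (λ q → + h ℤ.+ q) (trans (ℤ.pos-* 2 ((j + e) * (j + e))) (cong (+ 2 ℤ.*_) (ℤ.pos-* (j + e) (j + e))))))
      inner : + 2 ℤ.* + M ℤ.+ + 1 ℤ.- + h ℤ.- + 2 ℤ.* ((+ h ℤ.- + d) ℤ.* (+ h ℤ.- + d)) ≡ ℤ.- + suc t
      inner = trans (cong (λ x → + 2 ℤ.* + M ℤ.+ + 1 ℤ.- + h ℤ.- + 2 ℤ.* (x ℤ.* x)) (a+b-b (+ (j + e)) (+ d)))
        (trans (shift (+ 2 ℤ.* + M ℤ.+ + 1) (+ suc t) (+ h) (+ 2 ℤ.* (+ (j + e) ℤ.* + (j + e))))
          (trans (cong (λ x → x ℤ.- S ℤ.- + suc t) cast) (cancel S (+ suc t))))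

  odd-negative : ∀ e → let h = j + e + d in ¬ + 0 ℤ.≤ R p (+ h) (+ (1 + 2 * h)) (+ d)
  odd-negative e = from-gap (m≤n⇒∃[o]m+o≡n (odd-gap e))
    where
    h = j + e + d
    from-gap : ∃[ t ] suc M + t ≡ (j + e) * (j + e) + (j + e) → ¬ + 0 ℤ.≤ R p (+ h) (+ (1 + 2 * h)) (+ d)
    from-gap (t , eq) = negative {k = 2 * h * suc t + d * d} (>-nonZero (≤-trans (s≤s z≤n) (m≤m+n (2 * h * suc t) (d * d))))
        (trans (odd-value (+ d) h) (trans (cong (λ x → + 2 ℤ.* + h ℤ.* x ℤ.- + d ℤ.* + d) inner)
          (trans (collect (+ 2 ℤ.* + h) (+ suc t) (+ d ℤ.* + d))
                 (cong ℤ.-_ (sym (cong₂ ℤ._+_ (trans (ℤ.pos-* (2 * h) (suc t)) (cong (ℤ._* + suc t) (ℤ.pos-* 2 h))) (ℤ.pos-* d d)))))))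
      where
      S = + (j + e) ℤ.* + (j + e) ℤ.+ + (j + e)
      cast : + M ℤ.+ + suc t ≡ S
      cast = trans (cong +_ (trans (+-suc M t) eq)) (cong (ℤ._+ + (j + e)) (ℤ.pos-* (j + e) (j + e)))
      collect : ∀ h s d → h ℤ.* (ℤ.- s) ℤ.- d ≡ ℤ.- (h ℤ.* s ℤ.+ d)
      collect = ℤ-Solver.solve-∀
      inner : + M ℤ.- (+ h ℤ.- + d) ℤ.* (+ h ℤ.- + d) ℤ.- (+ h ℤ.- + d) ≡ ℤ.- + suc t
      inner = trans (cong (λ x → + M ℤ.- x ℤ.* x ℤ.- x) (a+b-b (+ (j + e)) (+ d)))
        (trans (shift (+ M) (+ suc t) (+ (j + e) ℤ.* + (j + e)) (+ (j + e)))
          (trans (cong (λ x → x ℤ.- S ℤ.- + suc t) cast) (cancel S (+ suc t))))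

  -- For y ≥ n the defining inequality of S_d is violated at x = ⌊y / 2⌋.
  InS⇒<n : ∀ y → InS p d y → y < n
  InS⇒<n y (_ , _ , nonNegative) = ≰⇒> λ n≤y → by-parity n≤y (y % 2) (y / 2) (m≡m%n+[m/n]*n y 2) (m%n<n y 2)
    where
    reorder : ∀ j d e → j + d + e ≡ j + e + d
    reorder = solve-∀
    by-parity : n ≤ y → ∀ a b → y ≡ a + b * 2 → a < 2 → ⊥
    by-parity n≤y 0 b y≡ _ = even-case (m≤n⇒∃[o]m+o≡n {j + d} {b} (*-cancelˡ-≤ 2
        (≤-trans (≤-reflexive (*-distribˡ-+ 2 j d)) (≤-trans n≤y (≤-reflexive (trans y≡ (*-comm b 2)))))))
      where
      even-case : ∃[ e ] j + d + e ≡ b → ⊥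
      even-case (e , b≡) = even-negative e (subst₂ (λ h y → + 0 ℤ.≤ R p (+ h) (+ y) (+ d))
        (trans (sym b≡) (reorder j d e)) (trans y≡ (trans (*-comm b 2) (cong (2 *_) (trans (sym b≡) (reorder j d e))))) (nonNegative (+ b)))
    by-parity n≤y 1 b y≡ _ = odd-case (m≤n⇒∃[o]m+o≡n {j + d} {b} (≤-pred (*-cancelˡ-< 2 (j + d) (suc b)
        (≤-trans (s≤s (≤-trans (≤-reflexive (*-distribˡ-+ 2 j d)) (≤-trans n≤y (≤-reflexive y≡)))) (≤-reflexive (eq b))))))
      where
      eq : ∀ b → suc (1 + b * 2) ≡ 2 * suc b
      eq = solve-∀
      odd-case : ∃[ e ] j + d + e ≡ b → ⊥
      odd-case (e , b≡) = odd-negative e (subst₂ (λ h y → + 0 ℤ.≤ R p (+ h) (+ y) (+ d))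
        (trans (sym b≡) (reorder j d e)) (trans y≡ (cong suc (trans (*-comm b 2) (cong (2 *_) (trans (sym b≡) (reorder j d e)))))) (nonNegative (+ b)))
    by-parity _ (suc (suc _)) _ _ (s≤s (s≤s ()))

  4d<j : 4 * d < j
  4d<j = ≤-trans (m≤m+n (suc (4 * d)) (4 * d + 7)) (≤-trans (≤-reflexive (eq d)) big)
    where eq : ∀ d → suc (4 * d) + (4 * d + 7) ≡ 8 * suc d
          eq = solve-∀

  n<p : n < p
  n<p = *-cancelˡ-< 2 n p (begin-strict
    2 * (2 * j + 2 * d)                     ≡⟨ eq₁ j d ⟩
    4 * j + 4 * d                           <⟨ +-monoʳ-< (4 * j) 4d<j ⟩
    4 * j + j                               ≤⟨ +-monoˡ-≤ j (≤-trans (*-monoˡ-≤ j {4} {8} (m≤m+n 4 4)) (*-monoʳ-≤ 8 (m≤m*n j j))) ⟩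
    8 * (j * j) + j                         ≤⟨ lower ⟩
    2 * p                                   ∎)
    where
    open ≤-Reasoning
    eq₁ : ∀ j d → 2 * (2 * j + 2 * d) ≡ 4 * j + 4 * d
    eq₁ = solve-∀

  R-nonNegative? : ∀ y → y < n → Dec (∀ x → + 0 ℤ.≤ R p x (+ y) (+ d))
  R-nonNegative? y y<n = all-integers? (λ x → R p x (+ y) (+ d)) (∣ β ∣ + ∣ γ ∣)
    λ x le → subst (+ 0 ℤ.≤_) (sym (quadratic x)) (quadratic-nonNegative u β γ x le)
    where
    u : ℕ
    u = suc (p ∸ suc y)
    p≡y+u : + p ≡ + y ℤ.+ + u
    p≡y+u = cong +_ (trans (sym (m+[n∸m]≡n (<-trans y<n n<p))) (sym (+-suc y (p ∸ suc y))))
    β γ : ℤ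
    β = + u ℤ.- + 4 ℤ.* + M ℤ.* + y ℤ.+ + 2 ℤ.* + y ℤ.* + d
    γ = + y ℤ.* (+ y ℤ.- + 1) ℤ.* + M ℤ.- + y ℤ.* + d ℤ.* + d
    eq₁ : ∀ x y u d M → x ℤ.* (x ℤ.+ + 1) ℤ.* (y ℤ.+ u ℤ.- y) ℤ.- + 4 ℤ.* M ℤ.* x ℤ.* y ℤ.+ + 2 ℤ.* x ℤ.* y ℤ.* d
            ℤ.+ y ℤ.* (y ℤ.- + 1) ℤ.* M ℤ.- y ℤ.* d ℤ.* d ≡
          u ℤ.* (x ℤ.* x) ℤ.+ (u ℤ.- + 4 ℤ.* M ℤ.* y ℤ.+ + 2 ℤ.* y ℤ.* d) ℤ.* x ℤ.+ (y ℤ.* (y ℤ.- + 1) ℤ.* M ℤ.- y ℤ.* d ℤ.* d)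
    eq₁ = ℤ-Solver.solve-∀
    quadratic : ∀ x → R p x (+ y) (+ d) ≡ + u ℤ.* (x ℤ.* x) ℤ.+ β ℤ.* x ℤ.+ γ
    quadratic x = trans (R-polynomial x (+ y) (+ d))
      (trans (cong (λ v → polynomial v x (+ y) (+ d)) p≡y+u) (eq₁ x (+ y) (+ u) (+ d) (+ M)))

  InS? : ∀ y → y < n → Dec (InS p d y)
  InS? y y<n = (d <? y) ×-dec ((y ≤? p) ×-dec R-nonNegative? y y<n)

  rab : ∃[ r ] (IsRab p d r × r < n)
  rab = from-maximum (maximum n InS? InS⇒<n)
    where
    from-maximum : ∃[ r ] (IsRab p d r × (InS p d r → r < n)) → ∃[ r ] (IsRab p d r × r < n)
    from-maximum (r , inj₁ (r∈S , max) , r<)      = r , inj₁ (r∈S , max) , r< r∈S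
    from-maximum (r , inj₂ (empty , refl) , _) = 0 , inj₂ (empty , refl) , s≤s z≤n

  private
    bound≡ : ∀ B e → + p ℤ.* (+ 2 ℤ.* + d ℤ.+ + 1) ℤ.- + e ℤ.* (+ 2 ℤ.* paley-k p ℤ.+ + 1) ≡
      + p ℤ.* (+ 2 ℤ.* + d ℤ.+ + 1 ℤ.- + e) → e ≡ B + (2 * d + 1) →
      + p ℤ.* (+ 2 ℤ.* + d ℤ.+ + 1) ℤ.- + e ℤ.* (+ 2 ℤ.* paley-k p ℤ.+ + 1) ≡ ℤ.- + (p * B)
    bound≡ B e first refl = trans first (trans
      (cong (λ x → + p ℤ.* (x ℤ.+ + 1 ℤ.- + (B + (2 * d + 1)))) (sym (ℤ.pos-* 2 d)))
      (trans (eq (+ p) (+ (2 * d + 1)) (+ B)) (cong ℤ.-_ (sym (ℤ.pos-* p B)))))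
      where eq : ∀ p x b → p ℤ.* (x ℤ.- (b ℤ.+ x)) ≡ ℤ.- (p ℤ.* b)
            eq = ℤ-Solver.solve-∀

    2k+1≡p : + 2 ℤ.* paley-k p ℤ.+ + 1 ≡ + p
    2k+1≡p = trans (cong (λ k → + 2 ℤ.* k ℤ.+ + 1) k≡) (trans (eq (+ M)) (sym p≡))
      where eq : ∀ m → + 2 ℤ.* (+ 2 ℤ.* m) ℤ.+ + 1 ≡ + 1 ℤ.+ + 4 ℤ.* m
            eq = ℤ-Solver.solve-∀

    right-side : ∀ B e → e ≡ B + (2 * d + 1) →
      + p ℤ.* (+ 2 ℤ.* + d ℤ.+ + 1) ℤ.- + e ℤ.* (+ 2 ℤ.* paley-k p ℤ.+ + 1) ≡ ℤ.- + (p * B)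
    right-side B e = bound≡ B e (trans (cong (λ x → + p ℤ.* (+ 2 ℤ.* + d ℤ.+ + 1) ℤ.- + e ℤ.* x) 2k+1≡p) (eq (+ p) (+ 2 ℤ.* + d ℤ.+ + 1) (+ e)))
      where eq : ∀ p x e → p ℤ.* x ℤ.- e ℤ.* p ≡ p ℤ.* (x ℤ.- e)
            eq = ℤ-Solver.solve-∀

    left-side : ∀ e A → e + A ≡ p → + e ℤ.- + p ≡ ℤ.- + A
    left-side e A e+A≡p = trans (cong (λ q → + e ℤ.- + q) (sym e+A≡p)) (eq (+ e) (+ A))
      where eq : ∀ e a → e ℤ.- (e ℤ.+ a) ≡ ℤ.- a
            eq = ℤ-Solver.solve-∀

  4j²+4d≤p : 4 * (j * j) + 4 * d ≤ p
  4j²+4d≤p = *-cancelˡ-≤ 2 (begin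
    2 * (4 * (j * j) + 4 * d)      ≡⟨ eq j d ⟩
    8 * (j * j) + 8 * d            ≤⟨ +-monoʳ-≤ (8 * (j * j)) (≤-trans (*-monoʳ-≤ 8 (n≤1+n d)) big) ⟩
    8 * (j * j) + j                ≤⟨ lower ⟩
    2 * p                          ∎)
    where
    open ≤-Reasoning
    eq : ∀ j d → 2 * (4 * (j * j) + 4 * d) ≡ 8 * (j * j) + 8 * d
    eq = solve-∀

  n≤Haem : LeHaem p d (+ n)
  n≤Haem = from-difference (m≤n⇒∃[o]m+o≡n 4j²+4d≤p)
    where
    open ≤-Reasoning
    o : ℕ
    o = 2 * j′ + 1
    eq₀ : ∀ j d w → 2 * suc j + 2 * d + (2 * suc j * (2 * j + 1) + 2 * d + w) ≡ 4 * (suc j * suc j) + 4 * d + w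
    eq₀ = solve-∀
    eq₁ : ∀ j d → 2 * suc j + 2 * d ≡ (2 * j + 1) + (2 * d + 1)
    eq₁ = solve-∀
    eq₂ : ∀ p o → p * o * (p * o) ≡ p * (o * o) * p
    eq₂ = solve-∀
    eq₃ : ∀ j d w → (4 * (suc j * suc j) + 4 * d + w) * ((2 * j + 1) * (2 * j + 1)) +
        ((2 * j + 1) * (4 * d + 2 * (suc j * w) + w) + (2 * d + w) * (2 * d + w)) ≡
      (2 * suc j * (2 * j + 1) + 2 * d + w) * (2 * suc j * (2 * j + 1) + 2 * d + w)
    eq₃ = solve-∀
    from-difference : ∃[ w ] 4 * (j * j) + 4 * d + w ≡ p → LeHaem p d (+ n)
    from-difference (w , p≡w) =
      subst₂ (SqrtLe p) (sym (left-side n A (trans (eq₀ j′ d w) p≡w))) (sym (right-side o n (eq₁ j′ d))) (SqrtLe-neg⇐ p A (p * o) (begin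
        p * o * (p * o)             ≡⟨ eq₂ p o ⟩
        p * (o * o) * p             ≤⟨ *-monoˡ-≤ p (subst (λ q → q * (o * o) ≤ A * A) p≡w (≤-trans (m≤m+n _ _) (≤-reflexive (eq₃ j′ d w)))) ⟩
        A * A * p                   ∎))
      where
      A : ℕ
      A = 2 * j * o + 2 * d + w

  n+1≰Haem : ¬ LeHaem p d (+ n ℤ.+ + 1)
  n+1≰Haem le = from-difference (m≤n⇒∃[o]m+o≡n n<p)
    where
    open ≤-Reasoning
    eq₁ : ∀ j d → suc (2 * j + 2 * d) ≡ 2 * j + (2 * d + 1)
    eq₁ = solve-∀
    eq₂ : ∀ p x → p * x * (p * x) ≡ p * (x * x) * p
    eq₂ = solve-∀
    eq₃ : ∀ j → 2 * j * (2 * j) ≡ 4 * (j * j)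
    eq₃ = solve-∀
    from-difference : ∃[ A ] suc n + A ≡ p → ⊥
    from-difference (A , n+1+A≡p) = <⇒≱ A²<
      (*-cancelʳ-≤ (p * (2 * j * (2 * j))) (A * A) p (subst (_≤ A * A * p) (eq₂ p (2 * j))
        (SqrtLe-neg⇒ p A (p * (2 * j)) {{m*n≢0 p (2 * j)}}
          (subst₂ (SqrtLe p)
            (trans (cong (λ e → + e ℤ.- + p) (+-comm n 1)) (left-side (suc n) A n+1+A≡p))
            (trans (cong (λ e → + p ℤ.* (+ 2 ℤ.* + d ℤ.+ + 1) ℤ.- + e ℤ.* (+ 2 ℤ.* paley-k p ℤ.+ + 1)) (+-comm n 1)) (right-side (2 * j) (suc n) (eq₁ j d)))
            le))))
      where
      A<4j² : A < 4 * (j * j)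
      A<4j² = *-cancelˡ-< 2 _ _ (+-cancelˡ-< (4 * j + 4 * d) (2 * A) _ (begin-strict
        4 * j + 4 * d + 2 * A                    <⟨ m<m+n _ {2} z<s ⟩
        4 * j + 4 * d + 2 * A + 2                ≡⟨ eq₄ j d A ⟩
        2 * (suc n + A)                          ≡⟨ cong (2 *_) n+1+A≡p ⟩
        2 * p                                    ≤⟨ upper ⟩
        8 * (j * j) + 3 * j                      ≤⟨ m≤m+n _ (j + 4 * d) ⟩
        8 * (j * j) + 3 * j + (j + 4 * d)        ≡⟨ eq₅ j d ⟩
        4 * j + 4 * d + 2 * (4 * (j * j))        ∎))
        where
        eq₄ : ∀ j d a → 4 * j + 4 * d + 2 * a + 2 ≡ 2 * (suc (2 * j + 2 * d) + a)
        eq₄ = solve-∀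
        eq₅ : ∀ j d → 8 * (j * j) + 3 * j + (j + 4 * d) ≡ 4 * j + 4 * d + 2 * (4 * (j * j))
        eq₅ = solve-∀
      A²< : A * A < p * (2 * j * (2 * j))
      A²< = begin-strict
        A * A                                <⟨ *-mono-< A<4j² A<4j² ⟩
        4 * (j * j) * (4 * (j * j))          ≤⟨ *-mono-≤ (≤-trans (m≤m+n (4 * (j * j)) (4 * d)) 4j²+4d≤p) (≤-reflexive (sym (eq₃ j))) ⟩
        p * (2 * j * (2 * j))                ∎

  conclusion : ∃[ r ] ∃[ n ] (IsRab p d r × IsFloorHaem p d n × + r ℤ.< n)
  conclusion = proj₁ rab , + n , proj₁ (proj₂ rab) , (n≤Haem , n+1≰Haem) , ℤ.+<+ (proj₂ (proj₂ rab))

theorem6p8 : (d : ℕ) → (N : ℕ) →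
    ∃[ p ] (N < p × Prime p × p % 4 ≡ 1 ×
    ∃[ r ] ∃[ n ] (IsRab p d r × IsFloorHaem p d n × (+ r) ℤ.< n))
theorem6p8 d N with infinitely-many-good (N + 8 * (b * b))
  where b = 8 * suc d
... | p , bound<p , pp , p%4≡1 , j , lower , upper =
  p , ≤-<-trans (m≤m+n N (8 * (b * b))) bound<p , pp , p%4≡1 , from-quotient (p / 4) p≡
  where
  b = 8 * suc d
  p≡ : p ≡ suc (4 * (p / 4))
  p≡ = trans (m≡m%n+[m/n]*n p 4) (cong₂ _+_ p%4≡1 (*-comm (p / 4) 4))
  b≤j : b ≤ j
  b≤j = ≮⇒≥ λ j<b → <⇒≱ bound<p (*-cancelˡ-≤ 2 (≤-trans upper (≤-trans
    (+-mono-≤ (*-monoʳ-≤ 8 (*-mono-≤ (<⇒≤ j<b) (<⇒≤ j<b))) (≤-trans (*-monoʳ-≤ 3 (<⇒≤ j<b)) (*-mono-≤ {3} {8} (m≤m+n 3 5) (m≤m*n b b))))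
    (≤-trans (≤-reflexive (eq (8 * (b * b)))) (*-monoʳ-≤ 2 (m≤n+m (8 * (b * b)) N))))))
    where eq : ∀ x → x + x ≡ 2 * x
          eq = solve-∀
  from-quotient : ∀ M → p ≡ suc (4 * M) → ∃[ r ] ∃[ n ] (IsRab p d r × IsFloorHaem p d n × (+ r) ℤ.< n)
  from-quotient zero     refl = contradiction pp ℙ.¬prime[1]
  from-quotient (suc m′) refl = from-j j b≤j lower upper
    where
    from-j : ∀ j → b ≤ j → 8 * (j * j) + j ≤ 2 * p → 2 * p ≤ 8 * (j * j) + 3 * j →
      ∃[ r ] ∃[ n ] (IsRab p d r × IsFloorHaem p d n × (+ r) ℤ.< n)
    from-j (suc j′) b≤j lower upper = Paley.conclusion d m′ j′ b≤j lower upper
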